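{- The problem $\mathrm{SharedSynth}(\mathrm{FO}^2[\sim])$ is undecidable; that is, there is no algorithm which, given a finite alphabet $A=A_S\uplus A_E$ of actions and a sentence $\varphi\in\mathrm{FO}^2[\sim]$ over $A$, decides whether there exists a finite set $\mathbb{P}_{SE}$ of shared processes (with no processes private to System or Environment) such that System has a winning strategy for $\varphi$.
   Context: **Data words.** $A$ is a finite alphabet of actions, partitioned into System actions $A_S$ and Environment actions $A_E$. Processes are shared: there is a finite set $\mathbb{P}_{SE}$ of processes on which both players can play, and no other processes (the sets $\mathbb{P}_S$, $\mathbb{P}_E$ of private processes of System and Environment are empty). Let $\Sigma_S := A_S\times\mathbb{P}_{SE}$, $\Sigma_E := A_E\times\mathbb{P}_{SE}$, $\Sigma:=\Sigma_S\cup\Sigma_E$. A data word is a finite or infinite sequence $w=(a_0,p_0)(a_1,p_1)\cdots$ over $\Sigma$; each pair $(a_i,p_i)$ in the sequence is called a position. **Logic.** Formulas of $\mathrm{FO}^2[\sim]$ are first-order formulas (connectives $\neg,\land,\lor,\exists,\forall$) using only two (reusable) variables $x,y$, built from the atoms $a(x)$ for $a\in A$, $x=y$, $x\sim y$, $\mathbb{P}_{SE}(x)$ (and $\mathbb{P}_S(x)$, $\mathbb{P}_E(x)$, which are interpreted as the empty set here), up to renaming of the two variables; neither an order nor a successor relation on positions is available. A data word is represented as a structure whose domain has one element for each position and one element for each process in $\mathbb{P}_{SE}$ (including processes on which no action is played). $\mathbb{P}_{SE}$ is interpreted as the set of process elements; $a$ is interpreted as the set of positions whose action is $a$; $\sim$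 is the equivalence relation such that two positions $(a_i,p_i)$, $(a_j,p_j)$ are related iff $p_i=p_j$, and each process element $p$ is related to all positions of the form $(a,p)$. **Strategies.** A strategy for System is a function $\mathcal{S}:\Sigma^*\to\Sigma_S\cup\{\varepsilon\}$. An execution (data word) $w=\sigma_0\sigma_1\cdots$ is $\mathcal{S}$-compatible if (i) for all $0\le i<|w|$, $\sigma_i\in\Sigma_S$ implies $\sigma_i=\mathcal{S}(\sigma_0\cdots\sigma_{i-1})$, and (ii) if $w$ is finite then $\mathcal{S}(w)=\varepsilon$. It is fair for $\mathcal{S}$ if, whenever there are infinitely many $i$ with $\mathcal{S}(\sigma_0\cdots\sigma_{i-1})\neq\varepsilon$, there are infinitely many positions of $w$ in $\Sigma_S$. $\mathcal{S}$ is winning for $\varphi$ if all executions that are $\mathcal{S}$-compatible and fair for $\mathcal{S}$ satisfy $\varphi$. **Problem.** For a logic $\mathcal{L}$, $\mathrm{SharedSynth}(\mathcal{L})$ is the problem: given $A=A_S\uplus A_E$ and a sentence $\varphi\in\mathcal{L}$, decide whether System has a winning strategy for $\varphi$ with $\mathbb{P}_S=\mathbb{P}_E=\emptyset$ and some finite set $\mathbb{P}_{SE}$. -}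

module Defs where

open import Data.Bool using (Bool; true; false; T)
open import Data.Empty using (⊥)
open import Data.Fin using (Fin; toℕ)
open import Data.List using (List; length; lookup; take; applyUpTo)
open import Data.Maybe using (Maybe; just; nothing)
open import Data.Nat using (ℕ; suc; _+_; _*_; _^_; _≤_; _<_)
open import Data.Product using (∃; _×_; _,_; proj₁; proj₂)
open import Data.Sum using (_⊎_; inj₁; inj₂)
open import Data.Unit using (⊤)
open import Data.Vec as Vec using (Vec; []; _∷_)
open import Data.Vec.Relation.Binary.Pointwise.Inductive using (Pointwise)
open import Relation.Nullary using (¬_)
open import Relation.Binary.PropositionalEquality using (_≡_; _≢_)

-- Finite alphabets are taken up to renaming: A_S = Fin s and A_E = Fin e.

Action : ℕ → ℕ → Set
Action s e = Fin s ⊎ Fin e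

------------------------------------------------------------------------
-- Syntax of FO²[∼]

data Var : Set where
  𝕩 𝕪 : Var

Scope : Set
Scope = Var → Bool

∅ : Scope
∅ _ = false

bind : Var → Scope → Scope
bind 𝕩 Γ 𝕩 = true
bind 𝕩 Γ 𝕪 = Γ 𝕪
bind 𝕪 Γ 𝕩 = Γ 𝕩
bind 𝕪 Γ 𝕪 = true

-- Formula s e Γ: formulas whose free variables lie in Γ.  A quantifier may
-- rebind a variable that is already in scope.
data Formula (s e : ℕ) (Γ : Scope) : Set where
  act           : Action s e → (u : Var) → T (Γ u) → Formula s e Γ
  equal         : (u v : Var) → T (Γ u) → T (Γ v) → Formula s e Γ
  same          : (u v : Var) → T (Γ u) → T (Γ v) → Formula s e Γ
  isP-SE        : (u : Var) → T (Γ u) → Formula s e Γ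
  isP-S         : (u : Var) → T (Γ u) → Formula s e Γ
  isP-E         : (u : Var) → T (Γ u) → Formula s e Γ
  neg           : Formula s e Γ → Formula s e Γ
  conj disj     : Formula s e Γ → Formula s e Γ → Formula s e Γ
  exists forAll : (u : Var) → Formula s e (bind u Γ) → Formula s e Γ

Sentence : ℕ → ℕ → Set
Sentence s e = Formula s e ∅

------------------------------------------------------------------------
-- Data words, semantics and strategies, for shared processes Fin n

module Game (s e n : ℕ) where

  Process : Set
  Process = Fin n

  SysLetter Letter : Set
  SysLetter = Fin s × Process
  Letter    = Action s e × Process

  sys : SysLetter → Letter
  sys (a , p) = inj₁ a , p

  data Word : Set where
    finite   : List Letter → Word
    infinite : (ℕ → Letter) → Word

  Position : Word → Set
  Position (finite l)   = Fin (length l)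
  Position (infinite f) = ℕ

  index : ∀ w → Position w → ℕ
  index (finite l)   i = toℕ i
  index (infinite f) i = i

  letter : ∀ w → Position w → Letter
  letter (finite l)   i = lookup l i
  letter (infinite f) i = f i

  -- The word σ₀ ⋯ σᵢ₋₁.
  before : ∀ w → Position w → List Letter
  before (finite l)   i = take (toℕ i) l
  before (infinite f) i = applyUpTo f i

  Element : Word → Set
  Element w = Position w ⊎ Process

  procOf : ∀ w → Element w → Process
  procOf w (inj₁ i) = proj₂ (letter w i)
  procOf w (inj₂ p) = p

  HasAction : ∀ w → Action s e → Element w → Set
  HasAction w a (inj₁ i) = proj₁ (letter w i) ≡ a
  HasAction w a (inj₂ p) = ⊥

  IsProcess : ∀ w → Element w → Set
  IsProcess w (inj₁ i) = ⊥
  IsProcess w (inj₂ p) = ⊤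

  Assignment : Word → Scope → Set
  Assignment w Γ = ∀ u → T (Γ u) → Element w

  assign : ∀ {w Γ} (u : Var) → Element w → Assignment w Γ → Assignment w (bind u Γ)
  assign 𝕩 d ρ 𝕩 _ = d
  assign 𝕩 d ρ 𝕪 t = ρ 𝕪 t
  assign 𝕪 d ρ 𝕩 t = ρ 𝕩 t
  assign 𝕪 d ρ 𝕪 _ = d

  -- Satisfaction is classical, so disjunction and existential quantification
  -- are doubly negated; no instance of excluded middle is then needed for
  -- the usual laws of classical logic to hold.
  Sat : ∀ {Γ} w → Assignment w Γ → Formula s e Γ → Set
  Sat w ρ (act a u t)       = HasAction w a (ρ u t)
  Sat w ρ (equal u v t t′)  = ρ u t ≡ ρ v t′
  Sat w ρ (same u v t t′)   = procOf w (ρ u t) ≡ procOf w (ρ v t′)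
  Sat w ρ (isP-SE u t)      = IsProcess w (ρ u t)
  Sat w ρ (isP-S u t)       = ⊥
  Sat w ρ (isP-E u t)       = ⊥
  Sat w ρ (neg φ)           = ¬ Sat w ρ φ
  Sat w ρ (conj φ ψ)        = Sat w ρ φ × Sat w ρ ψ
  Sat w ρ (disj φ ψ)        = ¬ ¬ (Sat w ρ φ ⊎ Sat w ρ ψ)
  Sat w ρ (exists u φ)      = ¬ ¬ (∃ λ d → Sat w (assign {w} u d ρ) φ)
  Sat w ρ (forAll u φ)      = ∀ d → Sat w (assign {w} u d ρ) φ

  _⊨_ : Word → Sentence s e → Set
  w ⊨ φ = Sat w (λ _ ()) φ

  -- nothing stands for ε.
  Strategy : Set
  Strategy = List Letter → Maybe SysLetter

  StopsAt : Strategy → Word → Set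
  StopsAt S (finite l)   = S l ≡ nothing
  StopsAt S (infinite f) = ⊤

  Compatible : Strategy → Word → Set
  Compatible S w =
    (∀ i τ → letter w i ≡ sys τ → S (before w i) ≡ just τ) × StopsAt S w

  -- Again the classical reading; it is false for every finite word.
  InfinitelyMany : ∀ w → (Position w → Set) → Set
  InfinitelyMany w P = ∀ N → ¬ ¬ (∃ λ i → N ≤ index w i × P i)

  Fair : Strategy → Word → Set
  Fair S w = InfinitelyMany w (λ i → S (before w i) ≢ nothing) →
             InfinitelyMany w (λ i → ∃ λ τ → letter w i ≡ sys τ)

  Winning : Strategy → Sentence s e → Set
  Winning S φ = ∀ w → Compatible S w → Fair S w → w ⊨ φ

record Instance : Set where
  constructor ⟨_,_,_⟩
  field
    sysActions envActions : ℕ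
    sentence              : Sentence sysActions envActions

SharedSynth : Instance → Set
SharedSynth ⟨ s , e , φ ⟩ = ∃ λ n → let open Game s e n in
  ∃ λ (S : Strategy) → Winning S φ

------------------------------------------------------------------------
-- Algorithms: partial recursive functions

data Rec : ℕ → Set where
  zeroᴿ : Rec 0
  sucᴿ  : Rec 1
  projᴿ : ∀ {k} → Fin k → Rec k
  compᴿ : ∀ {k m} → Rec m → Vec (Rec k) m → Rec k
  precᴿ : ∀ {k} → Rec k → Rec (2 + k) → Rec (1 + k)
  muᴿ   : ∀ {k} → Rec (1 + k) → Rec k

infix 4 _[_]⇓_

-- f [ xs ]⇓ r: f is defined at xs, with value r.
data _[_]⇓_ : ∀ {k} → Rec k → Vec ℕ k → ℕ → Set where
  ⇓zero : zeroᴿ [ [] ]⇓ 0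
  ⇓suc  : ∀ {x} → sucᴿ [ x ∷ [] ]⇓ suc x
  ⇓proj : ∀ {k} {i : Fin k} {xs} → projᴿ i [ xs ]⇓ Vec.lookup xs i
  ⇓comp : ∀ {k m} {f : Rec m} {gs : Vec (Rec k) m} {xs ys r} →
          Pointwise (λ g y → g [ xs ]⇓ y) gs ys → f [ ys ]⇓ r →
          compᴿ f gs [ xs ]⇓ r
  ⇓prec-zero : ∀ {k} {f : Rec k} {g : Rec (2 + k)} {xs r} →
               f [ xs ]⇓ r → precᴿ f g [ 0 ∷ xs ]⇓ r
  ⇓prec-suc  : ∀ {k} {f : Rec k} {g : Rec (2 + k)} {x xs q r} →
               precᴿ f g [ x ∷ xs ]⇓ q → g [ x ∷ q ∷ xs ]⇓ r →
               precᴿ f g [ suc x ∷ xs ]⇓ r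
  ⇓mu : ∀ {k} {f : Rec (1 + k)} {xs r} →
        (∀ i → i < r → ∃ λ q → f [ i ∷ xs ]⇓ suc q) → f [ r ∷ xs ]⇓ 0 →
        muᴿ f [ xs ]⇓ r

-- Inputs are presented through an encoding; nothing is required of the
-- algorithm on numbers that encode no input.
Decides : {I : Set} → (I → ℕ) → (I → Set) → Rec 1 → Set
Decides code P f =
  ∀ i → (f [ code i ∷ [] ]⇓ 1 × P i) ⊎ (f [ code i ∷ [] ]⇓ 0 × ¬ P i)

Undecidable : {I : Set} → (I → ℕ) → (I → Set) → Set
Undecidable code P = ¬ (∃ λ (f : Rec 1) → Decides code P f)

------------------------------------------------------------------------
-- Gödel numbering of instances

-- An injective pairing: every positive number is 2^a (2b + 1) for exactly
-- one pair (a , b).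
pair : ℕ → ℕ → ℕ
pair a b = 2 ^ a * (1 + 2 * b)

codeVar : Var → ℕ
codeVar 𝕩 = 0
codeVar 𝕪 = 1

codeAction : ∀ {s e} → Action s e → ℕ
codeAction (inj₁ a) = pair 0 (toℕ a)
codeAction (inj₂ a) = pair 1 (toℕ a)

codeFormula : ∀ {s e Γ} → Formula s e Γ → ℕ
codeFormula (act a u _)     = pair 0 (pair (codeAction a) (codeVar u))
codeFormula (equal u v _ _) = pair 1 (pair (codeVar u) (codeVar v))
codeFormula (same u v _ _)  = pair 2 (pair (codeVar u) (codeVar v))
codeFormula (isP-SE u _)    = pair 3 (codeVar u)
codeFormula (isP-S u _)     = pair 4 (codeVar u)
codeFormula (isP-E u _)     = pair 5 (codeVar u)
codeFormula (neg φ)         = pair 6 (codeFormula φ)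
codeFormula (conj φ ψ)      = pair 7 (pair (codeFormula φ) (codeFormula ψ))
codeFormula (disj φ ψ)      = pair 8 (pair (codeFormula φ) (codeFormula ψ))
codeFormula (exists u φ)    = pair 9 (pair (codeVar u) (codeFormula φ))
codeFormula (forAll u φ)    = pair 10 (pair (codeVar u) (codeFormula φ))

codeInstance : Instance → ℕ
codeInstance ⟨ s , e , φ ⟩ = pair s (pair e (codeFormula φ))

{-# OPTIONS --safe #-}

-- A formula of FO²[∼] only sees which letters occur at which processes, but
-- the players can still be made to simulate a counter machine, with processes
-- as counter tokens.  To take a transition, System fires it at a process (a
-- fresh one, or a token of r if it decrements r) and retires the transition
-- fired before; Environment then confirms the new event and closes the old
-- one.  The two players alternate in marking an event.  So whatever System
-- adds on its own, the outcome is good only if it is exactly the next step of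
-- the machine, and whatever Environment adds on its own, either it has just
-- given the turn back or System wins.  A test for zero asks that there be no
-- token.  System wins if the machine accepts, having one fresh process per
-- step, and loses if all runs end without acceptance.
--
-- An input c is presented by c more letters, each of which marks one process
-- as an initial token of register 0; the rest of the sentence, the template,
-- does not depend on c.  This makes a direct diagonalisation possible: a
-- recursive function f that decides the problem is compiled to a machine
-- which, started on the code c of its own template, evaluates f at the code
-- of its own instance for the input c and accepts if the value is 0.

module Submission where

open import Defs

-- Two obstacles shape the construction. Positions are unordered, so a formula sees only the set of
-- letters at each process, and a history has to be recoverable from these sets. Hence a transition
-- that is not a `dec` always needs a fresh process, and a process carries at most one such event
-- and at most one `dec` after it. For the same reason it must be visible in the marks whose turn it
-- is: the four marks of an event overlap with those of its neighbours in such a way that the latest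
-- event and the one before it stand out from all others.
--
-- The other obstacle is self-reference: the code of its own instance depends on how many
-- transitions the machine has. The program therefore begins with as many increments as the
-- remaining part has instructions, and the number of transitions becomes a fixed function of the
-- number so loaded.
--
-- Whether a letter occurs in an infinite word, or whether a strategy ever stops, cannot be decided.
-- Arguments about words therefore run under a double negation, and the conditions are chosen
-- stable.

-- Compiling partial recursive functions to loop programs

module Compilation where

  open import Data.Bool using (if_then_else_)
  open import Data.Empty using (⊥-elim)
  open import Data.Fin using (Fin; zero; suc)
  open import Data.Nat
  open import Data.Nat.Properties
  open import Data.Product using (∃; _×_; _,_)
  open import Data.Sum using (_⊎_; inj₁; inj₂)
  open import Data.Vec as Vec using (Vec; []; _∷_)
  open import Data.Vec.Relation.Binary.Pointwise.Inductive using (Pointwise; []; _∷_)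
  open import Function using (id; case_of_)
  open import Relation.Nullary using (yes; no; does)
  open import Relation.Nullary.Decidable using (dec-true; dec-false; False; toWitnessFalse)
  open import Relation.Binary.PropositionalEquality

  Val : Set
  Val = ℕ → ℕ

  abstract
    _[_≔_] : Val → ℕ → ℕ → Val
    (v [ r ≔ x ]) s = if does (s ≟ r) then x else v s

    upd-same : ∀ v r {x} → (v [ r ≔ x ]) r ≡ x
    upd-same v r {x} = cong (if_then x else v r) (dec-true (r ≟ r) refl)

    upd-other : ∀ v {r x s} → s ≢ r → (v [ r ≔ x ]) s ≡ v s
    upd-other v {r} {x} {s} s≢r = cong (if_then x else v s) (dec-false (s ≟ r) s≢r)

  infixr 5 _⨾_

  data Cmd : Set where
    skip : Cmd
    inc  : ℕ → Cmd
    _⨾_  : Cmd → Cmd → Cmd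
    -- loop r c: while r is positive, decrement r and run c.
    loop : ℕ → Cmd → Cmd

  data Exec : Cmd → Val → Val → Set where
    skip : ∀ {v} → Exec skip v v
    inc  : ∀ {r v} → Exec (inc r) v (v [ r ≔ suc (v r) ])
    _⨾_  : ∀ {c d v v′ v″} → Exec c v v′ → Exec d v′ v″ → Exec (c ⨾ d) v v″
    stop : ∀ {r c v} → v r ≡ 0 → Exec (loop r c) v v
    go   : ∀ {r c v v′ v″ k} → v r ≡ suc k → Exec c (v [ r ≔ k ]) v′ →
           Exec (loop r c) v′ v″ → Exec (loop r c) v v″

  clear : ℕ → Cmd
  clear r = loop r skip

  move : ℕ → ℕ → Cmd
  move i o = loop i (inc o)

  -- A register can only be read by emptying it, so its content goes to both `o` and the temporary
  -- `t`, from which `i` is restored.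
  copy : ℕ → ℕ → ℕ → Cmd
  copy t i o = loop i (inc t ⨾ inc o) ⨾ move t i

  clear-exec : ∀ r v → ∃ λ v′ → Exec (clear r) v v′ × v′ r ≡ 0 × (∀ s → s ≢ r → v′ s ≡ v s)
  clear-exec r v = go-on (v r) v refl
    where
    go-on : ∀ k v → v r ≡ k →
            ∃ λ v′ → Exec (clear r) v v′ × v′ r ≡ 0 × (∀ s → s ≢ r → v′ s ≡ v s)
    go-on zero    v eq = v , stop eq , eq , λ _ _ → refl
    go-on (suc k) v eq with go-on k (v [ r ≔ k ]) (upd-same v r)
    ... | v′ , ex , z , keep = v′ , go eq skip ex , z ,
          λ s s≢r → trans (keep s s≢r) (upd-other v s≢r)

  move-exec : ∀ i o v → i ≢ o → ∃ λ v′ → Exec (move i o) v v′ × v′ i ≡ 0 × v′ o ≡ v i + v o ×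
              (∀ s → s ≢ i → s ≢ o → v′ s ≡ v s)
  move-exec i o v i≢o = go-on (v i) v refl
    where
    go-on : ∀ k v → v i ≡ k → ∃ λ v′ → Exec (move i o) v v′ × v′ i ≡ 0 × v′ o ≡ k + v o ×
            (∀ s → s ≢ i → s ≢ o → v′ s ≡ v s)
    go-on zero    v eq = v , stop eq , eq , refl , λ _ _ _ → refl
    go-on (suc k) v eq
      with u ← v [ i ≔ k ] in u≡
      with go-on k (u [ o ≔ suc (u o) ]) (trans (upd-other u i≢o) (trans (cong (λ u → u i) (sym u≡)) (upd-same v i)))
    ... | v′ , ex , z , sum , keep =
      v′ , go eq (subst (λ u′ → Exec (inc o) u′ (u [ o ≔ suc (u o) ])) (sym u≡) inc) ex , z ,
      trans sum (trans (cong (k +_) (upd-same u o))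
        (trans (+-suc k (u o)) (cong (λ x → suc (k + x)) uo))) ,
      λ s s≢i s≢o → trans (keep s s≢i s≢o) (trans (upd-other u s≢o)
        (trans (cong (λ u → u s) (sym u≡)) (upd-other v s≢i)))
      where
      uo : u o ≡ v o
      uo = trans (cong (λ u → u o) (sym u≡)) (upd-other v (≢-sym i≢o))

  copy-exec : ∀ t i o v → t ≢ i → t ≢ o → i ≢ o → v t ≡ 0 →
              ∃ λ v′ → Exec (copy t i o) v v′ × v′ o ≡ v i + v o × (∀ s → s ≢ o → v′ s ≡ v s)
  copy-exec t i o v t≢i t≢o i≢o vt
    with first (v i) v refl
    where
    first : ∀ k v → v i ≡ k →
            ∃ λ v′ → Exec (loop i (inc t ⨾ inc o)) v v′ × v′ i ≡ 0 × v′ o ≡ k + v o ×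
            v′ t ≡ k + v t × (∀ s → s ≢ i → s ≢ o → s ≢ t → v′ s ≡ v s)
    first zero    v eq = v , stop eq , eq , refl , refl , λ _ _ _ _ → refl
    first (suc k) v eq = result
      where
      v₁ = v [ i ≔ k ]
      v₂ = v₁ [ t ≔ suc (v₁ t) ]
      v₃ = v₂ [ o ≔ suc (v₂ o) ]
      v₃i : v₃ i ≡ k
      v₃i = trans (upd-other v₂ i≢o) (trans (upd-other v₁ (≢-sym t≢i)) (upd-same v i))
      v₃o : v₃ o ≡ suc (v o)
      v₃o = trans (upd-same v₂ o)
        (cong suc (trans (upd-other v₁ (≢-sym t≢o)) (upd-other v (≢-sym i≢o))))
      v₃t : v₃ t ≡ suc (v t)
      v₃t = trans (upd-other v₂ t≢o) (trans (upd-same v₁ t) (cong suc (upd-other v t≢i)))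
      result : ∃ λ v′ → Exec (loop i (inc t ⨾ inc o)) v v′ × v′ i ≡ 0 × v′ o ≡ suc k + v o ×
               v′ t ≡ suc k + v t × (∀ s → s ≢ i → s ≢ o → s ≢ t → v′ s ≡ v s)
      result with first k v₃ v₃i
      ... | v′ , ex , z , so , st , keep =
        v′ , go eq (inc ⨾ inc) ex , z ,
        trans so (trans (cong (k +_) v₃o) (+-suc k (v o))) ,
        trans st (trans (cong (k +_) v₃t) (+-suc k (v t))) ,
        λ s s≢i s≢o s≢t → trans (keep s s≢i s≢o s≢t)
          (trans (upd-other v₂ s≢o) (trans (upd-other v₁ s≢t) (upd-other v s≢i)))
  ... | v₁ , ex₁ , z₁ , so , st , keep₁ with move-exec t i v₁ t≢i
  ... | v₂ , ex₂ , z₂ , si , keep₂ = v₂ , ex₁ ⨾ ex₂ ,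
    trans (keep₂ o (≢-sym t≢o) (≢-sym i≢o)) so , keep
    where
    keep : ∀ s → s ≢ o → v₂ s ≡ v s
    keep s s≢o with s ≟ t | s ≟ i
    ... | yes refl | _ = trans z₂ (sym vt)
    ... | no _ | yes refl = trans si (trans (cong₂ _+_ st z₁)
          (trans (+-identityʳ _) (trans (cong (v s +_) vt) (+-identityʳ _))))
    ... | no s≢t | no s≢i = trans (keep₂ s s≢t s≢i) (keep₁ s s≢i s≢o s≢t)

  regs : ℕ → (m : ℕ) → Vec ℕ m
  regs o zero    = []
  regs o (suc m) = o ∷ regs (suc o) m

  regs-≥ : ∀ o {m} i → o ≤ Vec.lookup (regs o m) i
  regs-≥ o {suc m} zero    = ≤-refl
  regs-≥ o {suc m} (suc i) = ≤-trans (n≤1+n o) (regs-≥ (suc o) i)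

  regs-< : ∀ o {m} i → Vec.lookup (regs o m) i < o + m
  regs-< o {suc m} zero    = m<m+n o (s≤s z≤n)
  regs-< o {suc m} (suc i) = subst (Vec.lookup (regs (suc o) m) i <_) (sym (+-suc o m)) (regs-< (suc o) i)

  clears : ℕ → ℕ → Cmd
  clears o zero    = skip
  clears o (suc m) = clear o ⨾ clears (suc o) m

  Outside : ℕ → ℕ → ℕ → Set
  Outside o m s = s < o ⊎ o + m ≤ s

  outside? : ∀ o m s → Outside o m s ⊎ (o ≤ s × s < o + m)
  outside? o m s with s <? o | s <? o + m
  ... | yes p | _ = inj₁ (inj₁ p)
  ... | no p | yes q = inj₂ (≮⇒≥ p , q)
  ... | no _ | no q = inj₁ (inj₂ (≮⇒≥ q))

  outside-suc : ∀ {o m s} → Outside o (suc m) s → Outside (suc o) m s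
  outside-suc {o} {m} (inj₁ p) = inj₁ (m<n⇒m<1+n p)
  outside-suc {o} {m} {s} (inj₂ p) = inj₂ (subst (_≤ s) (+-suc o m) p)

  outside-≢ : ∀ {o m s} → Outside o (suc m) s → s ≢ o
  outside-≢ (inj₁ p) refl = <-irrefl refl p
  outside-≢ {o} {m} (inj₂ p) refl = <-irrefl refl (≤-trans (m<m+n o (s≤s z≤n)) p)

  clears-exec : ∀ o m v → ∃ λ v′ → Exec (clears o m) v v′ ×
                (∀ s → o ≤ s → s < o + m → v′ s ≡ 0) × (∀ s → Outside o m s → v′ s ≡ v s)
  clears-exec o zero v = v , skip ,
    (λ s p q → ⊥-elim (<-irrefl refl (≤-trans q (subst (_≤ s) (sym (+-identityʳ o)) p)))) , λ _ _ → refl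
  clears-exec o (suc m) v with clear-exec o v
  ... | v₁ , ex₁ , z₁ , keep₁ with clears-exec (suc o) m v₁
  ... | v₂ , ex₂ , z₂ , keep₂ = v₂ , ex₁ ⨾ ex₂ , zeros ,
    λ s p → trans (keep₂ s (outside-suc p)) (keep₁ s (outside-≢ p))
    where
    zeros : ∀ s → o ≤ s → s < o + suc m → v₂ s ≡ 0
    zeros s p q with s ≟ o
    ... | yes refl = trans (keep₂ o (inj₁ ≤-refl)) z₁
    ... | no s≢o = z₂ s (≤∧≢⇒< p (≢-sym s≢o)) (subst (s <_) (+-suc o m) q)

  -- compile f is o b: add f (is) to the register o, which is initially 0; the
  -- registers from b on are scratch space, 0 before and after.
  compile  : ∀ {k} → Rec k → Vec ℕ k → ℕ → ℕ → Cmd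
  compiles : ∀ {k m} → Vec (Rec k) m → Vec ℕ k → ℕ → ℕ → Cmd
  compile zeroᴿ        is            o b = skip
  compile sucᴿ         (i ∷ [])      o b = copy b i o ⨾ inc o
  compile (projᴿ j)    is            o b = copy b (Vec.lookup is j) o
  compile (compᴿ {m = m} f gs) is    o b =
    compiles gs is b (b + m) ⨾ compile f (regs b m) o (b + m) ⨾ clears b m
  -- Register `b` holds the index, `1 + b` the accumulator, `2 + b` the next value computed by `g`,
  -- and `3 + b` the number of iterations left, a copy of `i` that the loop may consume.
  compile (precᴿ f g)  (i ∷ is)      o b =
    copy b i (3 + b) ⨾ compile f is (1 + b) (4 + b) ⨾
    loop (3 + b) (compile g (b ∷ 1 + b ∷ is) (2 + b) (4 + b) ⨾
                  clear (1 + b) ⨾ move (2 + b) (1 + b) ⨾ inc b) ⨾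
    move (1 + b) o ⨾ clear b
  -- Register `b` holds the candidate and `1 + b` the value of `f` at it. The loop test only takes
  -- one from this value, so the body clears the remainder before it evaluates the next candidate.
  compile (muᴿ f)      is            o b =
    compile f (b ∷ is) (1 + b) (2 + b) ⨾
    loop (1 + b) (clear (1 + b) ⨾ inc b ⨾ compile f (b ∷ is) (1 + b) (2 + b)) ⨾
    move b o
  compiles []       is o b = skip
  compiles (g ∷ gs) is o b = compile g is o b ⨾ compiles gs is (suc o) b

  -- Scratch registers are 0 on entry, so compiled code may use them at once; `in≢out` is what
  -- copying an input to the output requires.
  record Ready {k} (is : Vec ℕ k) (xs : Vec ℕ k) (o b : ℕ) (v : Val) : Set where
    constructor ready
    field
      out<   : o < b
      in<    : ∀ i → Vec.lookup is i < b
      in≢out : ∀ i → Vec.lookup is i ≢ o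
      out≡0  : v o ≡ 0
      free   : ∀ s → b ≤ s → v s ≡ 0
      input  : ∀ i → v (Vec.lookup is i) ≡ Vec.lookup xs i

  open Ready

  -- Keeping every register but `o` covers the inputs and also the scratch space, which is thereby 0
  -- again afterwards.
  Sets : Cmd → Val → ℕ → ℕ → Set
  Sets c v o x = ∃ λ v′ → Exec c v v′ × v′ o ≡ x × (∀ s → s ≢ o → v′ s ≡ v s)

  -- Only defined values matter: a decider has one at the code of every instance.
  Correct : ∀ {k} → Rec k → Set
  Correct f = ∀ {is xs o b v r} → Ready is xs o b v →
              f [ xs ]⇓ r → Sets (compile f is o b) v o r

  below : ∀ {s b} l → s < b → s ≢ l + b
  below {b = b} l s<b = <⇒≢ (<-≤-trans s<b (m≤n+m b l))

  shift : ∀ {b} l l′ → {False (l ≟ l′)} → l + b ≢ l′ + b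
  shift {b} l l′ {l≢l′} eq = toWitnessFalse l≢l′ (+-cancelʳ-≡ b l l′ eq)

  beyond : ∀ {s b} l → suc l + b ≤ s → s ≢ l + b
  beyond l p refl = <-irrefl refl p

  module Prec {k : ℕ} (f : Rec k) (g : Rec (2 + k)) (f-correct : Correct f) (g-correct : Correct g)
    {i : ℕ} {is : Vec ℕ k} {x : ℕ} {xs : Vec ℕ k} {o b : ℕ} {v : Val} (R : Ready (i ∷ is) (x ∷ xs) o b v) where

    body : Cmd
    body = compile g (b ∷ 1 + b ∷ is) (2 + b) (4 + b) ⨾ clear (1 + b) ⨾ move (2 + b) (1 + b) ⨾ inc b

    State : ℕ → ℕ → ℕ → Val → Set
    State j k q u = u (3 + b) ≡ j × u b ≡ k × u (1 + b) ≡ q ×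
      (∀ s → s ≢ 3 + b → s ≢ b → s ≢ 1 + b → u s ≡ v s)

    step : ∀ {j k q q′ u} → State j k q u → g [ k ∷ q ∷ xs ]⇓ q′ →
           ∃ λ u′ → Exec body u u′ × State j (suc k) q′ u′
    step {j} {k} {q} {q′} {u} (cnt , idx , acc , rest) dg
      with g-correct {b ∷ 1 + b ∷ is} {k ∷ q ∷ xs} {2 + b} {4 + b} {u}
        (ready (m≤n+m (3 + b) 1)
          (λ { zero → m≤n+m (1 + b) 3 ; (suc zero) → m≤n+m (2 + b) 2
             ; (suc (suc l)) → <-≤-trans (in< R (suc l)) (m≤n+m b 4) })
          (λ { zero → shift 0 2 ; (suc zero) → shift 1 2
             ; (suc (suc l)) → below 2 (in< R (suc l)) })
          (trans (rest (2 + b) (shift 2 3) (shift 2 0) (shift 2 1))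
                 (free R (2 + b) (m≤n+m b 2)))
          (λ s p → trans (rest s (beyond 3 p)
             (beyond 0 (≤-trans (m≤n+m (1 + b) 3) p)) (beyond 1 (≤-trans (m≤n+m (2 + b) 2) p)))
             (free R s (≤-trans (m≤n+m b 4) p)))
          (λ { zero → idx ; (suc zero) → acc
             ; (suc (suc l)) → trans (rest _ (below 3 (in< R (suc l))) (below 0 (in< R (suc l))) (below 1 (in< R (suc l))))
                                     (input R (suc l)) })) dg
    ... | u₁ , e₁ , out₁ , k₁ with clear-exec (1 + b) u₁
    ... | u₂ , e₂ , z₂ , k₂ with move-exec (2 + b) (1 + b) u₂ (shift 2 1)
    ... | u₃ , e₃ , z₃ , sum₃ , k₃ =
      u₃ [ b ≔ suc (u₃ b) ] , e₁ ⨾ e₂ ⨾ e₃ ⨾ inc ,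
      trans (old (3 + b) (shift 3 0) (shift 3 1) (shift 3 2)) cnt ,
      trans (upd-same u₃ b) (cong suc (trans (old′ b (shift 0 1) (shift 0 2)) idx)) ,
      trans (upd-other u₃ (shift 1 0))
        (trans sum₃ (trans (cong₂ _+_ (trans (k₂ _ (shift 2 1)) out₁) z₂) (+-identityʳ q′))) ,
      λ s s≢3 s≢0 s≢1 → other s s≢3 s≢0 s≢1
      where
      old′ : ∀ s → s ≢ 1 + b → s ≢ 2 + b → u₃ s ≡ u s
      old′ s s≢1 s≢2 = trans (k₃ s s≢2 s≢1) (trans (k₂ s s≢1) (k₁ s s≢2))
      old : ∀ s → s ≢ b → s ≢ 1 + b → s ≢ 2 + b → (u₃ [ b ≔ suc (u₃ b) ]) s ≡ u s
      old s s≢0 s≢1 s≢2 = trans (upd-other u₃ s≢0) (old′ s s≢1 s≢2)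
      other : ∀ s → s ≢ 3 + b → s ≢ b → s ≢ 1 + b → (u₃ [ b ≔ suc (u₃ b) ]) s ≡ v s
      other s s≢3 s≢0 s≢1 with s ≟ 2 + b
      ... | no s≢2 = trans (old s s≢0 s≢1 s≢2) (rest s s≢3 s≢0 s≢1)
      ... | yes refl = trans (upd-other u₃ s≢0) (trans z₃ (sym (free R (2 + b) (m≤n+m b 2))))

    -- A derivation for `suc x` contains one for `x`, which accounts for the earlier iterations
    -- while the counter must still provide for the later ones; hence the surplus `j`. The loop ends
    -- only after all of them, so the `x` iterations are returned as a function that puts them in
    -- front of the rest of the loop.
    run : ∀ x r → precᴿ f g [ x ∷ xs ]⇓ r → ∀ j u →
          u (3 + b) ≡ x + j × (∀ s → s ≢ 3 + b → u s ≡ v s) →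
          ∃ λ u₀ → ∃ λ u₁ → Exec (compile f is (1 + b) (4 + b)) u u₀ × State j x r u₁ ×
          (∀ {u₂} → Exec (loop (3 + b) body) u₁ u₂ → Exec (loop (3 + b) body) u₀ u₂)
    run zero r (⇓prec-zero df) j u (cnt , rest)
      with f-correct {is} {xs} {1 + b} {4 + b} {u}
        (ready (m≤n+m (2 + b) 2) (λ l → <-≤-trans (in< R (suc l)) (m≤n+m b 4))
          (λ l → below 1 (in< R (suc l)))
          (trans (rest _ (shift 1 3)) (free R (1 + b) (m≤n+m b 1)))
          (λ s p → trans (rest s (beyond 3 p)) (free R s (≤-trans (m≤n+m b 4) p)))
          (λ l → trans (rest _ (below 3 (in< R (suc l)))) (input R (suc l)))) df
    ... | u′ , e , out , k = u′ , u′ , e ,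
      (trans (k _ (shift 3 1)) cnt ,
       trans (k _ (shift 0 1)) (trans (rest _ (shift 0 3)) (free R b ≤-refl)) ,
       out , λ s s≢3 s≢0 s≢1 → trans (k s s≢1) (rest s s≢3)) , id
    run (suc x) r (⇓prec-suc {q = q} d dg) j u (cnt , rest) =
      let u₀ , u₁ , e , (cnt₁ , idx₁ , acc₁ , rest₁) , cont =
            run x q d (suc j) u (trans cnt (sym (+-suc x j)) , rest)
          u₂ , e₂ , st₂ = step {j} {x} {q} {r} {u₁ [ 3 + b ≔ j ]}
            (upd-same u₁ (3 + b) , trans (upd-other u₁ (shift 0 3)) idx₁ ,
             trans (upd-other u₁ (shift 1 3)) acc₁ ,
             λ s s≢3 s≢0 s≢1 → trans (upd-other u₁ s≢3) (rest₁ s s≢3 s≢0 s≢1)) dg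
      in u₀ , u₂ , e , st₂ , λ e₃ → cont (go cnt₁ e₂ e₃)

  prec-correct : ∀ {k} (f : Rec k) (g : Rec (2 + k)) → Correct f → Correct g → Correct (precᴿ f g)
  prec-correct f g f-correct g-correct {i ∷ is} {x ∷ xs} {o} {b} {v} {r} R d
    with copy-exec b i (3 + b) v (≢-sym (<⇒≢ (in< R zero))) (<⇒≢ (m≤n+m (suc b) 2))
         (<⇒≢ (<-≤-trans (in< R zero) (m≤n+m b 3))) (free R b ≤-refl)
  ... | v₁ , ex₁ , cnt₁ , keep₁
    with Prec.run f g f-correct g-correct R x r d 0 v₁ (trans cnt₁ (cong₂ _+_ (input R zero) (free R (3 + b) (m≤n+m b 3))) , keep₁)
  ... | u₀ , u₁ , e₀ , (cnt , idx , acc , rest) , cont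
    with move-exec (1 + b) o u₁ (≢-sym (<⇒≢ (<-≤-trans (out< R) (m≤n+m b 1))))
  ... | u₂ , e₂ , z₂ , sum₂ , k₂ with clear-exec b u₂
  ... | u₃ , e₃ , z₃ , k₃ = u₃ , ex₁ ⨾ e₀ ⨾ cont (stop cnt) ⨾ e₂ ⨾ e₃ ,
    trans (k₃ o (<⇒≢ (out< R))) (trans sum₂ (trans (cong₂ _+_ acc (trans (rest o
      (<⇒≢ (<-≤-trans (out< R) (m≤n+m b 3))) (<⇒≢ (out< R)) (<⇒≢ (<-≤-trans (out< R) (m≤n+m b 1)))) (out≡0 R)))
      (+-identityʳ r))) , keep
    where
    keep : ∀ s → s ≢ o → u₃ s ≡ v s
    keep s s≢o with s ≟ b | s ≟ 1 + b | s ≟ 3 + b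
    ... | yes refl | _ | _ = trans z₃ (sym (free R b ≤-refl))
    ... | no s≢0 | yes refl | _ = trans (k₃ s s≢0) (trans z₂ (sym (free R s (m≤n+m b 1))))
    ... | no s≢0 | no s≢1 | yes refl =
      trans (k₃ s s≢0) (trans (k₂ s s≢1 s≢o) (trans cnt (sym (free R s (m≤n+m b 3)))))
    ... | no s≢0 | no s≢1 | no s≢3 =
      trans (k₃ s s≢0) (trans (k₂ s s≢1 s≢o) (rest s s≢3 s≢0 s≢1))

  module Mu {k : ℕ} (f : Rec (1 + k)) (f-correct : Correct f)
    {is xs : Vec ℕ k} {o b : ℕ} {v : Val} (R : Ready is xs o b v) where

    body : Cmd
    body = clear (1 + b) ⨾ inc b ⨾ compile f (b ∷ is) (1 + b) (2 + b)

    Rest : Val → Set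
    Rest u = ∀ s → s ≢ b → s ≢ 1 + b → u s ≡ v s

    eval : ∀ {i q} u → Rest u → u b ≡ i → u (1 + b) ≡ 0 →
           f [ i ∷ xs ]⇓ q → Sets (compile f (b ∷ is) (1 + b) (2 + b)) u (1 + b) q
    eval {i} {q} u rest idx val d = f-correct {b ∷ is} {i ∷ xs} {1 + b} {2 + b} {u}
      (ready ≤-refl
        (λ { zero → m≤n+m (1 + b) 1 ; (suc l) → <-≤-trans (in< R l) (m≤n+m b 2) })
        (λ { zero → shift 0 1 ; (suc l) → below 1 (in< R l) })
        val
        (λ s p → trans (rest s (beyond 0 (≤-trans (m≤n+m (1 + b) 1) p)) (beyond 1 p))
                       (free R s (≤-trans (m≤n+m b 2) p)))
        (λ { zero → idx ; (suc l) → trans (rest _ (below 0 (in< R l)) (below 1 (in< R l)))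
                                          (input R l) })) d

    -- The evaluation at the current candidate is either the command in front of the loop or the end
    -- of the loop body, so it is kept apart from the execution of the loop. The number `j` counts
    -- the candidates left before `r`.
    search : ∀ {r} → (∀ i → i < r → ∃ λ q → f [ i ∷ xs ]⇓ suc q) → f [ r ∷ xs ]⇓ 0 →
             ∀ j i u₀ → i + j ≡ r → Rest u₀ → u₀ b ≡ i → u₀ (1 + b) ≡ 0 →
             ∃ λ u → ∃ λ u′ → Exec (compile f (b ∷ is) (1 + b) (2 + b)) u₀ u ×
             Exec (loop (1 + b) body) u u′ × u′ b ≡ r × u′ (1 + b) ≡ 0 × Rest u′
    search {r} pos nul zero i u₀ eq rest idx val =
      let i≡r = trans (sym (+-identityʳ i)) eq
          u , e , val′ , k = eval u₀ rest (trans idx i≡r) val nul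
      in u , u , e , stop val′ , trans (k b (shift 0 1)) (trans idx i≡r) , val′ ,
         λ s s≢0 s≢1 → trans (k s s≢1) (rest s s≢0 s≢1)
    search {r} pos nul (suc j) i u₀ eq rest idx val =
      let q , d = pos i (subst (i <_) eq (m<m+n i (s≤s z≤n)))
          u , e , val′ , k = eval u₀ rest idx val d
          u₁ , e₁ , z₁ , k₁ = clear-exec (1 + b) (u [ 1 + b ≔ q ])
          u₂ = u₁ [ b ≔ suc (u₁ b) ]
          old : ∀ s → s ≢ 1 + b → u₁ s ≡ u₀ s
          old s s≢1 = trans (k₁ s s≢1) (trans (upd-other u s≢1) (k s s≢1))
          u₃ , u₄ , e₃ , e₄ , fin = search pos nul j (suc i) u₂ (trans (sym (+-suc i j)) eq)
            (λ s s≢0 s≢1 → trans (upd-other u₁ s≢0) (trans (old s s≢1) (rest s s≢0 s≢1)))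
            (trans (upd-same u₁ b) (cong suc (trans (old b (shift 0 1)) idx)))
            (trans (upd-other u₁ (shift 1 0)) z₁)
      in u , u₄ , e , go val′ (e₁ ⨾ inc ⨾ e₃) e₄ , fin

  mu-correct : ∀ {k} (f : Rec (1 + k)) → Correct f → Correct (muᴿ f)
  mu-correct f f-correct {is} {xs} {o} {b} {v} {r} R (⇓mu pos nul) =
    let u₁ , u₂ , e₁ , e₂ , idx , val , rest = Mu.search f f-correct R pos nul r 0 v refl
          (λ _ _ _ → refl) (free R b ≤-refl) (free R (1 + b) (m≤n+m b 1))
        u₃ , e₃ , z₃ , sum₃ , k₃ = move-exec b o u₂ (≢-sym (<⇒≢ (out< R)))
        keep : ∀ s → s ≢ o → u₃ s ≡ v s
        keep s s≢o = case s ≟ b of λ where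
          (yes refl) → trans z₃ (sym (free R b ≤-refl))
          (no s≢0) → trans (k₃ s s≢0 s≢o) (case s ≟ 1 + b of λ where
            (yes refl) → trans val (sym (free R s (m≤n+m b 1)))
            (no s≢1) → rest s s≢0 s≢1)
    in u₃ , e₁ ⨾ e₂ ⨾ e₃ ,
       trans sum₃ (trans (cong₂ _+_ idx (trans (rest o (<⇒≢ (out< R)) (below 1 (out< R))) (out≡0 R)))
         (+-identityʳ r)) , keep

  compile-correct : ∀ {k} (f : Rec k) → Correct f
  -- Results go to consecutive registers. Each one moves the lower end of the zero region up by one
  -- and leaves the inputs, which lie below all outputs, as they were.
  compiles-correct : ∀ {k m} (gs : Vec (Rec k) m) {is xs o b v ys} → o + m ≤ b →
    (∀ i → Vec.lookup is i < o) → (∀ s → o ≤ s → v s ≡ 0) →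
    (∀ i → v (Vec.lookup is i) ≡ Vec.lookup xs i) →
    Pointwise (λ g y → g [ xs ]⇓ y) gs ys →
    ∃ λ v′ → Exec (compiles gs is o b) v v′ ×
      (∀ i → v′ (Vec.lookup (regs o m) i) ≡ Vec.lookup ys i) ×
      (∀ s → Outside o m s → v′ s ≡ v s)

  compile-correct zeroᴿ {v = v} R ⇓zero = v , skip , out≡0 R , λ _ _ → refl
  compile-correct sucᴿ {i ∷ []} {x ∷ []} {o} {b} {v} R ⇓suc
    with copy-exec b i o v (≢-sym (<⇒≢ (in< R zero))) (≢-sym (<⇒≢ (out< R))) (in≢out R zero) (free R b ≤-refl)
  ... | v′ , ex , sum , keep = v′ [ o ≔ suc (v′ o) ] , ex ⨾ inc ,
    trans (upd-same v′ o) (cong suc (trans sum (trans (cong₂ _+_ (input R zero) (out≡0 R)) (+-identityʳ x)))) ,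
    λ s s≢o → trans (upd-other v′ s≢o) (keep s s≢o)
  compile-correct (projᴿ j) {is} {xs} {o} {b} {v} R ⇓proj
    with copy-exec b (Vec.lookup is j) o v (≢-sym (<⇒≢ (in< R j))) (≢-sym (<⇒≢ (out< R))) (in≢out R j) (free R b ≤-refl)
  ... | v′ , ex , sum , keep = v′ , ex ,
    trans sum (trans (cong₂ _+_ (input R j) (out≡0 R)) (+-identityʳ _)) , keep
  compile-correct (compᴿ {m = m} f gs) {is} {xs} {o} {b} {v} {r} R (⇓comp {ys = ys} dgs df)
    with compiles-correct gs {b = b + m} {v = v} ≤-refl (in< R) (free R) (input R) dgs
  ... | v₁ , ex₁ , ins₁ , keep₁
    with compile-correct f {regs b m} {ys} {o} {b + m} {v₁}
         (ready (<-≤-trans (out< R) (m≤m+n b m)) (regs-< b)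
                (λ i → ≢-sym (<⇒≢ (<-≤-trans (out< R) (regs-≥ b i))))
                (trans (keep₁ o (inj₁ (out< R))) (out≡0 R))
                (λ s p → trans (keep₁ s (inj₂ p)) (free R s (≤-trans (m≤m+n b m) p)))
                ins₁) df
  ... | v₂ , ex₂ , o₂ , keep₂ with clears-exec b m v₂
  ... | v₃ , ex₃ , z₃ , same₃ = v₃ , ex₁ ⨾ ex₂ ⨾ ex₃ , trans (same₃ o (inj₁ (out< R))) o₂ , keep
    where
    keep : ∀ s → s ≢ o → v₃ s ≡ v s
    keep s s≢o with outside? b m s
    ... | inj₁ p = trans (same₃ s p) (trans (keep₂ s s≢o) (keep₁ s p))
    ... | inj₂ (p , q) = trans (z₃ s p q) (sym (free R s p))
  compile-correct (precᴿ f g) = prec-correct f g (compile-correct f) (compile-correct g)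
  compile-correct (muᴿ f) = mu-correct f (compile-correct f)

  compiles-correct [] p q z e [] = _ , skip , (λ ()) , λ _ _ → refl
  compiles-correct {m = suc m} (g ∷ gs) {is} {xs} {o} {b} {v} p q z e (d ∷ ds)
    with compile-correct g {is} {xs} {o} {b} {v}
      (ready (<-≤-trans (m<m+n o (s≤s z≤n)) p)
         (λ i → <-trans (q i) (<-≤-trans (m<m+n o (s≤s z≤n)) p))
         (λ i → <⇒≢ (q i)) (z o ≤-refl)
         (λ s b≤s → z s (≤-trans (≤-trans (m≤m+n o (suc m)) p) b≤s)) e) d
  ... | v₁ , ex₁ , o₁ , keep₁
    with compiles-correct gs {is} {xs} {suc o} {b} {v₁} (subst (_≤ b) (+-suc o m) p)
      (λ i → m<n⇒m<1+n (q i))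
      (λ s o<s → trans (keep₁ s (≢-sym (<⇒≢ o<s))) (z s (<⇒≤ o<s)))
      (λ i → trans (keep₁ _ (<⇒≢ (q i))) (e i)) ds
  ... | v₂ , ex₂ , ins₂ , keep₂ = v₂ , ex₁ ⨾ ex₂ ,
    (λ { zero → trans (keep₂ o (inj₁ ≤-refl)) o₁ ; (suc i) → ins₂ i }) ,
    λ s out → trans (keep₂ s (outside-suc out)) (keep₁ s (outside-≢ out))

-- Counter machines and their assembly from loop programs

module Machines where

  open import Data.Bool using (Bool; true; false)
  open import Data.Empty using (⊥-elim)
  open import Data.Fin as Fin using (Fin; zero; suc; toℕ; splitAt; _↑ˡ_; _↑ʳ_)
  open import Data.Fin.Properties using (toℕ-injective; toℕ<n; splitAt-↑ˡ; splitAt-↑ʳ)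
  open import Data.List using (List; []; _∷_; _++_; length; lookup)
  open import Data.List.Properties using (length-++; ++-assoc)
  open import Data.Nat
  open import Data.Nat.Properties
  open import Data.Product using (∃; _×_; _,_; proj₁; proj₂)
  open import Data.Sum using ([_,_]′)
  open import Data.Unit using (⊤; tt)
  open import Function using (case_of_)
  open import Relation.Binary.PropositionalEquality

  open Compilation using (Val; _[_≔_]; Cmd; skip; inc; _⨾_; loop; Exec; stop; go)

  data Kind : Set where
    inc dec test nop : Kind

  -- The register of a nop transition is junk.
  record Machine : Set where
    field
      #trans        : ℕ
      src dst reg   : Fin #trans → ℕ
      kind          : Fin #trans → Kind
      accept        : ℕ

  Config : Set
  Config = ℕ × Val

  data Effect : Kind → ℕ → Val → Val → Set where
    inc  : ∀ {r v} → Effect inc r v (v [ r ≔ suc (v r) ])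
    dec  : ∀ {r v k} → v r ≡ suc k → Effect dec r v (v [ r ≔ k ])
    test : ∀ {r v} → v r ≡ 0 → Effect test r v v
    nop  : ∀ {r v} → Effect nop r v v

  module Runs (M : Machine) where
    open Machine M

    Step : Config → Config → Set
    Step (q , v) (q′ , v′) = ∃ λ t → src t ≡ q × dst t ≡ q′ × Effect (kind t) (reg t) v v′

    -- The number of steps is recorded because System asks for that many spare processes.
    data Accepts : ℕ → Config → Set where
      here : ∀ {v} → Accepts 0 (accept , v)
      step : ∀ {k c c′} → Step c c′ → Accepts k c′ → Accepts (suc k) c

    -- Being inductive, it says that all runs from `c` end and none meets `accept`; Environment's
    -- refutation of a strategy is a recursion on it.
    data Rejects (c : Config) : Set where
      rejects : proj₁ c ≢ accept → (∀ c′ → Step c c′ → Rejects c′) → Rejects c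

    -- Forced runs. Acceptance travels back along them because the steps exist, rejection because
    -- they have no alternative and start outside `accept`.
    data Path : Config → Config → Set where
      done : ∀ {c} → Path c c
      step : ∀ {c c₁ c₂} → proj₁ c ≢ accept → Step c c₁ → (∀ c′ → Step c c′ → c′ ≡ c₁) →
             Path c₁ c₂ → Path c c₂

    path-trans : ∀ {c c₁ c₂} → Path c c₁ → Path c₁ c₂ → Path c c₂
    path-trans done             q = q
    path-trans (step na s u p) q = step na s u (path-trans p q)

    path-accepts : ∀ {c c′ k} → Path c c′ → Accepts k c′ → ∃ λ k → Accepts k c
    path-accepts done            a = _ , a
    path-accepts (step na s u p) a with path-accepts p a
    ... | k , a′ = suc k , step s a′

    path-rejects : ∀ {c c′} → Path c c′ → Rejects c′ → Rejects c
    path-rejects done            r = r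
    path-rejects (step na s u p) r =
      rejects na λ c′ s′ → subst Rejects (sym (u c′ s′)) (path-rejects p r)

  data Instr : Set where
    inc : ℕ → Instr
    -- jzd r l: jump to l if r is 0, otherwise decrement r and go on.
    jzd : ℕ → ℕ → Instr
    jmp : ℕ → Instr

  size : Cmd → ℕ
  size skip       = 0
  size (inc r)    = 1
  size (c ⨾ d)    = size c + size d
  size (loop r c) = 1 + (size c + 1)

  -- Jump targets are absolute, so the address `b` of the first instruction is a parameter.
  flatten : Cmd → ℕ → List Instr
  flatten skip       b = []
  flatten (inc r)    b = inc r ∷ []
  flatten (c ⨾ d)    b = flatten c b ++ flatten d (b + size c)
  flatten (loop r c) b = jzd r (b + size (loop r c)) ∷ flatten c (suc b) ++ jmp b ∷ []

  length-flatten : ∀ c b → length (flatten c b) ≡ size c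
  length-flatten skip       b = refl
  length-flatten (inc r)    b = refl
  length-flatten (c ⨾ d)    b = trans (length-++ (flatten c b))
    (cong₂ _+_ (length-flatten c b) (length-flatten d (b + size c)))
  length-flatten (loop r c) b = cong suc (trans (length-++ (flatten c (suc b)))
    (cong (_+ 1) (length-flatten c (suc b))))

  kindOf : Instr → Bool → Kind
  kindOf (inc r)   _     = inc
  kindOf (jzd r l) false = test
  kindOf (jzd r l) true  = dec
  kindOf (jmp l)   _     = nop

  regOf : Instr → ℕ
  regOf (inc r)   = r
  regOf (jzd r l) = r
  regOf (jmp l)   = 0

  target : Instr → Bool → ℕ → ℕ
  target (inc r)   _     b = suc b
  target (jzd r l) false b = l
  target (jzd r l) true  b = suc b
  target (jmp l)   _     b = l

  module Assembled (P : List Instr) (acc : ℕ) where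

    L : ℕ
    L = length P

    -- Two transitions per instruction: jzd needs both, for the others they agree.
    locate : Fin (L + L) → Fin L × Bool
    locate t = [ _, false , _, true ]′ (splitAt L t)

    machine : Machine
    machine = record
      { #trans = L + L
      ; src    = λ t → toℕ (proj₁ (locate t))
      ; dst    = λ t → let i , b = locate t in target (lookup P i) b (toℕ i)
      ; reg    = λ t → regOf (lookup P (proj₁ (locate t)))
      ; kind   = λ t → let i , b = locate t in kindOf (lookup P i) b
      ; accept = acc
      }

    open Runs machine public

    At : ℕ → Instr → Set
    At q ins = ∃ λ i → toℕ i ≡ q × lookup P i ≡ ins

    located : ∀ i b → ∃ λ t → locate t ≡ (i , b)
    located i false = i ↑ˡ L , cong [ _, false , _, true ]′ (splitAt-↑ˡ L i L)
    located i true  = L ↑ʳ i , cong [ _, false , _, true ]′ (splitAt-↑ʳ L L i)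

    at-step : ∀ {q ins v v′} b → At q ins → Effect (kindOf ins b) (regOf ins) v v′ →
              Step (q , v) (target ins b q , v′)
    at-step {v = v} {v′} b (i , refl , refl) e = proj₁ (located i b) , at (located i b)
      where
      at : ((t , _) : ∃ λ t → locate t ≡ (i , b)) → let j , b′ = locate t in
           toℕ j ≡ toℕ i × target (lookup P j) b′ (toℕ j) ≡ target (lookup P i) b (toℕ i) ×
           Effect (kindOf (lookup P j) b′) (regOf (lookup P j)) v v′
      at (t , eq) rewrite eq = refl , refl , e

    step-at : ∀ {q ins v q′ v′} → At q ins → Step (q , v) (q′ , v′) →
              ∃ λ b → q′ ≡ target ins b q × Effect (kindOf ins b) (regOf ins) v v′
    step-at (i , refl , refl) (t , s , d , e) with locate t
    ... | j , b with toℕ-injective s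
    ... | refl = b , sym d , e

    step-< : ∀ {q v c} → Step (q , v) c → q < L
    step-< (t , s , _) = subst (_< L) s (toℕ<n (proj₁ (locate t)))

    Code : ℕ → List Instr → Set
    Code b []         = ⊤
    Code b (ins ∷ is) = At b ins × Code (suc b) is

    code-++ : ∀ b is {js} → Code b (is ++ js) → Code b is × Code (b + length is) js
    code-++ b []         {js} c = tt , subst (λ b → Code b js) (sym (+-identityʳ b)) c
    code-++ b (ins ∷ is) {js} (a , c) with code-++ (suc b) is c
    ... | c₁ , c₂ = (a , c₁) , subst (λ b → Code b js) (sym (+-suc b (length is))) c₂

    -- The accepting state is no address of the program, so a run inside the program never passes
    -- through it.
    module _ (big : L ≤ acc) where

      at-path : ∀ {q ins v c} → At q ins → Step (q , v) c → (∀ c′ → Step (q , v) c′ → c′ ≡ c) →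
                Path (q , v) c
      at-path (i , refl , _) s u = step (<⇒≢ (<-≤-trans (toℕ<n i) big)) s u done

      inc-path : ∀ {q r v} → At q (inc r) → Path (q , v) (suc q , v [ r ≔ suc (v r) ])
      inc-path a = at-path a (at-step true a inc) λ { (q′ , v′) s → case step-at a s of λ
        { (_ , refl , inc) → refl } }

      jmp-path : ∀ {q l v} → At q (jmp l) → Path (q , v) (l , v)
      jmp-path a = at-path a (at-step true a nop) λ { (q′ , v′) s → case step-at a s of λ
        { (_ , refl , nop) → refl } }

      zero-path : ∀ {q r l v} → At q (jzd r l) → v r ≡ 0 → Path (q , v) (l , v)
      zero-path a z = at-path a (at-step false a (test z)) λ { (q′ , v′) s → case step-at a s of λ
        { (false , refl , test _) → refl ; (true , refl , dec nz) → case trans (sym z) nz of λ () } }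

      dec-path : ∀ {q r l v k} → At q (jzd r l) → v r ≡ suc k → Path (q , v) (suc q , v [ r ≔ k ])
      dec-path a nz = at-path a (at-step true a (dec nz)) λ { (q′ , v′) s → case step-at a s of λ
        { (false , refl , test z) → case trans (sym z) nz of λ ()
        ; (true , refl , dec nz′) → cong (λ k → _ , _ [ _ ≔ k ]) (suc-injective (trans (sym nz′) nz)) } }

      exec-path : ∀ {c v v′} → Exec c v v′ → ∀ b → Code b (flatten c b) →
                  Path (b , v) (b + size c , v′)
      exec-path {v = v} skip b _ = subst (λ q → Path (b , v) (q , v)) (sym (+-identityʳ b)) done
      exec-path {inc r} {v} inc b (a , _) =
        subst (λ q → Path (b , v) (q , v [ r ≔ suc (v r) ])) (+-comm 1 b) (inc-path a)
      exec-path {c ⨾ d} {v} {v′} (_⨾_ {v′ = v₁} e₁ e₂) b code with code-++ b (flatten c b) code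
      ... | code₁ , code₂ =
        path-trans (exec-path e₁ b code₁)
          (subst (λ q → Path (b + size c , v₁) (q , v′)) (+-assoc b (size c) (size d))
            (exec-path e₂ (b + size c)
              (subst (λ l → Code (b + l) (flatten d (b + size c))) (length-flatten c b) code₂)))
      exec-path (stop z) b (a , _) = zero-path a z
      exec-path {loop r c} (go nz e₁ e₂) b (a , code) with code-++ (suc b) (flatten c (suc b)) code
      ... | code₁ , (a₂ , _) =
        path-trans (dec-path a nz) (path-trans (exec-path e₁ (suc b) code₁)
          (path-trans (jmp-path (subst (λ l → At (suc b + l) (jmp b)) (length-flatten c (suc b)) a₂))
            (exec-path e₂ b (a , code))))

    module _ where
      private
        prefixed : ∀ ps is → P ≡ ps ++ is → Code (length ps) is
        prefixed ps [] eq = tt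
        prefixed ps (ins ∷ is) eq = found ps P eq ,
          subst (λ q → Code q is) (trans (length-++ ps) (+-comm (length ps) 1))
            (prefixed (ps ++ ins ∷ []) is (trans eq (sym (++-assoc ps (ins ∷ []) is))))
          where
          found : ∀ ps P → P ≡ ps ++ ins ∷ is → ∃ λ i → toℕ i ≡ length ps × lookup P i ≡ ins
          found []       _ refl = zero , refl , refl
          found (_ ∷ ps) _ refl with found ps _ refl
          ... | i , p , q = suc i , cong suc p , q

      whole : Code 0 P
      whole = prefixed [] P refl

  -- The code of `c` fills the addresses below `size c`, and the final test sits at `size c`. If `o`
  -- is 0, it jumps to the accepting state `2 + size c`; otherwise control falls through to
  -- `1 + size c`, which is neither an address nor accepting.
  program : Cmd → ℕ → List Instr
  program c o = flatten c 0 ++ jzd o (2 + size c) ∷ []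

  length-program : ∀ c o → length (program c o) ≡ size c + 1
  length-program c o = trans (length-++ (flatten c 0)) (cong (_+ 1) (length-flatten c 0))

  assemble : Cmd → ℕ → Machine
  assemble c o = Assembled.machine (program c o) (2 + size c)

  module _ {c : Cmd} {o : ℕ} {v v′ : Val} (e : Exec c v v′) where
    open Assembled (program c o) (2 + size c)
    private
      big : L ≤ 2 + size c
      big = ≤-trans (≤-reflexive (trans (length-program c o) (+-comm (size c) 1))) (n≤1+n _)

      codes : Code 0 (flatten c 0) × Code (length (flatten c 0)) (jzd o (2 + size c) ∷ [])
      codes = code-++ 0 (flatten c 0) whole

      run : Path (0 , v) (size c , v′)
      run = exec-path big e 0 (proj₁ codes)

      last : At (size c) (jzd o (2 + size c))
      last = subst (λ q → At q (jzd o (2 + size c))) (length-flatten c 0) (proj₁ (proj₂ codes))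

    accepts : v′ o ≡ 0 → ∃ λ k → Accepts k (0 , v)
    accepts z = path-accepts (path-trans run (zero-path big last z)) here

    rejects-pos : ∀ {k} → v′ o ≡ suc k → Rejects (0 , v)
    rejects-pos nz = path-rejects (path-trans run (dec-path big last nz))
      (rejects (λ eq → <-irrefl eq ≤-refl) λ _ s → ⊥-elim (<⇒≱ (step-< s)
        (≤-reflexive (trans (length-program c o) (+-comm (size c) 1)))))

-- Conditions on marked processes and their translation into two-variable formulas

module ProcessLogic where

  open import Data.Bool as Bool using (Bool; true; false)
  open import Data.Empty using (⊥-elim)
  open import Data.Fin as Fin using (Fin; zero; suc; toℕ; fromℕ; inject₁; splitAt; _↑ˡ_; _↑ʳ_)
  open import Data.Fin.Properties using (splitAt-↑ˡ; splitAt-↑ʳ; splitAt⁻¹-↑ˡ; splitAt⁻¹-↑ʳ; toℕ-↑ˡ)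
  open import Data.Fin.Relation.Unary.Top using (view; ‵fromℕ; ‵inject₁)
  open import Data.Nat
  open import Data.Nat.Properties
  open import Data.Product using (∃; Σ; _×_; _,_; proj₁; proj₂)
  open import Data.Sum using (_⊎_; inj₁; inj₂; [_,_]′)
  open import Data.Unit using (⊤; tt)
  open import Function using (_∘_; id; case_of_; _⇔_; mk⇔; Equivalence)
  open import Relation.Nullary using (¬_; Dec; yes; no)
  open import Relation.Binary.PropositionalEquality

  Stable : Set → Set
  Stable P = ¬ ¬ P → P

  -- An event is a transition carried out at a process.  System fires it,
  -- Environment confirms it, System retires it, Environment closes it.
  data Mark : Set where
    fire confirm retire close : Mark

  -- The index tells whether a condition speaks of one process or is closed. Leaving out disjunction
  -- and existential quantification makes all conditions stable; `when` is a guard that is decided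
  -- outside the logic.
  data Cond (m : ℕ) : Bool → Set₁ where
    has   : Mark → Fin m → Cond m true
    input : Cond m true
    not   : ∀ {b} → Cond m b → Cond m b
    _and_ : ∀ {b} → Cond m b → Cond m b → Cond m b
    _imp_ : ∀ {b} → Cond m b → Cond m b → Cond m b
    every : ∀ {b} → (Fin m → Cond m b) → Cond m b
    when  : ∀ {b} {P : Set} → Dec P → Cond m b → Cond m b
    all   : Cond m true → Cond m false
    atMostOne : Cond m true → Cond m false

  infixr 6 _and_
  infixr 5 _imp_

  record Marking (m n : ℕ) : Set₁ where
    field
      Has          : Mark → Fin m → Fin n → Set
      Input        : Fin n → Set
      has-stable   : ∀ μ t p → Stable (Has μ t p)
      input-stable : ∀ p → Stable (Input p)

  module Semantics {m n} (K : Marking m n) where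
    open Marking K

    Subject : Bool → Set
    Subject false = ⊤
    Subject true  = Fin n

    ⟦_⟧ : ∀ {b} → Cond m b → Subject b → Set
    ⟦ has μ t ⟧     p = Has μ t p
    ⟦ input ⟧       p = Input p
    ⟦ not φ ⟧       p = ¬ ⟦ φ ⟧ p
    ⟦ φ and ψ ⟧     p = ⟦ φ ⟧ p × ⟦ ψ ⟧ p
    ⟦ φ imp ψ ⟧     p = ⟦ φ ⟧ p → ⟦ ψ ⟧ p
    ⟦ every φ ⟧     p = ∀ t → ⟦ φ t ⟧ p
    ⟦ when {P = P} _ φ ⟧ p = P → ⟦ φ ⟧ p
    ⟦ all φ ⟧       _ = ∀ p → ⟦ φ ⟧ p
    ⟦ atMostOne φ ⟧ _ = ∀ p q → ⟦ φ ⟧ p → ⟦ φ ⟧ q → p ≡ q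

    stable : ∀ {b} (φ : Cond m b) p → Stable (⟦ φ ⟧ p)
    stable (has μ t)     p nn = has-stable μ t p nn
    stable input         p nn = input-stable p nn
    stable (not φ)       p nn h = nn λ f → f h
    stable (φ and ψ)     p nn = stable φ p (λ k → nn (k ∘ proj₁)) , stable ψ p (λ k → nn (k ∘ proj₂))
    stable (φ imp ψ)     p nn h = stable ψ p λ k → nn λ f → k (f h)
    stable (every φ)     p nn t = stable (φ t) p λ k → nn λ f → k (f t)
    stable (when d φ)    p nn h = stable φ p λ k → nn λ f → k (f h)
    stable (all φ)       _ nn p = stable φ p λ k → nn λ f → k (f p)
    stable (atMostOne φ) _ nn p q h h′ with p Fin.≟ q
    ... | yes eq = eq
    ... | no ne  = ⊥-elim (nn λ f → ne (f p q h h′))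

  implies : ∀ {s e Γ} → Formula s e Γ → Formula s e Γ → Formula s e Γ
  implies α β = neg (conj α (neg β))

  truth : ∀ {s e Γ} → Formula s e Γ
  truth = forAll 𝕩 (equal 𝕩 𝕩 tt tt)

  -- The largest index comes first: the conjunction for `suc k` is one new conjunct in front of the
  -- conjunction for `k`, so that codes can be computed by primitive recursion on `k`.
  ⋀ : ∀ {s e Γ} k → (Fin k → Formula s e Γ) → Formula s e Γ
  ⋀ zero    φ = truth
  ⋀ (suc k) φ = conj (φ (fromℕ k)) (⋀ k (φ ∘ inject₁))

  -- The subject is named by one variable, and the other one is requantified for an element of the
  -- same process; two variables thus suffice at any depth.
  someAt : ∀ {s e Γ} (u : Var) → Bool.T (Γ u) →
           (∀ {Δ} (v : Var) → Bool.T (Δ v) → Formula s e Δ) → Formula s e Γ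
  someAt 𝕩 h β = exists 𝕪 (conj (β 𝕪 tt) (same 𝕪 𝕩 tt h))
  someAt 𝕪 h β = exists 𝕩 (conj (β 𝕩 tt) (same 𝕩 𝕪 tt h))

  Place : Bool → Scope → Set
  Place false Γ = ⊤
  Place true  Γ = Σ Var (Bool.T ∘ Γ)

  module Translation (m x : ℕ) where

    -- The marks are numbered before the input letters, so their numbers do not depend on `x`.
    embed : Mark → Fin m → Action (m + m + x) (m + m)
    embed fire    t = inj₁ ((t ↑ˡ m) ↑ˡ x)
    embed retire  t = inj₁ ((m ↑ʳ t) ↑ˡ x)
    embed confirm t = inj₂ (t ↑ˡ m)
    embed close   t = inj₂ (m ↑ʳ t)

    inputLetter : Fin x → Action (m + m + x) (m + m)
    inputLetter k = inj₁ ((m + m) ↑ʳ k)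

    Form : Scope → Set
    Form = Formula (m + m + x) (m + m)

    noMark : ∀ {Γ} (u : Var) → Bool.T (Γ u) → Fin m → Form Γ
    noMark u h t = conj (lacks fire) (conj (lacks confirm) (conj (lacks retire) (lacks close)))
      where lacks = λ μ → neg (act (embed μ t) u h)

    isInput : ∀ {Γ} (u : Var) → Bool.T (Γ u) → Form Γ
    isInput u h = conj (neg (isP-SE u h)) (⋀ m (noMark u h))

    translate : ∀ {b Γ} → Cond m b → Place b Γ → Form Γ
    translate (has μ t)        (u , h) = someAt u h (act (embed μ t))
    translate input            (u , h) = someAt u h isInput
    translate (not φ)          ρ = neg (translate φ ρ)
    translate (φ and ψ)        ρ = conj (translate φ ρ) (translate ψ ρ)
    translate (φ imp ψ)        ρ = implies (translate φ ρ) (translate ψ ρ)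
    translate (every φ)        ρ = ⋀ m λ t → translate (φ t) ρ
    translate (when (yes _) φ) ρ = translate φ ρ
    translate (when (no _) φ)  ρ = truth
    translate (all φ)          _ = forAll 𝕩 (translate φ (𝕩 , tt))
    translate (atMostOne φ)    _ = forAll 𝕩 (implies (translate φ (𝕩 , tt))
      (forAll 𝕪 (implies (translate φ (𝕪 , tt)) (same 𝕩 𝕪 tt tt))))

    -- The input letters mark the initial tokens of register 0.  They are the
    -- letters that are no marks: only the formula inputs depends on x.
    inputsApart : Form ∅
    inputsApart = forAll 𝕩 (implies (isInput 𝕩 tt) (forAll 𝕪
      (implies (conj (isInput 𝕪 tt) (same 𝕩 𝕪 tt tt)) (equal 𝕩 𝕪 tt tt))))

    atOneProcess : Action (m + m + x) (m + m) → Form ∅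
    atOneProcess a = exists 𝕩 (conj (act a 𝕩 tt) (forAll 𝕪
      (neg (conj (act a 𝕪 tt) (neg (same 𝕩 𝕪 tt tt))))))

    inputs : Form ∅
    inputs = ⋀ x (atOneProcess ∘ inputLetter)

  -- Codes of formulas as unevaluated trees

  data Tree : Set where
    leaf : ℕ → Tree
    node : Tree → Tree → Tree

  number : Tree → ℕ
  number (leaf n)   = n
  number (node s t) = pair (number s) (number t)

  treeAction : ∀ {s e} → Action s e → Tree
  treeAction (inj₁ a) = node (leaf 0) (leaf (toℕ a))
  treeAction (inj₂ a) = node (leaf 1) (leaf (toℕ a))

  treeVar : Var → Tree
  treeVar u = leaf (codeVar u)

  -- codeFormula before the pairs are evaluated: equal codes can then be proved
  -- without computing with large numerals.
  tree : ∀ {s e Γ} → Formula s e Γ → Tree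
  tree (act a u _)     = node (leaf 0) (node (treeAction a) (treeVar u))
  tree (equal u v _ _) = node (leaf 1) (node (treeVar u) (treeVar v))
  tree (same u v _ _)  = node (leaf 2) (node (treeVar u) (treeVar v))
  tree (isP-SE u _)    = node (leaf 3) (treeVar u)
  tree (isP-S u _)     = node (leaf 4) (treeVar u)
  tree (isP-E u _)     = node (leaf 5) (treeVar u)
  tree (neg φ)         = node (leaf 6) (tree φ)
  tree (conj φ ψ)      = node (leaf 7) (node (tree φ) (tree ψ))
  tree (disj φ ψ)      = node (leaf 8) (node (tree φ) (tree ψ))
  tree (exists u φ)    = node (leaf 9) (node (treeVar u) (tree φ))
  tree (forAll u φ)    = node (leaf 10) (node (treeVar u) (tree φ))

  number-node : ∀ s t {a b} → number s ≡ a → number t ≡ b → number (node s t) ≡ pair a b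
  number-node s t = cong₂ pair

  number-node₂ : ∀ n s t {a b} → number s ≡ a → number t ≡ b →
                 number (node (leaf n) (node s t)) ≡ pair n (pair a b)
  number-node₂ n s t p q = number-node (leaf n) (node s t) refl (number-node s t p q)

  number-treeAction : ∀ {s e} (a : Action s e) → number (treeAction a) ≡ codeAction a
  number-treeAction (inj₁ a) = number-node (leaf 0) (leaf (toℕ a)) refl refl
  number-treeAction (inj₂ a) = number-node (leaf 1) (leaf (toℕ a)) refl refl

  number-tree : ∀ {s e Γ} (φ : Formula s e Γ) → number (tree φ) ≡ codeFormula φ
  number-tree (act a u _)     = number-node₂ 0 (treeAction a) (treeVar u) {codeAction a} {codeVar u} (number-treeAction a) refl
  number-tree (equal u v _ _) = number-node₂ 1 (treeVar u) (treeVar v) {codeVar u} {codeVar v} refl refl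
  number-tree (same u v _ _)  = number-node₂ 2 (treeVar u) (treeVar v) {codeVar u} {codeVar v} refl refl
  number-tree (isP-SE u _)    = number-node (leaf 3) (treeVar u) {3} {codeVar u} refl refl
  number-tree (isP-S u _)     = number-node (leaf 4) (treeVar u) {4} {codeVar u} refl refl
  number-tree (isP-E u _)     = number-node (leaf 5) (treeVar u) {5} {codeVar u} refl refl
  number-tree (neg φ)         = number-node (leaf 6) (tree φ) {6} {codeFormula φ} refl (number-tree φ)
  number-tree (conj φ ψ)      = number-node₂ 7 (tree φ) (tree ψ) {codeFormula φ} {codeFormula ψ} (number-tree φ) (number-tree ψ)
  number-tree (disj φ ψ)      = number-node₂ 8 (tree φ) (tree ψ) {codeFormula φ} {codeFormula ψ} (number-tree φ) (number-tree ψ)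
  number-tree (exists u φ)    = number-node₂ 9 (treeVar u) (tree φ) {codeVar u} {codeFormula φ} refl (number-tree φ)
  number-tree (forAll u φ)    = number-node₂ 10 (treeVar u) (tree φ) {codeVar u} {codeFormula φ} refl (number-tree φ)

  module _ (m x : ℕ) where
    private
      module X = Translation m x
      module O = Translation m 0

      node₂ : ℕ → Tree → Tree → Tree
      node₂ n s t = node (leaf n) (node s t)

    tree-⋀ : ∀ {s s′ e e′ Γ} k {φ : Fin k → Formula s e Γ} {ψ : Fin k → Formula s′ e′ Γ} →
             (∀ i → tree (φ i) ≡ tree (ψ i)) → tree (⋀ k φ) ≡ tree (⋀ k ψ)
    tree-⋀ zero    eq = refl
    tree-⋀ (suc k) eq = cong₂ (node₂ 7) (eq (fromℕ k)) (tree-⋀ k (eq ∘ inject₁))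

    tree-embed : ∀ μ t → treeAction (X.embed μ t) ≡ treeAction (O.embed μ t)
    tree-embed fire    t = cong (node (leaf 0) ∘ leaf) (trans (toℕ-↑ˡ _ x) (sym (toℕ-↑ˡ _ 0)))
    tree-embed retire  t = cong (node (leaf 0) ∘ leaf) (trans (toℕ-↑ˡ _ x) (sym (toℕ-↑ˡ _ 0)))
    tree-embed confirm t = refl
    tree-embed close   t = refl

    tree-someAt : ∀ {s s′ e e′ Γ} u h {β : ∀ {Δ} (v : Var) → Bool.T (Δ v) → Formula s e Δ}
                  {β′ : ∀ {Δ} (v : Var) → Bool.T (Δ v) → Formula s′ e′ Δ} →
                  (∀ {Δ} v h → tree (β {Δ} v h) ≡ tree (β′ {Δ} v h)) →
                  tree (someAt {Γ = Γ} u h β) ≡ tree (someAt {Γ = Γ} u h β′)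
    tree-someAt {Γ = Γ} 𝕩 h eq =
      cong (λ a → node₂ 9 (treeVar 𝕪) (node₂ 7 a (node₂ 2 (treeVar 𝕪) (treeVar 𝕩)))) (eq {bind 𝕪 Γ} 𝕪 tt)
    tree-someAt {Γ = Γ} 𝕪 h eq =
      cong (λ a → node₂ 9 (treeVar 𝕩) (node₂ 7 a (node₂ 2 (treeVar 𝕩) (treeVar 𝕪)))) (eq {bind 𝕩 Γ} 𝕩 tt)

    tree-act : ∀ {Γ} u h μ t → tree {Γ = Γ} (act (X.embed μ t) u h) ≡ tree {Γ = Γ} (act (O.embed μ t) u h)
    tree-act u h μ t = cong (λ a → node₂ 0 a (treeVar u)) (tree-embed μ t)

    tree-isInput : ∀ {Γ} u h → tree (X.isInput {Γ} u h) ≡ tree (O.isInput {Γ} u h)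
    tree-isInput {Γ} u h = cong (node₂ 7 _) (tree-⋀ m λ t →
      cong₂ (λ a b → node₂ 7 (node (leaf 6) a) b) (tree-act {Γ} u h fire t)
      (cong₂ (λ a b → node₂ 7 (node (leaf 6) a) b) (tree-act {Γ} u h confirm t)
      (cong₂ (λ a b → node₂ 7 (node (leaf 6) a) (node (leaf 6) b))
        (tree-act {Γ} u h retire t) (tree-act {Γ} u h close t))))

    tree-inputsApart : tree X.inputsApart ≡ tree O.inputsApart
    tree-inputsApart = cong₂ (λ a b → node₂ 10 (treeVar 𝕩) (node (leaf 6) (node₂ 7 a (node (leaf 6)
      (node₂ 10 (treeVar 𝕪) (node (leaf 6) (node₂ 7 (node₂ 7 b (node₂ 2 (treeVar 𝕩) (treeVar 𝕪)))
        (node (leaf 6) (node₂ 1 (treeVar 𝕩) (treeVar 𝕪))))))))))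
      (tree-isInput {bind 𝕩 ∅} 𝕩 tt) (tree-isInput {bind 𝕪 (bind 𝕩 ∅)} 𝕪 tt)

    -- An action enters the code only by its number, which for a mark is the same whatever `x` is.
    -- The two formulas have different types, so the comparison is made on trees.
    tree-translate : ∀ {b Γ} (φ : Cond m b) (ρ : Place b Γ) →
                     tree (X.translate φ ρ) ≡ tree (O.translate φ ρ)
    tree-translate (has μ t)        (u , h) = tree-someAt u h λ {Δ} v h → tree-act {Δ} v h μ t
    tree-translate input            (u , h) = tree-someAt u h λ {Δ} → tree-isInput {Δ}
    tree-translate (not φ)          ρ = cong (node (leaf 6)) (tree-translate φ ρ)
    tree-translate (φ and ψ)        ρ = cong₂ (node₂ 7) (tree-translate φ ρ) (tree-translate ψ ρ)
    tree-translate (φ imp ψ)        ρ =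
      cong₂ (λ a b → node (leaf 6) (node₂ 7 a (node (leaf 6) b))) (tree-translate φ ρ) (tree-translate ψ ρ)
    tree-translate (every φ)        ρ = tree-⋀ m λ t → tree-translate (φ t) ρ
    tree-translate (when (yes _) φ) ρ = tree-translate φ ρ
    tree-translate (when (no _) φ)  ρ = refl
    tree-translate (all φ)          _ = cong (node₂ 10 _) (tree-translate φ (𝕩 , tt))
    tree-translate (atMostOne φ)    _ =
      cong₂ (λ a b → node₂ 10 (treeVar 𝕩) (node (leaf 6) (node₂ 7 a (node (leaf 6) (node₂ 10 (treeVar 𝕪)
        (node (leaf 6) (node₂ 7 b (node (leaf 6) (node₂ 2 (treeVar 𝕩) (treeVar 𝕪))))))))))
        (tree-translate φ (𝕩 , tt)) (tree-translate φ (𝕪 , tt))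

  -- The alphabet and the meaning of translated conditions

  Symbol : ℕ → ℕ → Set
  Symbol m x = (Mark × Fin m) ⊎ Fin x

  module Alphabet (m x : ℕ) where
    open Translation m x public

    encode : Symbol m x → Action (m + m + x) (m + m)
    encode (inj₁ (μ , t)) = embed μ t
    encode (inj₂ k)       = inputLetter k

    decode : Action (m + m + x) (m + m) → Symbol m x
    decode (inj₁ i) = [ inj₁ ∘ [ fire ,_ , retire ,_ ]′ ∘ splitAt m , inj₂ ]′ (splitAt (m + m) i)
    decode (inj₂ j) = inj₁ ([ confirm ,_ , close ,_ ]′ (splitAt m j))

    decode-encode : ∀ a → decode (encode a) ≡ a
    decode-encode (inj₁ (fire , t))    rewrite splitAt-↑ˡ (m + m) (t ↑ˡ m) x | splitAt-↑ˡ m t m = refl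
    decode-encode (inj₁ (retire , t))  rewrite splitAt-↑ˡ (m + m) (m ↑ʳ t) x | splitAt-↑ʳ m m t = refl
    decode-encode (inj₁ (confirm , t)) rewrite splitAt-↑ˡ m t m = refl
    decode-encode (inj₁ (close , t))   rewrite splitAt-↑ʳ m m t = refl
    decode-encode (inj₂ k)             rewrite splitAt-↑ʳ (m + m) x k = refl

    encode-decode : ∀ a → encode (decode a) ≡ a
    encode-decode (inj₁ i) with splitAt (m + m) i in eq
    ... | inj₂ k = cong inj₁ (splitAt⁻¹-↑ʳ eq)
    ... | inj₁ j with splitAt m j in eq′
    ...   | inj₁ t = cong inj₁ (trans (cong (_↑ˡ x) (splitAt⁻¹-↑ˡ eq′)) (splitAt⁻¹-↑ˡ eq))
    ...   | inj₂ t = cong inj₁ (trans (cong (_↑ˡ x) (splitAt⁻¹-↑ʳ eq′)) (splitAt⁻¹-↑ˡ eq))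
    encode-decode (inj₂ j) with splitAt m j in eq
    ... | inj₁ t = cong inj₂ (splitAt⁻¹-↑ˡ eq)
    ... | inj₂ t = cong inj₂ (splitAt⁻¹-↑ʳ eq)

    encode-injective : ∀ {a b} → encode a ≡ encode b → a ≡ b
    encode-injective {a} {b} eq =
      trans (sym (decode-encode a)) (trans (cong decode eq) (decode-encode b))

  module Satisfaction (m x n : ℕ) where
    open Alphabet m x public
    open Game (m + m + x) (m + m) n public

    occurs : Word → Symbol m x → Process → Set
    occurs w a p = ¬ ¬ ∃ λ i → letter w i ≡ (encode a , p)

    marking : Word → Marking m n
    marking w = record
      { Has          = λ μ t → occurs w (inj₁ (μ , t))
      ; Input        = λ p → ¬ ¬ ∃ λ k → ∃ λ i → letter w i ≡ (inputLetter k , p)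
      ; has-stable   = λ _ _ _ nn k → nn λ f → f k
      ; input-stable = λ _ nn k → nn λ f → f k
      }

    module _ (w : Word) where
      open Semantics (marking w)
      open Equivalence

      InputAt : Element w → Set
      InputAt d = ∃ λ k → ∃ λ i → d ≡ inj₁ i × proj₁ (letter w i) ≡ inputLetter k

      sat-⋀ : ∀ {Γ} k (φ : Fin k → Form Γ) (ρ : Assignment w Γ) →
              Sat w ρ (⋀ k φ) ⇔ (∀ i → Sat w ρ (φ i))
      sat-⋀ zero    φ ρ = mk⇔ (λ _ ()) (λ _ _ → refl)
      sat-⋀ (suc k) φ ρ = mk⇔ there (λ f → f (fromℕ k) , from (sat-⋀ k (φ ∘ inject₁) ρ) (f ∘ inject₁))
        where
        there : Sat w ρ (⋀ (suc k) φ) → ∀ i → Sat w ρ (φ i)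
        there (h , hs) i with view i
        ... | ‵fromℕ     = h
        ... | ‵inject₁ j = to (sat-⋀ k (φ ∘ inject₁) ρ) hs j

      sat-someAt : ∀ {Γ} u h {β : ∀ {Δ} (v : Var) → Bool.T (Δ v) → Form Δ} {Q : Element w → Set} →
                   (∀ {Δ} v h (ρ : Assignment w Δ) → Sat w ρ (β v h) ⇔ Q (ρ v h)) →
                   ∀ (ρ : Assignment w Γ) → Sat w ρ (someAt u h β) ⇔
                   (¬ ¬ ∃ λ d → Q d × procOf w d ≡ procOf w (ρ u h))
      sat-someAt 𝕩 h eqv ρ = mk⇔
        (λ nn k → nn λ { (d , q , e) → k (d , to (eqv 𝕪 tt _) q , e) })
        (λ nn k → nn λ { (d , q , e) → k (d , from (eqv 𝕪 tt _) q , e) })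
      sat-someAt 𝕪 h eqv ρ = mk⇔
        (λ nn k → nn λ { (d , q , e) → k (d , to (eqv 𝕩 tt _) q , e) })
        (λ nn k → nn λ { (d , q , e) → k (d , from (eqv 𝕩 tt _) q , e) })

      sat-isInput : ∀ {Γ} u h (ρ : Assignment w Γ) → Sat w ρ (isInput u h) ⇔ InputAt (ρ u h)
      sat-isInput u h ρ = mk⇔ there back
        where
        there : Sat w ρ (isInput u h) → InputAt (ρ u h)
        there (notProc , rest) with ρ u h | to (sat-⋀ m (noMark u h) ρ) rest
        ... | inj₂ p | _ = ⊥-elim (notProc tt)
        ... | inj₁ i | lacks with decode (proj₁ (letter w i)) | encode-decode (proj₁ (letter w i))
        ...   | inj₂ k             | eq = k , i , refl , sym eq
        ...   | inj₁ (fire , t)    | eq = ⊥-elim (proj₁ (lacks t) (sym eq))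
        ...   | inj₁ (confirm , t) | eq = ⊥-elim (proj₁ (proj₂ (lacks t)) (sym eq))
        ...   | inj₁ (retire , t)  | eq = ⊥-elim (proj₁ (proj₂ (proj₂ (lacks t))) (sym eq))
        ...   | inj₁ (close , t)   | eq = ⊥-elim (proj₂ (proj₂ (proj₂ (lacks t))) (sym eq))
        back : InputAt (ρ u h) → Sat w ρ (isInput u h)
        back (k , i , at , eq) = (λ isP → subst (IsProcess w) at isP) ,
          from (sat-⋀ m (noMark u h) ρ) λ t → lacks fire t , lacks confirm t , lacks retire t , lacks close t
          where
          lacks : ∀ μ t → ¬ HasAction w (embed μ t) (ρ u h)
          lacks μ t held with subst (HasAction w (embed μ t)) at held
          ... | eq′ with encode-injective {inj₁ (μ , t)} {inj₂ k} (trans (sym eq′) eq)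
          ...   | ()

      value : ∀ {b Γ} → Assignment w Γ → Place b Γ → Subject b
      value {false} ρ _       = tt
      value {true}  ρ (u , h) = procOf w (ρ u h)

      letter-≡ : ∀ {i a p} → proj₁ (letter w i) ≡ a → proj₂ (letter w i) ≡ p → letter w i ≡ (a , p)
      letter-≡ refl refl = refl

      -- A translated condition depends only on the process of the element that stands for its
      -- subject. Every process is itself an element, so quantifying over elements amounts to
      -- quantifying over processes, including those at which nothing was played.
      sat-translate : ∀ {b Γ} (φ : Cond m b) (ρ : Assignment w Γ) (π : Place b Γ) →
                      Sat w ρ (translate φ π) ⇔ ⟦ φ ⟧ (value ρ π)
      sat-implies : ∀ {b Γ} (φ ψ : Cond m b) (ρ : Assignment w Γ) (π : Place b Γ) →
                    Sat w ρ (implies (translate φ π) (translate ψ π)) ⇔ (⟦ φ ⟧ (value ρ π) → ⟦ ψ ⟧ (value ρ π))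
      sat-implies φ ψ ρ π = mk⇔
        (λ f h → stable ψ _ λ k → f (from (sat-translate φ ρ π) h , k ∘ to (sat-translate ψ ρ π)))
        (λ { f (h , k) → k (from (sat-translate ψ ρ π) (f (to (sat-translate φ ρ π) h))) })

      sat-translate (has μ t) ρ (u , h) = mk⇔
        (λ s k → to here s λ { (inj₁ i , e , e′) → k (i , letter-≡ e e′) })
        (λ nn → from here λ k → nn λ { (i , e) → k (inj₁ i , cong proj₁ e , cong proj₂ e) })
        where here = sat-someAt u h {Q = HasAction w (embed μ t)} (λ _ _ _ → mk⇔ id id) ρ
      sat-translate input ρ (u , h) = mk⇔
        (λ s k → to here s λ { (_ , (l , i , refl , e) , e′) → k (l , i , letter-≡ e e′) })
        (λ nn → from here λ k → nn λ
          { (l , i , e) → k (inj₁ i , (l , i , refl , cong proj₁ e) , cong proj₂ e) })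
        where here = sat-someAt u h {Q = InputAt} sat-isInput ρ
      sat-translate (not φ) ρ π = mk⇔ (λ k → k ∘ from (sat-translate φ ρ π)) (λ k → k ∘ to (sat-translate φ ρ π))
      sat-translate (φ and ψ) ρ π = mk⇔
        (λ (h , k) → to (sat-translate φ ρ π) h , to (sat-translate ψ ρ π) k)
        (λ (h , k) → from (sat-translate φ ρ π) h , from (sat-translate ψ ρ π) k)
      sat-translate (φ imp ψ) ρ π = sat-implies φ ψ ρ π
      sat-translate (every φ) ρ π = mk⇔
        (λ s t → to (sat-translate (φ t) ρ π) (to (sat-⋀ m _ ρ) s t))
        (λ f → from (sat-⋀ m _ ρ) λ t → from (sat-translate (φ t) ρ π) (f t))
      sat-translate (when (yes q) φ) ρ π = mk⇔ (λ s _ → to (sat-translate φ ρ π) s) (λ f → from (sat-translate φ ρ π) (f q))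
      sat-translate (when (no ¬q) φ) ρ π = mk⇔ (λ _ q → ⊥-elim (¬q q)) (λ _ _ → refl)
      sat-translate (all φ) ρ _ = mk⇔
        (λ s p → to (sat-translate φ (assign {w} 𝕩 (inj₂ p) ρ) (𝕩 , tt)) (s (inj₂ p)))
        (λ f d → from (sat-translate φ (assign {w} 𝕩 d ρ) (𝕩 , tt)) (f (procOf w d)))
      sat-translate (atMostOne φ) ρ _ = mk⇔ there back
        where
        A = λ d → sat-translate φ (assign {w} 𝕩 d ρ) (𝕩 , tt)
        B = λ d d′ → sat-translate φ (assign {w} 𝕪 d′ (assign {w} 𝕩 d ρ)) (𝕪 , tt)
        there : Sat w ρ (translate (atMostOne φ) tt) → ⟦ atMostOne φ ⟧ tt
        there s p q h h′ with p Fin.≟ q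
        ... | yes eq = eq
        ... | no ne  = ⊥-elim (s (inj₂ p) (from (A (inj₂ p)) h , λ s′ →
          s′ (inj₂ q) (from (B (inj₂ p) (inj₂ q)) h′ , ne)))
        back : ⟦ atMostOne φ ⟧ tt → Sat w ρ (translate (atMostOne φ) tt)
        back f d (h , k) = k λ { d′ (h′ , k′) → k′ (f _ _ (to (A d) h) (to (B d d′) h′)) }

      apart-sat : (∀ {i j k l p} → letter w i ≡ (inputLetter k , p) → letter w j ≡ (inputLetter l , p) → i ≡ j) →
                  w ⊨ inputsApart
      apart-sat apart d (h , f) = f λ d′ ((h′ , s) , ne) →
        case to (sat-isInput 𝕩 tt (assign {w} 𝕩 d λ _ ())) h ,
             to (sat-isInput 𝕪 tt (assign {w} 𝕪 d′ (assign {w} 𝕩 d λ _ ()))) h′ of λ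
          { ((k , i , refl , e) , (l , j , refl , e′)) →
              ne (cong inj₁ (apart (letter-≡ e refl) (letter-≡ e′ (sym s)))) }

      -- The formula yields equality of the positions only under a double negation. Equality of the
      -- letters is decidable, and it is what injectivity of the placement asks for.
      sat-apart : w ⊨ inputsApart → ∀ {i j k l p} →
                  letter w i ≡ (inputLetter k , p) → letter w j ≡ (inputLetter l , p) → k ≡ l
      sat-apart s {i} {j} {k} {l} e e′ with k Fin.≟ l
      ... | yes eq = eq
      ... | no ne  = ⊥-elim (s (inj₁ i)
        ( from (sat-isInput 𝕩 tt _) (k , i , refl , cong proj₁ e)
        , λ f → f (inj₁ j)
            ( (from (sat-isInput 𝕪 tt _) (l , j , refl , cong proj₁ e′) , trans (cong proj₂ e) (sym (cong proj₂ e′)))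
            , λ { refl → ne (inputLetter-injective (trans (sym (cong proj₁ e)) (cong proj₁ e′))) })))
        where
        inputLetter-injective : ∀ {k l} → inputLetter k ≡ inputLetter l → k ≡ l
        inputLetter-injective {k} {l} eq with encode-injective {inj₂ k} {inj₂ l} eq
        ... | refl = refl

      placed-sat : (∀ k → ¬ ¬ ∃ λ p → (∃ λ i → letter w i ≡ (inputLetter k , p)) ×
                                      (∀ j q → letter w j ≡ (inputLetter k , q) → q ≡ p)) →
                   w ⊨ inputs
      placed-sat h = from (sat-⋀ x _ _) λ k f → h k λ { (p , (i , e) , unique) → f (inj₁ i , cong proj₁ e ,
        λ { (inj₁ j) (e′ , ne) → ne (trans (cong proj₂ e) (sym (unique j _ (letter-≡ e′ refl)))) }) }

      sat-placed : w ⊨ inputs → ∀ k → ¬ ¬ ∃ λ p → (∃ λ i → letter w i ≡ (inputLetter k , p)) ×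
                                                  (∀ j q → letter w j ≡ (inputLetter k , q) → q ≡ p)
      sat-placed s k f = to (sat-⋀ x _ _) s k λ
        { (inj₁ i , e , unique) → f (_ , (i , letter-≡ e refl) , λ j q e′ →
            case q Fin.≟ proj₂ (letter w i) of λ where
              (yes eq) → eq
              (no ne)  → ⊥-elim (unique (inj₁ j) (cong proj₁ e′ , λ eq → ne (trans (sym (cong proj₂ e′)) (sym eq))))) }

-- Processes as counter tokens

module TokenGame where

  open import Data.Bool as Bool using (Bool; true; false; if_then_else_)
  open import Data.Empty using (⊥-elim)
  open import Data.Fin as Fin using (Fin; zero; suc)
  open import Data.Fin.Properties as Fin using (any?)
  open import Data.List using (List; []; _∷_)
  open import Data.List.Membership.Propositional using (_∈_; _∉_)
  open import Data.List.Relation.Unary.Any using (here; there)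
  open import Data.Nat as ℕ using (ℕ; zero; suc; _+_)
  import Data.Nat.Properties as ℕ
  open import Data.Product using (∃; _×_; _,_)
  open import Data.Sum using (_⊎_; inj₁; inj₂; [_,_]′)
  open import Function using (_∘_; case_of_; _⇔_; mk⇔)
  open import Relation.Nullary using (¬_; Dec; yes; no; does)
  open import Relation.Nullary.Decidable using (dec-true; dec-false; does-⇔)
  open import Relation.Binary.PropositionalEquality

  open Compilation using (Val; _[_≔_]; upd-same; upd-other)
  open Machines

  count : ∀ {n} → (Fin n → Bool) → ℕ
  count {zero}  f = 0
  count {suc n} f = (if f zero then 1 else 0) + count (f ∘ suc)

  count-cong : ∀ {n} {f g : Fin n → Bool} → (∀ p → f p ≡ g p) → count f ≡ count g
  count-cong {zero}  eq = refl
  count-cong {suc n} eq = cong₂ (λ b k → (if b then 1 else 0) + k) (eq zero) (count-cong (eq ∘ suc))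

  count-insert : ∀ {n} {f g : Fin n → Bool} p → f p ≡ false → g p ≡ true →
                 (∀ q → q ≢ p → f q ≡ g q) → count g ≡ suc (count f)
  count-insert {suc n} {f} {g} zero fp gp eq rewrite fp | gp =
    cong suc (sym (count-cong λ q → eq (suc q) λ ()))
  count-insert {suc n} {f} {g} (suc p) fp gp eq = trans
    (cong₂ (λ b k → (if b then 1 else 0) + k) (sym (eq zero λ ()))
      (count-insert {f = f ∘ suc} {g ∘ suc} p fp gp λ q q≢p → eq (suc q) (q≢p ∘ Fin.suc-injective)))
    (ℕ.+-suc (if f zero then 1 else 0) _)

  count-false : ∀ {n} {f : Fin n → Bool} → (∀ p → f p ≡ false) → count f ≡ 0
  count-false {zero}  eq = refl
  count-false {suc n} eq rewrite eq zero = count-false (eq ∘ suc)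

  count-true : ∀ {n} {f : Fin n → Bool} p → f p ≡ true → count f ≢ 0
  count-true {suc n} {f} zero    eq rewrite eq = λ ()
  count-true {suc n} {f} (suc p) eq with f zero
  ... | true  = λ ()
  ... | false = count-true p eq

  count-pos : ∀ {n k} (f : Fin n → Bool) → count f ≡ suc k → ∃ λ p → f p ≡ true
  count-pos {suc n} f eq with f zero in eq₀
  ... | true  = zero , eq₀
  ... | false with count-pos (f ∘ suc) eq
  ...   | p , h = suc p , h

  data Status : Set where
    fresh used : Status
    token      : ℕ → Status

  token-injective : ∀ {r s} → token r ≡ token s → r ≡ s
  token-injective refl = refl

  holds : ℕ → Status → Bool
  holds r (token r′) = does (r ℕ.≟ r′)
  holds r _          = false

  holds-true : ∀ {r s} → holds r s ≡ true → s ≡ token r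
  holds-true {r} {token r′} h with r ℕ.≟ r′
  ... | yes refl = refl
  ... | no ne    = case trans (sym h) (dec-false (r ℕ.≟ r′) ne) of λ ()

  isDec : Kind → Bool
  isDec dec = true
  isDec _   = false

  isDec-true : ∀ {k} → isDec k ≡ true → k ≡ dec
  isDec-true {dec} _ = refl

  -- Even `test` and `nop` use up a fresh process: repeating a transition at the same process would
  -- add no letter that a formula could notice.
  after needs : Kind → ℕ → Status
  after inc r = token r
  after _   r = used
  needs dec r = token r
  needs _   r = fresh

  -- Only the status at `p` changes, so each count moves by at most one. No register counts `fresh`
  -- or `used` processes; hence only an `inc` adds a token and only a `dec` removes one.
  counts-effect : ∀ {n k s v v′} {f g : Fin n → Status} p → f p ≡ needs k s → g p ≡ after k s →
                  (∀ q → q ≢ p → f q ≡ g q) → Effect k s v v′ →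
                  (∀ r → count (holds r ∘ f) ≡ v r) → ∀ r → count (holds r ∘ g) ≡ v′ r
  counts-effect {n} {k} {s} {v} {v′} {f} {g} p fp gp eq e c r = go e fp gp
    where
    elsewhere : ∀ q → q ≢ p → holds r (f q) ≡ holds r (g q)
    elsewhere q q≢p = cong (holds r) (eq q q≢p)

    unchanged : holds r (f p) ≡ holds r (g p) → count (holds r ∘ g) ≡ count (holds r ∘ f)
    unchanged h = sym (count-cong λ q → case q Fin.≟ p of λ where
      (yes refl) → h
      (no q≢p)   → elsewhere q q≢p)

    held : ∀ {st} → st ≡ token r → holds r st ≡ true
    held refl = dec-true (r ℕ.≟ r) refl

    other : ∀ {st s} → st ≡ token s → r ≢ s → holds r st ≡ false
    other {s = s} refl r≢s = dec-false (r ℕ.≟ s) r≢s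

    go : Effect k s v v′ → f p ≡ needs k s → g p ≡ after k s → count (holds r ∘ g) ≡ v′ r
    go inc fp gp with r ℕ.≟ s
    ... | yes refl = trans (count-insert p (cong (holds r) fp) (held gp) elsewhere)
                           (trans (cong suc (c r)) (sym (upd-same v r)))
    ... | no r≢s   = trans (unchanged (trans (cong (holds r) fp) (sym (other gp r≢s))))
                           (trans (c r) (sym (upd-other v r≢s)))
    go (dec pos) fp gp with r ℕ.≟ s
    ... | yes refl = ℕ.suc-injective
      (trans (sym (count-insert p (cong (holds r) gp) (held fp) λ q q≢p → sym (elsewhere q q≢p)))
             (trans (c r) (trans pos (cong suc (sym (upd-same v r))))))
    ... | no r≢s   = trans (unchanged (trans (other fp r≢s) (sym (cong (holds r) gp))))
                           (trans (c r) (sym (upd-other v r≢s)))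
    go (test _) fp gp = trans (unchanged (trans (cong (holds r) fp) (sym (cong (holds r) gp)))) (c r)
    go nop      fp gp = trans (unchanged (trans (cong (holds r) fp) (sym (cong (holds r) gp)))) (c r)

  -- Processes as counter tokens: a process is fresh until an inc, test or nop
  -- event uses it; an inc event makes it a token, and a dec event uses up a token.
  module Tokens (M : Machine) {n x : ℕ} (π : Fin x → Fin n) where
    open Machine M

    Event : Set
    Event = Fin #trans × Fin n

    IsInput : Fin n → Set
    IsInput p = ∃ λ k → π k ≡ p

    isInput? : ∀ p → Dec (IsInput p)
    isInput? p = any? λ k → π k Fin.≟ p

    status : List Event → Fin n → Status
    status []             p = if does (isInput? p) then token 0 else fresh
    status ((t , q) ∷ es) p = if does (p Fin.≟ q) then after (kind t) (reg t) else status es p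

    status-here : ∀ t p es → status ((t , p) ∷ es) p ≡ after (kind t) (reg t)
    status-here t p es = cong (if_then after (kind t) (reg t) else status es p) (dec-true (p Fin.≟ p) refl)

    status-there : ∀ {t p q es} → p ≢ q → status ((t , q) ∷ es) p ≡ status es p
    status-there {t} {p} {q} {es} p≢q = cong (if_then after (kind t) (reg t) else status es p) (dec-false (p Fin.≟ q) p≢q)

    state : List Event → ℕ
    state []            = 0
    state ((t , _) ∷ _) = dst t

    tail : List Event → List Event
    tail []       = []
    tail (_ ∷ es) = es

    Clear : List Event → Fin #trans → Set
    Clear es t = kind t ≡ test → ∀ p → status es p ≢ token (reg t)

    -- Histories of the token game, latest event first.
    data Legal : List Event → Set where
      []   : Legal []
      fire : ∀ {es t p} → Legal es → src t ≡ state es → status es p ≡ needs (kind t) (reg t) →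
             Clear es t → Legal ((t , p) ∷ es)

    Counts : List Event → Val → Set
    Counts es v = ∀ r → count (holds r ∘ status es) ≡ v r

    counts-fire : ∀ {es t p v v′} → status es p ≡ needs (kind t) (reg t) →
                  Effect (kind t) (reg t) v v′ → Counts es v → Counts ((t , p) ∷ es) v′
    counts-fire {es} {t} {p} st e c =
      counts-effect {f = status es} {status ((t , p) ∷ es)} p st (status-here t p es)
        (λ q q≢p → sym (status-there {es = es} q≢p)) e c

    -- A token at `p` witnesses that its register is positive, and the absence of tokens that the
    -- tested register is 0.
    legal-effect : ∀ {es t p v} → status es p ≡ needs (kind t) (reg t) → Clear es t → Counts es v →
                   ∃ λ v′ → Effect (kind t) (reg t) v v′
    legal-effect {es} {t} {p} {v} st tst c with kind t
    ... | inc  = _ , inc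
    ... | nop  = _ , nop
    ... | dec with v (reg t) in eq
    ...   | suc k = _ , dec eq
    ...   | zero  = ⊥-elim (count-true p (trans (cong (holds (reg t)) st) (dec-true (reg t ℕ.≟ reg t) refl))
                                       (trans (c (reg t)) eq))
    legal-effect {es} {t} {p} {v} st tst c | test = _ , test (trans (sym (c (reg t)))
      (count-false λ q → none q))
      where
      none : ∀ q → holds (reg t) (status es q) ≡ false
      none q with holds (reg t) (status es q) in eq
      ... | false = refl
      ... | true  = ⊥-elim (tst refl q (holds-true eq))

    -- The clause `status es p ≡ fresh → p ≡ p₀` says that no fresh process but the one offered is
    -- spent; the rest of a supply remains for later steps.
    effect-legal : ∀ {es t p₀ v v′} → status es p₀ ≡ fresh → Effect (kind t) (reg t) v v′ → Counts es v →
                   (∃ λ p → status es p ≡ needs (kind t) (reg t) × (status es p ≡ fresh → p ≡ p₀)) × Clear es t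
    effect-legal {es} {t} {p₀} fr e c with kind t | reg t
    effect-legal fr inc c | inc | r = (_ , fr , λ _ → refl) , λ ()
    effect-legal fr nop c | nop | r = (_ , fr , λ _ → refl) , λ ()
    effect-legal {es} fr (dec pos) c | dec | r with count-pos (holds r ∘ status es) (trans (c r) pos)
    ... | p , h = (p , holds-true h , λ f → case trans (sym f) (holds-true h) of λ ()) , λ ()
    effect-legal fr (test z) c | test | r = (_ , fr , λ _ → refl) , λ _ q tok →
      count-true q (trans (cong (holds r) tok) (dec-true (r ℕ.≟ r) refl)) (trans (c r) z)

    trace : List Event → Fin n → List (Fin #trans)
    trace []             p = []
    trace ((t , q) ∷ es) p = if does (p Fin.≟ q) then t ∷ trace es p else trace es p

    ∈-trace : ∀ {es t p} → (t , p) ∈ es → t ∈ trace es p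
    ∈-trace {_ ∷ es} {p = p} (here refl) rewrite dec-true (p Fin.≟ p) refl = here refl
    ∈-trace {(_ , q) ∷ es} {p = p} (there h) with p Fin.≟ q
    ... | yes _ = there (∈-trace h)
    ... | no _  = ∈-trace h

    trace-∈ : ∀ {es t p} → t ∈ trace es p → (t , p) ∈ es
    trace-∈ {(_ , q) ∷ es} {p = p} h with p Fin.≟ q
    trace-∈ {(_ , q) ∷ es} (here refl) | yes refl = here refl
    trace-∈ {(_ , q) ∷ es} (there h)   | yes refl = there (trace-∈ h)
    trace-∈ {(_ , q) ∷ es} h           | no _     = there (trace-∈ h)

    -- All possible lives of a process, latest event first: at most one event that is not a `dec`,
    -- and at most one `dec` after it. The kinds thus determine the order, so the set of events at a
    -- process determines its status, and sets are all that formulas see.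
    data Shape (p : Fin n) : List (Fin #trans) → Status → Set where
      untouched  : ¬ IsInput p → Shape p [] fresh
      given      : IsInput p → Shape p [] (token 0)
      once       : ∀ {t} → ¬ IsInput p → isDec (kind t) ≡ false →
                   Shape p (t ∷ []) (after (kind t) (reg t))
      givenSpent : ∀ {t} → IsInput p → kind t ≡ dec → reg t ≡ 0 → Shape p (t ∷ []) used
      spent      : ∀ {t t′} → ¬ IsInput p → kind t ≡ dec → kind t′ ≡ inc → reg t ≡ reg t′ →
                   Shape p (t ∷ t′ ∷ []) used

    after-token : ∀ {k r s} → after k r ≡ token s → k ≡ inc × r ≡ s
    after-token {inc} refl = refl , refl

    after≢fresh : ∀ {k r} → after k r ≢ fresh
    after≢fresh {inc} ()

    needs-plain : ∀ {k r} → isDec k ≡ false → needs k r ≡ fresh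
    needs-plain {inc}  _ = refl
    needs-plain {test} _ = refl
    needs-plain {nop}  _ = refl

    shape-fire : ∀ {p l st} t → Shape p l st → st ≡ needs (kind t) (reg t) →
                 Shape p (t ∷ l) (after (kind t) (reg t))
    shape-fire {p} {l} {st} t sh eq with isDec (kind t) in d
    ... | false = plain sh (trans eq (needs-plain d))
      where
      plain : ∀ {l st} → Shape p l st → st ≡ fresh → Shape p (t ∷ l) (after (kind t) (reg t))
      plain (untouched ni) _ = once ni d
      plain (once _ _) eq = ⊥-elim (after≢fresh eq)
    ... | true = subst (λ k → Shape p (t ∷ l) (after k (reg t))) (sym k≡dec)
                   (spend sh (trans eq (cong (λ k → needs k (reg t)) k≡dec)))
      where
      k≡dec = isDec-true d
      spend : ∀ {l st} → Shape p l st → st ≡ token (reg t) → Shape p (t ∷ l) used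
      spend (given i) eq = givenSpent i k≡dec (sym (token-injective eq))
      spend (once ni _) eq with after-token eq
      ... | k≡inc , r≡ = spent ni k≡dec k≡inc (sym r≡)

    shape : ∀ {es} → Legal es → ∀ p → Shape p (trace es p) (status es p)
    shape [] p with isInput? p
    ... | yes i = given i
    ... | no ni = untouched ni
    shape (fire {es} {t} {q} L _ st _) p with p Fin.≟ q
    ... | yes refl = shape-fire t (shape L p) st
    ... | no _     = shape L p

    -- The two origins of a token, an `inc` or an input letter for register 0. `Fired` is a
    -- parameter so that histories and single traces can both be plugged in.
    Made : (Fin n → Fin #trans → Set) → Fin n → ℕ → Set
    Made Fired p r = (∃ λ t → Fired p t × kind t ≡ inc × reg t ≡ r) ⊎ (r ≡ 0 × IsInput p)

    FiredIn : List Event → Fin n → Fin #trans → Set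
    FiredIn es p t = (t , p) ∈ es

    module _ {es} (L : Legal es) where
      private
        ∈Shape : ∀ {p} (Q : List (Fin #trans) → Status → Set) →
                 (∀ {l st} → Shape p l st → Q l st) → Q (trace es p) (status es p)
        ∈Shape {p} Q f = f (shape L p)

        dec≢inc : ∀ {k : Kind} → k ≡ dec → k ≢ inc
        dec≢inc refl ()

        plain≢dec : ∀ {k : Kind} → isDec k ≡ false → k ≢ dec
        plain≢dec () refl

      -- At a process that is no input, a `dec` presupposes an `inc`; if only `dec` events are
      -- allowed, there is no event at all.
      fresh-if : ∀ {p} → (∀ t → (t , p) ∈ es → kind t ≡ dec) → ¬ IsInput p → status es p ≡ fresh
      fresh-if {p} spends ni = ∈Shape (λ l st → (∀ t → t ∈ l → kind t ≡ dec) → st ≡ fresh)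
        (λ { (untouched _) h → refl
           ; (given i) h → ⊥-elim (ni i)
           ; (once _ d) h → ⊥-elim (plain≢dec d (h _ (here refl)))
           ; (givenSpent i _ _) h → ⊥-elim (ni i)
           ; (spent _ _ k _) h → ⊥-elim (dec≢inc (h _ (there (here refl))) k) })
        (λ t → spends t ∘ trace-∈)

      token-if : ∀ {p r} → Made (FiredIn es) p r → (∀ t → (t , p) ∈ es → kind t ≢ dec) →
                 status es p ≡ token r
      token-if {p} {r} made unspent =
        ∈Shape (λ l st → Made (λ _ t → t ∈ l) p r → (∀ t → t ∈ l → kind t ≢ dec) → st ≡ token r)
        (λ { (untouched ni) (inj₂ (_ , i)) h → ⊥-elim (ni i)
           ; (given i) (inj₂ (refl , _)) h → refl
           ; (once {t} _ _) (inj₁ (_ , here refl , k , refl)) h → cong (λ k → after k (reg t)) k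
           ; (once ni _) (inj₂ (_ , i)) h → ⊥-elim (ni i)
           ; (givenSpent _ k _) _ h → ⊥-elim (h _ (here refl) k)
           ; (spent _ k _ _) _ h → ⊥-elim (h _ (here refl) k) })
        ([ (λ (t , f , h) → inj₁ (t , ∈-trace f , h)) , inj₂ ]′ made) (λ t → unspent t ∘ trace-∈)

      token-made : ∀ {p r} → status es p ≡ token r →
                   Made (FiredIn es) p r × (∀ t → (t , p) ∈ es → kind t ≢ dec)
      token-made {p} {r} eq with ∈Shape {p} (λ l st → st ≡ token r → Made (λ _ t → t ∈ l) p r ×
                                                         (∀ t → t ∈ l → kind t ≢ dec))
        (λ { (given i) refl → inj₂ (refl , i) , λ _ ()
           ; (once {t} _ d) eq → let k , r≡ = after-token eq in
               inj₁ (t , here refl , k , r≡) , λ { _ (here refl) → plain≢dec d } }) eq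
      ... | inj₁ (t , f , h) , g = inj₁ (t , trace-∈ f , h) , λ t → g t ∘ ∈-trace
      ... | inj₂ h , g           = inj₂ h , λ t → g t ∘ ∈-trace

      fired-unique : ∀ {p t t′} → (t , p) ∈ es → (t′ , p) ∈ es →
                     isDec (kind t) ≡ isDec (kind t′) → t ≡ t′
      fired-unique {p} {t} {t′} f f′ = ∈Shape (λ l st → t ∈ l → t′ ∈ l → isDec (kind t) ≡ isDec (kind t′) → t ≡ t′)
        (λ { (once _ _) (here refl) (here refl) _ → refl
           ; (givenSpent _ _ _) (here refl) (here refl) _ → refl
           ; (spent _ _ _ _) (here refl) (here refl) _ → refl
           ; (spent _ _ _ _) (there (here refl)) (there (here refl)) _ → refl
           ; (spent _ k k′ _) (here refl) (there (here refl)) eq →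
               case trans (sym (cong isDec k)) (trans eq (cong isDec k′)) of λ ()
           ; (spent _ k k′ _) (there (here refl)) (here refl) eq →
               case trans (sym (cong isDec k)) (trans (sym eq) (cong isDec k′)) of λ () })
        (∈-trace f) (∈-trace f′)

      plain-not-input : ∀ {p t} → (t , p) ∈ es → kind t ≢ dec → ¬ IsInput p
      plain-not-input {p} {t} f = ∈Shape (λ l st → t ∈ l → kind t ≢ dec → ¬ IsInput p)
        (λ { (once ni _) _ _ → ni
           ; (givenSpent _ k _) (here refl) nd → ⊥-elim (nd k)
           ; (spent ni _ _ _) _ _ → ni })
        (∈-trace f)

      dec-made : ∀ {p t} → (t , p) ∈ es → kind t ≡ dec → Made (FiredIn es) p (reg t)
      dec-made {p} {t} f k with ∈Shape (λ l st → t ∈ l → kind t ≡ dec → Made (λ _ t → t ∈ l) p (reg t))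
        (λ { (once _ d) (here refl) k → ⊥-elim (plain≢dec d k)
           ; (givenSpent i _ r) (here refl) _ → inj₂ (r , i)
           ; (spent _ _ k′ r) (here refl) _ → inj₁ (_ , there (here refl) , k′ , sym r)
           ; (spent _ _ k′ _) (there (here refl)) k → ⊥-elim (dec≢inc k k′) })
        (∈-trace f) k
      ... | inj₁ (t , f , h) = inj₁ (t , trace-∈ f , h)
      ... | inj₂ h           = inj₂ h

      -- A process never becomes fresh again after an event, and a spent token never returns. So
      -- events do not repeat, and a set of marks can stand for a history.
      not-again : ∀ {p t} → status es p ≡ needs (kind t) (reg t) → (t , p) ∉ es
      not-again {p} {t} st f = ∈Shape (λ l st → st ≡ needs (kind t) (reg t) → t ∉ l)
        (λ { (once {t} _ d) eq (here refl) → after≢fresh (trans eq (needs-plain d))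
           ; (givenSpent {t} _ k _) eq (here refl) → case trans eq (cong (λ k → needs k (reg t)) k) of λ ()
           ; (spent {t} _ k _ _) eq (here refl) → case trans eq (cong (λ k → needs k (reg t)) k) of λ ()
           ; (spent {t′ = t} _ _ k _) eq (there (here refl)) → case trans eq (cong (λ k → needs k (reg t)) k) of λ () })
        st (∈-trace f)

  counts-input : ∀ {n x} (π : Fin x → Fin n) → (∀ {k l} → π k ≡ π l → k ≡ l) →
                 count (λ p → does (any? λ k → π k Fin.≟ p)) ≡ x
  counts-input {x = zero}  π inj = count-false {f = λ p → does (any? λ k → π k Fin.≟ p)} λ p → refl
  counts-input {x = suc x} π inj = trans
    (count-insert {f = λ p → does (any? λ k → π (suc k) Fin.≟ p)} (π zero)
      (dec-false (any? λ k → π (suc k) Fin.≟ π zero) λ { (k , eq) → case inj eq of λ () })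
      (dec-true (any? λ k → π k Fin.≟ π zero) (zero , refl))
      (λ q q≢ → does-⇔ (mk⇔ (λ (k , eq) → suc k , eq)
        λ { (zero , eq) → ⊥-elim (q≢ (sym eq)) ; (suc k , eq) → k , eq })
        (any? λ k → π (suc k) Fin.≟ q) (any? λ k → π k Fin.≟ q)))
    (cong suc (counts-input (π ∘ suc) λ eq → Fin.suc-injective (inj eq)))

-- The winning condition and its link to legal histories

module Rules where

  open import Data.Bool as Bool using (Bool; true; false)
  open import Data.Empty using (⊥; ⊥-elim)
  open import Data.Fin as Fin using (Fin; zero; suc)
  open import Data.List using (List; []; _∷_)
  open import Data.List.Membership.Propositional using (_∈_; _∉_)
  open import Data.List.Relation.Unary.Any using (here; there)
  open import Data.Nat as ℕ using (ℕ; zero; suc)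
  open import Data.Product using (∃; _×_; _,_; proj₁; proj₂)
  open import Data.Product.Properties using (,-injectiveˡ; ,-injectiveʳ; ≡-dec)
  open import Data.Sum using (_⊎_; inj₁; inj₂; [_,_]′)
  open import Data.Unit using (⊤; tt)
  open import Function using (_∘_; case_of_; _⇔_; mk⇔; Equivalence)
  open import Relation.Nullary using (¬_; yes; no; ¬?; _×-dec_)
  open import Relation.Nullary.Decidable using (decidable-stable)
  open import Relation.Binary using (DecidableEquality)
  open import Relation.Binary.PropositionalEquality

  open Compilation using (_[_≔_])
  open Machines
  open ProcessLogic
  open TokenGame

  _≟ᴷ_ : DecidableEquality Kind
  inc  ≟ᴷ inc  = yes refl
  inc  ≟ᴷ dec  = no λ ()
  inc  ≟ᴷ test = no λ ()
  inc  ≟ᴷ nop  = no λ ()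
  dec  ≟ᴷ inc  = no λ ()
  dec  ≟ᴷ dec  = yes refl
  dec  ≟ᴷ test = no λ ()
  dec  ≟ᴷ nop  = no λ ()
  test ≟ᴷ inc  = no λ ()
  test ≟ᴷ dec  = no λ ()
  test ≟ᴷ test = yes refl
  test ≟ᴷ nop  = no λ ()
  nop  ≟ᴷ inc  = no λ ()
  nop  ≟ᴷ dec  = no λ ()
  nop  ≟ᴷ test = no λ ()
  nop  ≟ᴷ nop  = yes refl

  -- Once System has moved, the latest event is new and the one before is
  -- leaving.  Environment has to close the latter and to confirm the former,
  -- which becomes current; System then retires it and fires the next event.
  module Specification (M : Machine) where
    open Machine M renaming (#trans to m)

    new current leaving : Fin m → Cond m true
    new t     = has fire t and not (has confirm t)
    current t = has confirm t and not (has retire t)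
    leaving t = has retire t and not (has close t)

    none : (Fin m → Cond m true) → Cond m false
    none φ = every λ t → all (not (φ t))

    -- The two processes may differ, yet neither is named in terms of the other: each half is a
    -- closed condition.
    clash : Cond m true → Cond m true → Cond m false
    clash φ ψ = not (all (not φ)) imp all (not ψ)

    orderly unaccepted : Cond m false
    orderly    = every λ t → all ((has confirm t imp has fire t) and (has close t imp has retire t))
    unaccepted = every λ t → when (dst t ℕ.≟ accept) (all (not (has confirm t)))

    -- `Made` in negative form, since conditions have no disjunction; it gives back `Made` only
    -- under a double negation.
    made : ℕ → Cond m true
    made r = not ((every λ t → when ((kind t ≟ᴷ inc) ×-dec (reg t ℕ.≟ r)) (not (has fire t)))
                  and when (r ℕ.≟ 0) (not input))

    unspent : Cond m true
    unspent = every λ t → when (kind t ≟ᴷ dec) (not (has fire t))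

    -- The first three settle whose turn it is: when nothing is leaving, the current event must have
    -- been retired, and when nothing is current, there must be a new event. The next five make the
    -- new event unique and admissible as to states and tests. The last three concern all fired
    -- events and force the marks at each process into one of the shapes of a legal history.
    retire⇒confirm current⇒leaving moved one-new distinct-new follows starts clears-tests
      one-use not-input dec⇒made pending : Cond m false
    retire⇒confirm  = every λ t → all (has retire t imp has confirm t)
    current⇒leaving = none leaving imp none current
    moved           = none current imp not (none new)
    one-new         = every λ t → atMostOne (new t)
    distinct-new    = every λ t → every λ t′ → when (¬? (t Fin.≟ t′)) (clash (new t) (new t′))
    follows         = every λ t → every λ t′ → when (¬? (src t′ ℕ.≟ dst t)) (clash (leaving t) (new t′))
    starts          = every λ t → when (¬? (src t ℕ.≟ 0)) (none (has confirm) imp all (not (new t)))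
    clears-tests    = every λ t → when (kind t ≟ᴷ test) (clash (new t) (made (reg t) and unspent))
    one-use         = every λ t → every λ t′ → when (¬? (t Fin.≟ t′) ×-dec (isDec (kind t) Bool.≟ isDec (kind t′)))
                        (all (not (has fire t and has fire t′)))
    not-input       = every λ t → when (¬? (kind t ≟ᴷ dec)) (all (not (has fire t and input)))
    dec⇒made        = every λ t → when (kind t ≟ᴷ dec) (all (has fire t imp made (reg t)))
    pending = retire⇒confirm and current⇒leaving and moved and one-new and distinct-new and follows and
              starts and clears-tests and one-use and not-input and dec⇒made

    -- Environment loses by confirming what was not fired, by closing what was not retired, and by
    -- confirming an accepting event. Otherwise System must leave a situation in which an answer of
    -- Environment is outstanding.
    good : Cond m false
    good = orderly imp unaccepted imp pending

    module _ {n x : ℕ} (π : Fin x → Fin n) (K : Marking m n) where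
      open Tokens M π
      open Semantics K
      open Marking K

      -- As events do not repeat, the head of a legal history is the only event outside the tail;
      -- membership is what marks can express.
      Latest : List Event → Event → Set
      Latest es e = e ∈ es × e ∉ tail es

      latest-state : ∀ {es t p} → Latest es (t , p) → dst t ≡ state es
      latest-state {_ ∷ _} (here refl , _) = refl
      latest-state {_ ∷ _} (there h , nh)  = ⊥-elim (nh h)

      latest-unique : ∀ {es a b} → Latest es a → Latest es b → a ≡ b
      latest-unique {_ ∷ _} (here refl , _) (here refl , _) = refl
      latest-unique {_ ∷ _} (there h , nh)  _               = ⊥-elim (nh h)
      latest-unique {_ ∷ _} _               (there h , nh)  = ⊥-elim (nh h)

      latest : ∀ {es} → Legal es → es ≡ [] ⊎ ∃ (Latest es)
      latest []              = inj₁ refl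
      latest (fire L _ st _) = inj₂ (_ , here refl , not-again L st)

      Answered : List Event → Set
      Answered []                          = ⊤
      Answered ((t , p) ∷ [])              = Has confirm t p
      Answered ((t , p) ∷ (t′ , p′) ∷ _)   = Has confirm t p × Has close t′ p′

      answered : ∀ {t p} es → Has confirm t p → (∀ {t′ p′} → (t′ , p′) ∈ es → Has close t′ p′) →
                 Answered ((t , p) ∷ es)
      answered []       c _  = c
      answered (_ ∷ _)  c cl = c , cl (here refl)

      module _ (inputs : ∀ {p} → Input p ⇔ IsInput p) where
        open Equivalence

        made-to : ∀ {es p r} → (∀ {t} → Has fire t p → (t , p) ∈ es) →
                  ⟦ made r ⟧ p → ¬ ¬ Made (FiredIn es) p r
        made-to f md k = md ((λ t (ki , re) h → k (inj₁ (t , f h , ki , re))) ,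
                             (λ r≡0 i → k (inj₂ (r≡0 , to inputs i))))

        made-from : ∀ {es p r} → (∀ {t} → (t , p) ∈ es → Has fire t p) →
                    Made (FiredIn es) p r → ⟦ made r ⟧ p
        made-from f (inj₁ (t , h , ki , re)) (k , _) = k t (ki , re) (f h)
        made-from f (inj₂ (r≡0 , i))         (_ , k) = k r≡0 (from inputs i)

        module _ {t : Fin m} {p : Fin n} {es : List Event} (L : Legal ((t , p) ∷ es))
          (fired     : ∀ {t′ p′} → Has fire t′ p′ ⇔ ((t′ , p′) ∈ (t , p) ∷ es))
          (retired   : ∀ {t′ p′} → Has retire t′ p′ ⇔ ((t′ , p′) ∈ es))
          (confirmed : ∀ {t′ p′} → (t′ , p′) ∈ es → Has confirm t′ p′)
          (closed    : ∀ {t′ p′} → (t′ , p′) ∈ tail es → Has close t′ p′)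
          (waiting   : ¬ Answered ((t , p) ∷ es))
          (ord       : ⟦ orderly ⟧ tt) where
          private
            now : Event
            now = t , p

            L′ : Legal es
            L′ = case L of λ { (fire L′ _ _ _) → L′ }

            follow : src t ≡ state es
            follow = case L of λ { (fire _ s _ _) → s }

            once-only : (t , p) ∉ es
            once-only = case L of λ { (fire L′ _ st _) → not-again L′ st }

            clear : Clear es t
            clear = case L of λ { (fire _ _ _ c) → c }

            new-now : ∀ {t′ p′} → ⟦ new t′ ⟧ p′ → (t′ , p′) ≡ now
            new-now (f , nc) with to fired f
            ... | here eq = eq
            ... | there h = ⊥-elim (nc (confirmed h))

            current-now : ∀ {t′ p′} → ⟦ current t′ ⟧ p′ → (t′ , p′) ≡ now
            current-now (c , nr) with to fired (proj₁ (ord _ _) c)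
            ... | here eq = eq
            ... | there h = ⊥-elim (nr (from retired h))

            leaving-state : ∀ {t′ p′} → ⟦ leaving t′ ⟧ p′ → dst t′ ≡ state es
            leaving-state (r , nc) = latest-state (to retired r , nc ∘ closed)

            not-answered : ⟦ none leaving ⟧ tt → ¬ Has confirm t p
            not-answered nl c = waiting (answered es c λ {t′} {p′} h →
              has-stable close t′ p′ λ nc → nl t′ p′ (from retired h , nc))

            start-state : ⟦ none (has confirm) ⟧ tt → src t ≡ 0
            start-state nc = case latest L′ of λ where
              (inj₁ z) → trans follow (cong state z)
              (inj₂ ((t₁ , p₁) , h , _)) → ⊥-elim (nc t₁ p₁ (confirmed h))

            no-token : kind t ≡ test → ∀ q → ¬ ⟦ made (reg t) and unspent ⟧ q
            no-token k q (md , un) = made-to {(t , p) ∷ es} (to fired) md λ md′ →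
              let tok = token-if L md′ λ t′ f kd → un t′ kd (from fired f) in
              case q Fin.≟ p of λ where
                -- At `p` the test itself has just been fired, which leaves the process used and not
                -- a token.
                (yes refl) → case trans (sym tok) (trans (status-here t p es) (cong (λ k → after k (reg t)) k)) of λ ()
                (no q≢p) → clear k q (trans (sym (status-there {es = es} q≢p)) tok)

          -- System's marks are known exactly, Environment's only from below. `ord` confines
          -- confirmations to fired events, so nothing but the latest event can be new or current.
          pending-intro : ⟦ pending ⟧ tt
          pending-intro =
            (λ _ _ → confirmed ∘ to retired) ,
            (λ nl t′ p′ cu → case current-now cu of λ { refl → not-answered nl (proj₁ cu) }) ,
            (λ ncu nnew → nnew t p (from fired (here refl) , λ c → ncu t p (c , once-only ∘ to retired))) ,
            (λ t′ p′ q′ a b → ,-injectiveʳ (trans (new-now a) (sym (new-now b)))) ,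
            (λ t₁ t₂ ne some q b → some λ q′ a → ne (,-injectiveˡ (trans (new-now a) (sym (new-now b))))) ,
            (λ t₁ t₂ ne some q b → some λ q′ a →
              ne (trans (cong src (,-injectiveˡ (new-now b))) (trans follow (sym (leaving-state a))))) ,
            (λ t′ ne nc q a → ne (trans (cong src (,-injectiveˡ (new-now a))) (start-state nc))) ,
            (λ t′ k some q h → some λ q′ a → case new-now a of λ { refl → no-token k q h }) ,
            (λ t₁ t₂ (ne , d) q (f , f′) → ne (fired-unique L (to fired f) (to fired f′) d)) ,
            (λ t′ nd q (f , i) → plain-not-input L (to fired f) nd (to inputs i)) ,
            (λ t′ d q f → made-from {(t , p) ∷ es} (from fired) (dec-made L (to fired f) d))

        Fires : List Event → Set
        Fires es = ∃ λ e → Legal (e ∷ es) × (∀ {t p} → Has fire t p ⇔ ((t , p) ∈ e ∷ es)) ×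
                           (∀ {t p} → Has retire t p ⇔ ((t , p) ∈ es))

        module _ {es : List Event} (L : Legal es)
          (confirmed  : ∀ {t p} → Has confirm t p ⇔ ((t , p) ∈ es))
          (closed     : ∀ {t p} → Has close t p ⇔ ((t , p) ∈ tail es))
          (fired      : ∀ {t p} → (t , p) ∈ es → Has fire t p)
          (retired    : ∀ {t p} → (t , p) ∈ tail es → Has retire t p)
          (undecided  : ∀ {t p} → (t , p) ∈ es → dst t ≢ accept) where

          pending-if-good : ⟦ good ⟧ tt → ⟦ pending ⟧ tt
          pending-if-good g = g
            (λ t p → fired ∘ to confirmed , retired ∘ to closed)
            (λ t acc p c → undecided (to confirmed c) acc)

          -- Here Environment's marks are known exactly and System's only from below. Nothing is
          -- left for Environment to answer, so `pending` can hold only if System has retired the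
          -- latest event and fired a further one, and the other rules make that one legal.
          good-fires : ⟦ good ⟧ tt → ¬ ¬ Fires es
          good-fires g stuck = with-pending (pending-if-good g)
            where
            with-pending : ⟦ pending ⟧ tt → ⊥
            with-pending (r⇒c , c⇒l , mv , one , dis , fol , sta , clr , use , nin , d⇒m) =
              mv no-current λ t p nw → fits nw λ fit → stuck ((t , p) , fires nw fit)
              where
              no-current : ⟦ none current ⟧ tt
              no-current t p (c , nr) = c⇒l no-leaving t p (c , nr)
                where
                -- The tail is retired and closed, so a current event and a leaving one both lie
                -- outside it. Both would be the latest event, which would then be retired and not
                -- retired.
                no-leaving : ⟦ none leaving ⟧ tt
                no-leaving t′ p′ (r , ncl) = case latest-unique (to confirmed c , nr ∘ retired)
                    (to confirmed (r⇒c t′ p′ r) , ncl ∘ from closed) of λ { refl → nr r }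

              all-retired : ∀ {t p} → (t , p) ∈ es → Has retire t p
              all-retired {t} {p} h = has-stable retire t p λ nr → no-current t p (from confirmed h , nr)

              module _ {t : Fin m} {p : Fin n} (nw : ⟦ new t ⟧ p) where
                unconfirmed : (t , p) ∉ es
                unconfirmed h = proj₂ nw (from confirmed h)

                -- A fired event outside `es` is unconfirmed, hence new, and the new event is
                -- unique.
                fired-to : ∀ {t′ p′} → Has fire t′ p′ → (t′ , p′) ∈ (t , p) ∷ es
                fired-to {t′} {p′} f = case (t′ , p′) ∈? es of λ where
                    (yes h) → there h
                    (no nh) → case t′ Fin.≟ t of λ where
                      (yes refl) → case one t p′ p (f , nh ∘ to confirmed) nw of λ { refl → here refl }
                      (no ne) → ⊥-elim (dis t′ t ne (λ none → none p′ (f , nh ∘ to confirmed)) p nw)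
                  where
                  open import Data.List.Membership.DecPropositional
                    (≡-dec Fin._≟_ (Fin._≟_ {n})) using (_∈?_)

                follow : src t ≡ state es
                follow = decidable-stable (src t ℕ.≟ state es) λ ne → case latest L of λ where
                  (inj₁ z) → sta t (λ s → ne (trans s (sym (cong state z))))
                    (λ t′ p′ c → case subst ((t′ , p′) ∈_) z (to confirmed c) of λ ()) p nw
                  (inj₂ ((t₁ , p₁) , l)) → fol t₁ t (λ s → ne (trans s (latest-state l)))
                    (λ none → none p₁ (all-retired (proj₁ l) , proj₂ l ∘ to closed)) p nw

                fits : ¬ ¬ (status es p ≡ needs (kind t) (reg t))
                fits no-fit with kind t ≟ᴷ dec
                ... | no nd = no-fit (trans (fresh-if L
                        (λ t′ h → decidable-stable (kind t′ ≟ᴷ dec) λ nd′ →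
                          use t t′ ((λ { refl → unconfirmed h }) , trans (plain nd) (sym (plain nd′))) p (proj₁ nw , fired h))
                        (λ i → nin t nd p (proj₁ nw , from inputs i)))
                        (sym (needs-plain (plain nd))))
                  where
                  plain : ∀ {k} → k ≢ dec → isDec k ≡ false
                  plain {inc}  _ = refl
                  plain {test} _ = refl
                  plain {nop}  _ = refl
                  plain {dec}  f = ⊥-elim (f refl)
                ... | yes d = made-to {(t , p) ∷ es} fired-to (d⇒m t d p (proj₁ nw)) λ md →
                  no-fit (trans (token-if L (earlier md) λ t′ h d′ →
                    use t t′ ((λ { refl → unconfirmed h }) , cong isDec (trans d (sym d′))) p (proj₁ nw , fired h))
                    (cong (λ k → needs k (reg t)) (sym d)))
                  where
                  -- The event just fired is a `dec` and cannot be the `inc` that made the token it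
                  -- consumes.
                  earlier : ∀ {r} → Made (FiredIn ((t , p) ∷ es)) p r → Made (FiredIn es) p r
                  earlier (inj₁ (_ , here refl , k , _)) = case trans (sym d) k of λ ()
                  earlier (inj₁ (t′ , there h , kr))     = inj₁ (t′ , h , kr)
                  earlier (inj₂ h)                       = inj₂ h

                clear : Clear es t
                clear k q tok with token-made L tok
                ... | md , un = clr t k (λ none → none p nw) q
                  (made-from {es} fired md , λ t′ d f → case fired-to f of λ where
                    (here refl) → case trans (sym k) d of λ ()
                    (there h) → un t′ h d)

                fires : status es p ≡ needs (kind t) (reg t) →
                        Legal ((t , p) ∷ es) × (∀ {t′ p′} → Has fire t′ p′ ⇔ ((t′ , p′) ∈ (t , p) ∷ es)) ×
                        (∀ {t p} → Has retire t p ⇔ ((t , p) ∈ es))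
                fires fit = fire L follow fit clear ,
                  mk⇔ fired-to (λ { (here refl) → proj₁ nw ; (there h) → fired h }) ,
                  mk⇔ (to confirmed ∘ r⇒c _ _) all-retired

-- Prefixes, saturation and continuation of plays

module Words where

  open import Data.Empty using (⊥-elim)
  open import Data.Fin as Fin using (Fin; zero; suc; toℕ)
  open import Data.Fin.Properties using (toℕ<n)
  open import Data.List using (List; []; _∷_; _++_; _∷ʳ_; length; lookup; take; applyUpTo; initLast; _∷ʳ′_)
  open import Data.List.Properties using (++-assoc; ++-identityʳ; ∷ʳ-injective; take-suc; take++drop≡id; take-all; applyUpTo-∷ʳ)
  open import Data.List.Membership.Propositional using (_∈_)
  open import Data.List.Membership.Propositional.Properties using (∈-++⁺ˡ; ∈-++⁻; ∈-applyUpTo⁺; ∈-applyUpTo⁻; ∈-lookup)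
  open import Data.List.Relation.Unary.Any using (here; there)
  open import Data.Maybe using (Maybe; just; nothing)
  open import Data.Nat as ℕ using (ℕ; zero; suc; _+_; _≤_; _<_; s≤s; z≤n; _⊔_)
  import Data.Nat.Properties as ℕ
  open import Data.Product using (∃; _×_; _,_; proj₁; proj₂)
  open import Data.Sum using (inj₁; inj₂; [_,_]′)
  open import Data.Unit using (tt)
  open import Function using (_∘_)
  open import Relation.Nullary using (¬_)
  open import Relation.Binary.PropositionalEquality

  ¬¬-bound : ∀ {k} {P : Fin k → ℕ → Set} → (∀ {i N N′} → N ≤ N′ → P i N → P i N′) →
             (∀ i → ¬ ¬ ∃ (P i)) → ¬ ¬ ∃ λ N → ∀ i → P i N
  ¬¬-bound {zero}  mono h f = f (0 , λ ())
  ¬¬-bound {suc k} mono h f = h zero λ (N₀ , p) → ¬¬-bound mono (h ∘ suc) λ (N , ps) →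
    f (N₀ ⊔ N , λ { zero → mono (ℕ.m≤m⊔n N₀ N) p ; (suc i) → mono (ℕ.m≤n⊔m N₀ N) (ps i) })

  applyUpTo-+ : ∀ {A : Set} (f : ℕ → A) N d → applyUpTo f (N + d) ≡ applyUpTo f N ++ applyUpTo (λ i → f (N + i)) d
  applyUpTo-+ f zero    d = refl
  applyUpTo-+ f (suc N) d = cong (f 0 ∷_) (applyUpTo-+ (f ∘ suc) N d)

  _⧺_ : {A : Set} → List A → (ℕ → A) → ℕ → A
  ([]      ⧺ g) i       = g i
  ((a ∷ u) ⧺ g) zero    = a
  ((a ∷ u) ⧺ g) (suc i) = (u ⧺ g) i

  applyUpTo-⧺ : ∀ {A : Set} (u : List A) g k → applyUpTo (u ⧺ g) (length u + k) ≡ u ++ applyUpTo g k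
  applyUpTo-⧺ []      g k = refl
  applyUpTo-⧺ (a ∷ u) g k = cong (a ∷_) (applyUpTo-⧺ u g k)

  ⧺-beyond : ∀ {A : Set} (u : List A) g k → (u ⧺ g) (length u + k) ≡ g k
  ⧺-beyond []      g k = refl
  ⧺-beyond (a ∷ u) g k = ⧺-beyond u g k

  lookup-∈-take : ∀ {A : Set} (l : List A) i {N} → toℕ i < N → lookup l i ∈ take N l
  lookup-∈-take (a ∷ l) zero    (s≤s _) = here refl
  lookup-∈-take (a ∷ l) (suc i) (s≤s p) = there (lookup-∈-take l i p)

  ∈-take-lookup : ∀ {A : Set} (l : List A) {N a} → a ∈ take N l → ∃ λ i → toℕ i < N × lookup l i ≡ a
  ∈-take-lookup (b ∷ l) {suc N} (here refl) = zero , s≤s z≤n , refl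
  ∈-take-lookup (b ∷ l) {suc N} (there h) with ∈-take-lookup l h
  ... | i , p , eq = suc i , s≤s p , eq

  module Plays (s e n : ℕ) where
    open Game s e n

    initial : Word → ℕ → List Letter
    initial (finite l)   N = take N l
    initial (infinite f) N = applyUpTo f N

    before≡initial : ∀ w i → before w i ≡ initial w (index w i)
    before≡initial (finite l)   i = refl
    before≡initial (infinite f) i = refl

    initial-suc : ∀ w i → initial w (suc (index w i)) ≡ before w i ∷ʳ letter w i
    initial-suc (finite l)   i = take-suc l i
    initial-suc (infinite f) i = sym (applyUpTo-∷ʳ f i)

    letter-∈-initial : ∀ w i {N} → index w i < N → letter w i ∈ initial w N
    letter-∈-initial (finite l)   i p = lookup-∈-take l i p
    letter-∈-initial (infinite f) i p = ∈-applyUpTo⁺ f p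

    ∈-initial : ∀ w {N a} → a ∈ initial w N → ∃ λ i → index w i < N × letter w i ≡ a
    ∈-initial (finite l)   h = ∈-take-lookup l h
    ∈-initial (infinite f) h with ∈-applyUpTo⁻ f h
    ... | i , p , eq = i , p , sym eq

    initial-mono : ∀ w {N N′ a} → N ≤ N′ → a ∈ initial w N → a ∈ initial w N′
    initial-mono w N≤ h with ∈-initial w h
    ... | i , p , refl = letter-∈-initial w i (ℕ.<-≤-trans p N≤)

    Saturated : Word → ℕ → Set
    Saturated w N = ∀ i → letter w i ∈ initial w N

    -- There are finitely many letters, and each one either has an occurrence to wait for or never
    -- occurs; a maximum of finitely many bounds does for all. Beyond it a word shows nothing new to
    -- the conditions.
    saturate : ∀ w → ¬ ¬ ∃ (Saturated w)
    saturate w f =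
      ¬¬-bound (λ N≤ c k → covers-mono N≤ (c k))
        (λ p → ¬¬-bound (covers-mono {_}) (λ a → covers (inj₁ a , p))) λ (N₁ , c₁) →
      ¬¬-bound (λ N≤ c k → covers-mono N≤ (c k))
        (λ p → ¬¬-bound (covers-mono {_}) (λ a → covers (inj₂ a , p))) λ (N₂ , c₂) →
      f (N₁ ⊔ N₂ , λ i → done N₁ N₂ c₁ c₂ i (letter w i) refl)
      where
      Covers : Letter → ℕ → Set
      Covers a N = ∀ i → letter w i ≡ a → a ∈ initial w N

      covers-mono : ∀ {a N N′} → N ≤ N′ → Covers a N → Covers a N′
      covers-mono N≤ c i eq = initial-mono w N≤ (c i eq)

      covers : ∀ a → ¬ ¬ ∃ (Covers a)
      -- The bound 0 is offered; an occurrence that would refute it supplies the right bound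
      -- instead.
      covers a f = f (0 , λ i eq → ⊥-elim (f (suc (index w i) , λ _ _ →
        subst (_∈ initial w (suc (index w i))) eq (letter-∈-initial w i ℕ.≤-refl))))

      done : ∀ N₁ N₂ → (∀ p a → Covers (inj₁ a , p) N₁) → (∀ p a → Covers (inj₂ a , p) N₂) →
             ∀ i a → letter w i ≡ a → letter w i ∈ initial w (N₁ ⊔ N₂)
      done N₁ N₂ c₁ c₂ i (inj₁ a , p) eq rewrite eq = initial-mono w (ℕ.m≤m⊔n N₁ N₂) (c₁ p a i eq)
      done N₁ N₂ c₁ c₂ i (inj₂ a , p) eq rewrite eq = initial-mono w (ℕ.m≤n⊔m N₁ N₂) (c₂ p a i eq)

    Follows : Strategy → List Letter → Set
    Follows S u = ∀ u₁ τ u₂ → u ≡ (u₁ ∷ʳ sys τ) ++ u₂ → S u₁ ≡ just τ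

    module _ {S : Strategy} where

      follows-[] : Follows S []
      follows-[] []       τ u₂ ()
      follows-[] (_ ∷ _)  τ u₂ ()

      follows-prefix : ∀ u {v} → Follows S (u ++ v) → Follows S u
      follows-prefix u {v} F u₁ τ u₂ eq =
        F u₁ τ (u₂ ++ v) (trans (cong (_++ v) eq) (++-assoc (u₁ ∷ʳ sys τ) u₂ v))

      follows-∷ʳ : ∀ {u a} → Follows S u → (∀ τ → a ≡ sys τ → S u ≡ just τ) → Follows S (u ∷ʳ a)
      follows-∷ʳ {u} F last u₁ τ u₂ eq with initLast u₂
      ... | [] with ∷ʳ-injective u u₁ (trans eq (++-identityʳ (u₁ ∷ʳ sys τ)))
      ...   | refl , a≡ = last τ a≡
      follows-∷ʳ {u} F last u₁ τ _ eq | v ∷ʳ′ b =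
        F u₁ τ v (proj₁ (∷ʳ-injective u ((u₁ ∷ʳ sys τ) ++ v)
          (trans eq (sym (++-assoc (u₁ ∷ʳ sys τ) v (b ∷ []))))))

      follows-compatible : ∀ w → (∀ N → Follows S (initial w N)) → ∀ i τ → letter w i ≡ sys τ →
                           S (before w i) ≡ just τ
      follows-compatible w F i τ eq = F (suc (index w i)) (before w i) τ []
        (trans (initial-suc w i) (trans (cong (before w i ∷ʳ_) eq)
          (sym (++-identityʳ (before w i ∷ʳ sys τ)))))

    record Continuation (S : Strategy) (u : List Letter) : Set where
      field
        word       : Word
        compatible : Compatible S word
        fair       : Fair S word
        follows    : ∀ N → Follows S (initial word N)
        extends    : ∀ {a} → a ∈ u → ∃ λ i → letter word i ≡ a
        env-old    : ∀ i a p → letter word i ≡ (inj₂ a , p) → (inj₂ a , p) ∈ u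

    finite-fair : ∀ S l → Fair S (finite l)
    finite-fair S l inf = ⊥-elim (inf (length l) λ (i , p , _) →
      ℕ.<-irrefl refl (ℕ.<-≤-trans (toℕ<n i) p))

    -- Environment falls silent after u.
    continue : ∀ S u → Follows S u → ¬ ¬ Continuation S u
    -- Assuming that there is no continuation excludes every stop of `S`, as a stop would give a
    -- finite one. Then System moves forever, and the infinite play is a continuation after all.
    continue S u F no-continuation = no-continuation (infinitely λ k → moves k (S (history k)) refl)
      where
      next : Maybe SysLetter → List Letter → List Letter
      next nothing  v = v
      next (just τ) v = v ∷ʳ sys τ

      history : ℕ → List Letter
      history zero    = u
      history (suc k) = next (S (history k)) (history k)

      history-follows : ∀ k → Follows S (history k)
      history-follows zero = F
      history-follows (suc k) with S (history k) in eq
      ... | nothing = history-follows k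
      ... | just τ  = follows-∷ʳ (history-follows k) λ { _ refl → eq }

      history-⊇ : ∀ k {a} → a ∈ u → a ∈ history k
      history-⊇ zero h = h
      history-⊇ (suc k) h with S (history k)
      ... | nothing = history-⊇ k h
      ... | just τ  = ∈-++⁺ˡ (history-⊇ k h)

      history-env : ∀ k {a p} → (inj₂ a , p) ∈ history k → (inj₂ a , p) ∈ u
      history-env zero h = h
      history-env (suc k) h with S (history k)
      ... | nothing = history-env k h
      ... | just τ with ∈-++⁻ (history k) h
      ...   | inj₁ h′ = history-env k h′
      ...   | inj₂ (here ())

      finitely : ∀ k → S (history k) ≡ nothing → Continuation S u
      finitely k stop = record
        { word       = w
        ; compatible = follows-compatible w F′ , stop
        ; fair       = finite-fair S (history k)
        ; follows    = F′
        ; extends    = λ h → let i , _ , eq = ∈-initial w {length (history k)}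
                                   (subst (_ ∈_) (sym (take-all _ (history k) ℕ.≤-refl)) (history-⊇ k h))
                             in i , eq
        ; env-old    = λ i a p eq → history-env k (subst (_∈ history k) eq
                         (∈-lookup i))
        }
        where
        w = finite (history k)
        F′ : ∀ N → Follows S (initial w N)
        F′ N = follows-prefix (take N (history k))
          (subst (Follows S) (sym (take++drop≡id N (history k))) (history-follows k))

      moves : ∀ k m → S (history k) ≡ m → ∃ λ τ → S (history k) ≡ just τ
      moves k nothing  eq = ⊥-elim (no-continuation (finitely k eq))
      moves k (just τ) eq = τ , eq

      infinitely : (∀ k → ∃ λ τ → S (history k) ≡ just τ) → Continuation S u
      infinitely move = record
        { word       = infinite f
        ; compatible = follows-compatible (infinite f) F′ , tt
        -- After `u` all letters are System's, so the conclusion of fairness holds outright.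
        ; fair       = λ _ N k → k (length u + N , ℕ.m≤n+m N (length u) , proj₁ (move N) , ⧺-beyond u g N)
        ; follows    = F′
        ; extends    = λ h → let i , _ , eq = ∈-initial (infinite f) {length u + 0}
                                   (subst (_ ∈_) (sym (applyUpTo-history 0)) h)
                             in i , eq
        ; env-old    = λ i a p eq → history-env (suc i) (subst (_∈ history (suc i)) eq
                         (subst (f i ∈_) (applyUpTo-history (suc i))
                           (∈-applyUpTo⁺ f (ℕ.m≤n+m (suc i) (length u)))))
        }
        where
        g : ℕ → Letter
        g k = sys (proj₁ (move k))

        f : ℕ → Letter
        f = u ⧺ g

        history-++ : ∀ k → history k ≡ u ++ applyUpTo g k
        history-++ zero    = sym (++-identityʳ u)
        history-++ (suc k) = trans (cong (λ m → next m (history k)) (proj₂ (move k)))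
          (trans (cong (_∷ʳ g k) (history-++ k)) (trans (++-assoc u (applyUpTo g k) (g k ∷ []))
            (cong (u ++_) (applyUpTo-∷ʳ g k))))

        applyUpTo-history : ∀ k → applyUpTo f (length u + k) ≡ history k
        applyUpTo-history k = trans (applyUpTo-⧺ u g k) (sym (history-++ k))

        F′ : ∀ N → Follows S (applyUpTo f N)
        F′ N = follows-prefix (applyUpTo f N) (subst (Follows S)
          (trans (sym (trans (cong (applyUpTo f) (ℕ.+-comm N (length u))) (applyUpTo-history N)))
                 (applyUpTo-+ f N (length u)))
          (history-follows N))

-- System's strategy for an accepting legal history

module SystemPlay where

  open import Data.Bool using (if_then_else_)
  open import Data.Empty using (⊥; ⊥-elim)
  open import Data.Fin as Fin using (Fin; zero; suc; _↑ˡ_; _↑ʳ_)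
  open import Data.Fin.Properties using (toℕ-injective)
  open import Data.List using (List; []; _∷_; length; map; allFin; lookup)
  open import Data.List.Properties using (take-all)
  open import Data.List.Membership.Propositional using (_∈_; _∉_)
  open import Data.List.Membership.Propositional.Properties using (∈-map⁺; ∈-map⁻; ∈-allFin)
  open import Data.List.Relation.Unary.All as All using (All; []; _∷_; all?)
  open import Data.List.Relation.Unary.Any using (here; there)
  open import Data.Maybe using (Maybe; just; nothing)
  open import Data.Maybe.Properties using (just-injective)
  open import Data.Nat as ℕ using (ℕ; zero; suc; _+_; _≤_; _<_; _⊔_)
  import Data.Nat.Properties as ℕ
  open import Data.Product using (∃; _×_; _,_; proj₁; proj₂)
  open import Data.Product.Properties as Product using (,-injectiveˡ; ,-injectiveʳ)
  open import Data.Sum using (_⊎_; inj₁; inj₂; [_,_]′)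
  import Data.Sum.Properties as Sum
  open import Data.Unit using (tt)
  open import Function using (id; case_of_; _⇔_; mk⇔; Equivalence)
  open import Relation.Nullary using (¬_; Dec; yes; no; does)
  open import Relation.Nullary.Decidable using (decidable-stable; does-⇔)
  open import Relation.Binary using (DecidableEquality; tri<; tri≈; tri>)
  open import Relation.Binary.PropositionalEquality

  open Machines
  open ProcessLogic
  open TokenGame
  open Rules
  open Words

  module _ (M : Machine) where
    open Machine M renaming (#trans to m)
    open Specification M

    template : (x : ℕ) → Sentence (m + m + x) (m + m)
    template x = conj inputsApart (translate good tt)
      where open Translation m x

    sentence : (x : ℕ) → Sentence (m + m + x) (m + m)
    sentence x = conj (template x) (Translation.inputs m x)

    index-injective : ∀ {s e n} w {i j} → Game.index s e n w i ≡ Game.index s e n w j → i ≡ j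
    index-injective (Game.finite l)   = toℕ-injective
    index-injective (Game.infinite f) = id

    module GameOf (x n : ℕ) where
      open Satisfaction m x n public
      open Plays (m + m + x) (m + m) n public

      _≟ᴸ_ : DecidableEquality Letter
      _≟ᴸ_ = Product.≡-dec (Sum.≡-dec Fin._≟_ Fin._≟_) Fin._≟_

      open import Data.List.Membership.DecPropositional _≟ᴸ_ using (_∈?_) public

      ∈⇒occurs : ∀ w {N a p} → (encode a , p) ∈ initial w N → occurs w a p
      ∈⇒occurs w h k with ∈-initial w h
      ... | i , _ , eq = k (i , eq)

      occurs⇒∈ : ∀ w {N a p} → Saturated w N → occurs w a p → (encode a , p) ∈ initial w N
      occurs⇒∈ w {N} {a} {p} sat nn = decidable-stable ((encode a , p) ∈? initial w N)
        λ nh → nn λ (i , eq) → nh (subst (_∈ initial w N) eq (sat i))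

    module Plan {x n : ℕ} (π : Fin x → Fin n) (π-injective : ∀ {k l} → π k ≡ π l → k ≡ l) where
      open GameOf x n
      open Tokens M π

      fireᴸ retireᴸ : Event → SysLetter
      fireᴸ (t , p)   = (t ↑ˡ m) ↑ˡ x , p
      retireᴸ (t , p) = (m ↑ʳ t) ↑ˡ x , p

      confirmᴸ closeᴸ : Event → Letter
      confirmᴸ (t , p) = embed confirm t , p
      closeᴸ (t , p)   = embed close t , p

      inputᴸ : Fin x → SysLetter
      inputᴸ k = (m + m) ↑ʳ k , π k

      demand : List Event → List Letter
      demand []            = []
      demand (e ∷ [])      = confirmᴸ e ∷ []
      demand (e ∷ e₁ ∷ _)  = confirmᴸ e ∷ closeᴸ e₁ ∷ []

      moves : Event → List Event → List SysLetter
      moves e []       = fireᴸ e ∷ []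
      moves e (e₁ ∷ _) = retireᴸ e₁ ∷ fireᴸ e ∷ []

      data Progress : Set where
        done waiting : Progress
        move         : SysLetter → Progress

      missing : List SysLetter → List Letter → Progress
      missing []       u = done
      missing (τ ∷ τs) u = if does (sys τ ∈? u) then missing τs u else move τ

      _then_ : Progress → Progress → Progress
      done    then q = q
      waiting then q = waiting
      move τ  then q = move τ

      met? : ∀ es u → Dec (All (_∈ u) (demand es))
      met? es u = all? (_∈? u) (demand es)

      -- How far a play has come in carrying out the events, from the oldest on.
      progress : List Event → List Letter → Progress
      progress []       u = missing (map inputᴸ (allFin x)) u
      progress (e ∷ es) u = progress es u then
        (if does (met? es u) then missing (moves e es) u else waiting)

      play : Progress → Maybe SysLetter
      play done     = nothing
      play waiting  = nothing
      play (move τ) = just τ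

      _≈_ : List Letter → List Letter → Set
      u ≈ v = ∀ {a} → a ∈ u ⇔ a ∈ v

      open Equivalence

      missing-cong : ∀ {u v} → u ≈ v → ∀ τs → missing τs u ≡ missing τs v
      missing-cong u≈v []       = refl
      missing-cong {u} {v} u≈v (τ ∷ τs) = cong₂ (λ b q → if b then q else move τ)
        (does-⇔ u≈v (sys τ ∈? u) (sys τ ∈? v)) (missing-cong u≈v τs)

      -- The strategy depends only on which letters have occurred, so its answer no longer changes
      -- once the word is saturated.
      progress-cong : ∀ {u v} → u ≈ v → ∀ es → progress es u ≡ progress es v
      progress-cong u≈v []       = missing-cong u≈v (map inputᴸ (allFin x))
      progress-cong {u} {v} u≈v (e ∷ es) = cong₂ _then_ (progress-cong u≈v es)
        (cong₂ (λ b q → if b then q else waiting)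
          (does-⇔ (mk⇔ (All.map (to u≈v)) (All.map (from u≈v))) (met? es u) (met? es v))
          (missing-cong u≈v (moves e es)))

      Played : List Letter → SysLetter → Set
      Played u τ = sys τ ∈ u

      missing-done : ∀ τs {u} → missing τs u ≡ done → All (Played u) τs
      missing-done []           eq = []
      missing-done (τ ∷ τs) {u} eq with sys τ ∈? u
      ... | yes h = h ∷ missing-done τs eq

      done-missing : ∀ {τs u} → All (Played u) τs → missing τs u ≡ done
      done-missing []                       = refl
      done-missing {τ ∷ τs} {u} (h ∷ hs) with sys τ ∈? u
      ... | yes _ = done-missing hs
      ... | no nh = ⊥-elim (nh h)

      missing-move : ∀ τs {u τ} → missing τs u ≡ move τ → τ ∈ τs × sys τ ∉ u
      missing-move (τ ∷ τs) {u} eq with sys τ ∈? u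
      missing-move (τ ∷ τs) {u} refl | no nh = here refl , nh
      missing-move (τ ∷ τs) {u} eq   | yes _ with missing-move τs eq
      ... | h , nh = there h , nh

      missing-waiting : ∀ τs {u} → missing τs u ≢ waiting
      missing-waiting (τ ∷ τs) {u} eq with sys τ ∈? u
      ... | yes _ = missing-waiting τs eq

      Complete : List Event → List Letter → Set
      Complete []       u = All (Played u) (map inputᴸ (allFin x))
      Complete (e ∷ es) u = Complete es u × All (_∈ u) (demand es) × All (Played u) (moves e es)

      -- A certificate that `τ` was due when it was played. It survives extensions of `u`, so
      -- certificates from different moments can be collected at the saturation point.
      Origin : List Event → SysLetter → List Letter → Set
      Origin []       τ u = τ ∈ map inputᴸ (allFin x)
      Origin (e ∷ es) τ u = Origin es τ u ⊎ (Complete es u × All (_∈ u) (demand es) × τ ∈ moves e es)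

      complete-mono : ∀ es {u v} → (∀ {a} → a ∈ u → a ∈ v) → Complete es u → Complete es v
      complete-mono []       ⊆ c             = All.map ⊆ c
      complete-mono (e ∷ es) ⊆ (c , d , ms) = complete-mono es ⊆ c , All.map ⊆ d , All.map ⊆ ms

      origin-mono : ∀ es {u v τ} → (∀ {a} → a ∈ u → a ∈ v) → Origin es τ u → Origin es τ v
      origin-mono []       ⊆ o                    = o
      origin-mono (e ∷ es) ⊆ (inj₁ o)             = inj₁ (origin-mono es ⊆ o)
      origin-mono (e ∷ es) ⊆ (inj₂ (c , d , h)) = inj₂ (complete-mono es ⊆ c , All.map ⊆ d , h)

      progress-done : ∀ es {u} → progress es u ≡ done → Complete es u
      progress-done []           eq = missing-done _ eq
      progress-done (e ∷ es) {u} eq with progress es u in eq₁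
      ... | done with met? es u
      ...   | yes d = progress-done es eq₁ , d , missing-done (moves e es) eq

      complete-progress : ∀ es {u} → Complete es u → progress es u ≡ done
      complete-progress []           c            = done-missing c
      complete-progress (e ∷ es) {u} (c , d , ms) rewrite complete-progress es c with met? es u
      ... | yes _ = done-missing ms
      ... | no nd = ⊥-elim (nd d)

      progress-move : ∀ es {u τ} → progress es u ≡ move τ → Origin es τ u × sys τ ∉ u
      progress-move []           eq = missing-move _ eq
      progress-move (e ∷ es) {u} eq with progress es u in eq₁
      progress-move (e ∷ es) {u} refl | move τ with progress-move es eq₁
      ... | o , nh = inj₁ o , nh
      progress-move (e ∷ es) {u} eq   | done with met? es u
      ... | yes d with missing-move (moves e es) eq
      ...   | h , nh = inj₂ (progress-done es eq₁ , d , h) , nh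

      progress-waiting : ∀ es {u} → Legal es → progress es u ≡ waiting →
        (∀ τ → sys τ ∈ u → Origin es τ u) →
        ∃ λ es′ → Legal es′ × Complete es′ u × ¬ All (_∈ u) (demand es′) × (∀ τ → sys τ ∈ u → Origin es′ τ u)
      progress-waiting [] L eq os = ⊥-elim (missing-waiting (map inputᴸ (allFin x)) eq)
      progress-waiting (e ∷ es) {u} (fire L _ _ _) eq os with progress es u in eq₁
      ... | waiting = progress-waiting es L eq₁ λ τ h → case os τ h of λ where
        (inj₁ o)           → o
        (inj₂ (c , _ , _)) → case trans (sym eq₁) (complete-progress es c) of λ ()
      ... | done with met? es u
      ...   | yes _ = ⊥-elim (missing-waiting (moves e es) eq)
      ...   | no nd = es , L , progress-done es eq₁ , nd , λ τ h → case os τ h of λ where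
        (inj₁ o)           → o
        (inj₂ (_ , d , _)) → ⊥-elim (nd d)

      complete-input : ∀ es {u} → Complete es u → ∀ k → sys (inputᴸ k) ∈ u
      complete-input []       c           k = All.lookup c (∈-map⁺ inputᴸ (∈-allFin k))
      complete-input (e ∷ es) (c , _ , _) k = complete-input es c k

      complete-fired : ∀ es {u e} → Complete es u → e ∈ es → sys (fireᴸ e) ∈ u
      complete-fired (e ∷ [])     (_ , _ , h ∷ [])     (here refl) = h
      complete-fired (e ∷ _ ∷ _)  (_ , _ , _ ∷ h ∷ []) (here refl) = h
      complete-fired (e ∷ es)     (c , _ , _)          (there h)   = complete-fired es c h

      complete-retired : ∀ es {u e} → Complete es u → e ∈ tail es → sys (retireᴸ e) ∈ u
      complete-retired (_ ∷ e ∷ _)  (_ , _ , h ∷ _) (here refl) = h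
      complete-retired (_ ∷ e ∷ es) (c , _ , _)     (there h)   = complete-retired (e ∷ es) c h

      complete-confirmed : ∀ es {u e} → Complete es u → e ∈ tail es → confirmᴸ e ∈ u
      complete-confirmed (_ ∷ e ∷ [])     (_ , h ∷ _ , _) (here refl) = h
      complete-confirmed (_ ∷ e ∷ _ ∷ _)  (_ , h ∷ _ , _) (here refl) = h
      complete-confirmed (_ ∷ e ∷ es)     (c , _ , _)     (there h)   = complete-confirmed (e ∷ es) c h

      complete-closed : ∀ es {u e} → Complete es u → e ∈ tail (tail es) → closeᴸ e ∈ u
      complete-closed (_ ∷ _ ∷ e ∷ _)   (_ , _ ∷ h ∷ _ , _) (here refl) = h
      complete-closed (_ ∷ e₁ ∷ e ∷ es) (c , _ , _)         (there h)   = complete-closed (e₁ ∷ e ∷ es) c h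

      data Planned (es : List Event) : SysLetter → Set where
        input  : ∀ k → Planned es (inputᴸ k)
        fire   : ∀ {e} → e ∈ es → Planned es (fireᴸ e)
        retire : ∀ {e} → e ∈ tail es → Planned es (retireᴸ e)

      origin-planned : ∀ es {u τ} → Origin es τ u → Planned es τ
      origin-planned [] o with ∈-map⁻ inputᴸ o
      ... | k , _ , refl = input k
      origin-planned (e ∷ es) (inj₁ o) with origin-planned es o
      ... | input k  = input k
      ... | fire h   = fire (there h)
      ... | retire h = retire (weaken es h)
        where
        weaken : ∀ es {e} → e ∈ tail es → e ∈ es
        weaken (_ ∷ _) h = there h
      origin-planned (e ∷ [])     (inj₂ (_ , _ , here refl))         = fire (here refl)
      origin-planned (e ∷ e₁ ∷ _) (inj₂ (_ , _ , here refl))         = retire (here refl)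
      origin-planned (e ∷ e₁ ∷ _) (inj₂ (_ , _ , there (here refl))) = fire (here refl)

      letter-injective : ∀ {a b} {p q : Process} → (encode a , p) ≡ (encode b , q) → a ≡ b × p ≡ q
      letter-injective {a} {b} eq = encode-injective {a} {b} (,-injectiveˡ eq) , ,-injectiveʳ eq

      planned-mark : ∀ {es τ} → Planned es τ → ∀ {a p} → sys τ ≡ (encode a , p) →
                     (∃ λ k → a ≡ inj₂ k × p ≡ π k) ⊎ (∃ λ t → a ≡ inj₁ (fire , t) × (t , p) ∈ es)
                     ⊎ (∃ λ t → a ≡ inj₁ (retire , t) × (t , p) ∈ tail es)
      planned-mark (input k) {a} eq with letter-injective {inj₂ k} {a} eq
      ... | refl , refl = inj₁ (k , refl , refl)
      planned-mark (fire {t , p} h) {a} eq with letter-injective {inj₁ (fire , t)} {a} eq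
      ... | refl , refl = inj₂ (inj₁ (t , refl , h))
      planned-mark (retire {t , p} h) {a} eq with letter-injective {inj₁ (retire , t)} {a} eq
      ... | refl , refl = inj₂ (inj₂ (t , refl , h))

      module _ {full : List Event} (L : Legal full) (acc : state full ≡ accept) (acc≢0 : accept ≢ 0) where

        strategy : Strategy
        strategy u = play (progress full u)

        strategy-move : ∀ {u τ} → strategy u ≡ just τ → Origin full τ u × sys τ ∉ u
        strategy-move {u} eq with progress full u in eq₁
        strategy-move {u} refl | move τ = progress-move full eq₁

        module _ (w : Word) (compatible : Compatible strategy w) (fair : Fair strategy w) where

          played : ∀ {i τ} → letter w i ≡ sys τ → Origin full τ (before w i) × sys τ ∉ before w i
          played {i} {τ} eq = strategy-move (proj₁ compatible i τ eq)

          -- Otherwise the strategy would insist on the same unplayed letter from the saturation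
          -- point on. In a finite word this contradicts that System has stopped; in an infinite one
          -- fairness makes System play that letter, which by saturation had occurred before.
          no-move : ∀ {N} → Saturated w N → ∀ τ → progress full (initial w N) ≢ move τ
          no-move {N} sat τ eq = stuck w refl
            where
            unplayed : sys τ ∉ initial w N
            unplayed = proj₂ (progress-move full eq)

            same-move : ∀ {v} → v ≈ initial w N → strategy v ≡ just τ
            same-move v≈ = cong play (trans (progress-cong v≈ full) eq)

            later : ∀ {N′} → N ≤ N′ → initial w N′ ≈ initial w N
            later N≤ = mk⇔ (λ h → let i , _ , e = ∈-initial w h in subst (_∈ initial w N) e (sat i))
                           (initial-mono w N≤)

            stuck : ∀ w′ → w ≡ w′ → ⊥
            stuck (finite l) refl = case trans (sym (proj₂ compatible)) (same-move (subst (_≈ initial w N)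
              (take-all _ l (ℕ.m≤n⊔m N (length l))) (later (ℕ.m≤m⊔n N (length l))))) of λ ()
            stuck (infinite f) refl = fair
              (λ N′ k → k (N′ ⊔ N , ℕ.m≤m⊔n N′ N , λ none →
                case trans (sym none) (same-move (later (ℕ.m≤n⊔m N′ N))) of λ ()))
              N λ (i , N≤i , τ′ , e) → unplayed (subst (_∈ initial w N)
                (trans e (cong sys (just-injective (trans (sym (proj₁ compatible i τ′ e)) (same-move (later N≤i))))))
                (sat i))

          record Settled : Set where
            field
              N         : ℕ
              saturated : Saturated w N
              es        : List Event
              legal     : Legal es
              complete  : Complete es (initial w N)
              origins   : ∀ τ → sys τ ∈ initial w N → Origin es τ (initial w N)
              final     : es ≡ full ⊎ ¬ All (_∈ initial w N) (demand es)

          settled : ¬ ¬ Settled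
          settled k = saturate w λ (N , sat) → k (settle N sat (progress full (initial w N)) refl)
            where
            settle : ∀ N → Saturated w N → ∀ p → progress full (initial w N) ≡ p → Settled
            settle N sat p eq = go p eq
              where
              os : ∀ τ → sys τ ∈ initial w N → Origin full τ (initial w N)
              os τ h = let i , i<N , e = ∈-initial w h in
                origin-mono full (λ h → initial-mono w (ℕ.<⇒≤ i<N) (subst (_ ∈_) (before≡initial w i) h))
                  (proj₁ (played e))
              go : ∀ p → progress full (initial w N) ≡ p → Settled
              go (move τ) eq = ⊥-elim (no-move sat τ eq)
              go done     eq = record { saturated = sat ; legal = L ; complete = progress-done full eq
                                      ; origins = os ; final = inj₁ refl }
              go waiting  eq with progress-waiting full L eq os
              ... | es , L′ , c , nd , os′ = record { saturated = sat ; legal = L′ ; complete = c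
                                                    ; origins = os′ ; final = inj₂ nd }

          module _ (st : Settled) where
            open Settled st
            open Semantics (marking w)
            open Marking (marking w)

            planned : ∀ {a p} → occurs w a p → (∃ λ i → encode a ≡ inj₁ i) →
                      (∃ λ k → a ≡ inj₂ k × p ≡ π k) ⊎ (∃ λ t → a ≡ inj₁ (fire , t) × (t , p) ∈ es)
                      ⊎ (∃ λ t → a ≡ inj₁ (retire , t) × (t , p) ∈ tail es)
            planned {a} {p} o (i , eq) =
              planned-mark (origin-planned es (origins (i , p)
                (subst (λ b → (b , p) ∈ initial w N) eq (occurs⇒∈ w {a = a} saturated o)))) {a} (cong (_, p) (sym eq))

            inputs⇔ : ∀ {p} → Input p ⇔ IsInput p
            inputs⇔ {p} = mk⇔
              (λ nn → decidable-stable (isInput? p) λ ni → nn λ (k , i , e) →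
                case planned {inj₂ k} (λ f → f (i , e)) (_ , refl) of λ where
                  (inj₁ (k , refl , eq))      → ni (k , sym eq)
                  (inj₂ (inj₁ (_ , () , _)))
                  (inj₂ (inj₂ (_ , () , _))))
              (λ { (k , refl) f → ∈⇒occurs w {a = inj₂ k} (complete-input es complete k) λ (i , e) → f (k , i , e) })

            fired⇔ : ∀ {t p} → Has fire t p ⇔ ((t , p) ∈ es)
            fired⇔ {t} {p} = mk⇔
              (λ o → case planned {inj₁ (fire , t)} o (_ , refl) of λ where
                (inj₁ (_ , () , _))
                (inj₂ (inj₁ (_ , refl , h))) → h
                (inj₂ (inj₂ (_ , () , _))))
              (λ h → ∈⇒occurs w {a = inj₁ (fire , t)} (complete-fired es complete h))

            retired⇔ : ∀ {t p} → Has retire t p ⇔ ((t , p) ∈ tail es)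
            retired⇔ {t} {p} = mk⇔
              (λ o → case planned {inj₁ (retire , t)} o (_ , refl) of λ where
                (inj₁ (_ , () , _))
                (inj₂ (inj₁ (_ , () , _)))
                (inj₂ (inj₂ (_ , refl , h))) → h)
              (λ h → ∈⇒occurs w {a = inj₁ (retire , t)} (complete-retired es complete h))

            good-holds : ⟦ good ⟧ tt
            good-holds ord unacc with es in eq | final
            -- The empty history is never where play ends: its state 0 is not accepting, and it
            -- demands nothing that Environment could withhold.
            ... | [] | inj₁ full≡ = ⊥-elim (acc≢0 (trans (sym acc) (cong state (sym full≡))))
            ... | [] | inj₂ nd    = ⊥-elim (nd [])
            ... | (t , p) ∷ es′ | fin = pending-intro π (marking w) inputs⇔ (subst Legal eq legal)
              (λ {t′} {p′} → subst (λ es → Has fire t′ p′ ⇔ ((t′ , p′) ∈ es)) eq fired⇔)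
              (λ {t′} {p′} → subst (λ es → Has retire t′ p′ ⇔ ((t′ , p′) ∈ tail es)) eq retired⇔)
              (λ {t′} h → ∈⇒occurs w {a = inj₁ (confirm , t′)} (complete-confirmed ((t , p) ∷ es′) c h))
              (λ {t′} h → ∈⇒occurs w {a = inj₁ (close , t′)} (complete-closed ((t , p) ∷ es′) c h))
              (waiting′ fin) ord
              where
              c : Complete ((t , p) ∷ es′) (initial w N)
              c = subst (λ es → Complete es (initial w N)) eq complete

              waiting′ : (t , p) ∷ es′ ≡ full ⊎ ¬ All (_∈ initial w N) (demand ((t , p) ∷ es′)) →
                         ¬ Answered π (marking w) ((t , p) ∷ es′)
              -- With the full history carried out, an answer would confirm its last event, which
              -- leads to `accept`; `unacc` excludes this.
              waiting′ (inj₁ refl) ans = unacc t acc p (confirmed es′ ans)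
                where
                confirmed : ∀ es′ → Answered π (marking w) ((t , p) ∷ es′) → Has confirm t p
                confirmed []      c       = c
                confirmed (_ ∷ _) (c , _) = c
              waiting′ (inj₂ nd) ans = nd (met es′ ans)
                where
                met : ∀ es′ → Answered π (marking w) ((t , p) ∷ es′) →
                      All (_∈ initial w N) (demand ((t , p) ∷ es′))
                met []              c        = occurs⇒∈ w {a = inj₁ (confirm , t)} saturated c ∷ []
                met ((t₁ , _) ∷ _) (c , cl) = occurs⇒∈ w {a = inj₁ (confirm , t)} saturated c ∷
                                              occurs⇒∈ w {a = inj₁ (close , t₁)} saturated cl ∷ []

            placed : ∀ k → ∃ λ p → (∃ λ i → letter w i ≡ (inputLetter k , p)) ×
                                   (∀ j q → letter w j ≡ (inputLetter k , q) → q ≡ p)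
            placed k = π k , (let i , _ , e = ∈-initial w (complete-input es complete k) in i , e) ,
              λ j q e → case planned {inj₂ k} (λ f → f (j , e)) (_ , refl) of λ where
                (inj₁ (_ , refl , eq))      → eq
                (inj₂ (inj₁ (_ , () , _)))
                (inj₂ (inj₂ (_ , () , _)))

          home : ∀ {i k p} → letter w i ≡ (inputLetter k , p) → p ≡ π k
          home {i} {k} {p} e =
            case planned-mark (origin-planned full (proj₁ (played {i} {_ , p} e))) {inj₂ k} refl of λ where
              (inj₁ (_ , refl , eq))      → eq
              (inj₂ (inj₁ (_ , () , _)))
              (inj₂ (inj₂ (_ , () , _)))

          no-repeat : ∀ {i j k p} → letter w i ≡ (inputLetter k , p) → letter w j ≡ (inputLetter k , p) →
                      ¬ index w i < index w j
          no-repeat {i} {j} {k} {p} e e′ lt = proj₂ (played {j} {_ , p} e′)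
            (subst (_∈ before w j) e (subst (letter w i ∈_) (sym (before≡initial w j)) (letter-∈-initial w i lt)))

          -- Each input letter stays at its own process and `π` is injective, so both letters are
          -- the same; and the strategy plays no letter twice.
          apart : ∀ {i j k l p} → letter w i ≡ (inputLetter k , p) → letter w j ≡ (inputLetter l , p) → i ≡ j
          apart {i} {j} e e′ with π-injective (trans (sym (home e)) (home e′))
          ... | refl with ℕ.<-cmp (index w i) (index w j)
          ...   | tri≈ _ eq _ = index-injective w eq
          ...   | tri< lt _ _ = ⊥-elim (no-repeat e e′ lt)
          ...   | tri> _ _ gt = ⊥-elim (no-repeat e′ e gt)

        wins : Winning strategy (sentence x)
        wins w compatible fair = (apart-sat w (apart w compatible fair) ,
          from (sat-translate w good _ tt) (stable (marking w) good tt λ f → settled w compatible fair λ st →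
            f (good-holds w compatible fair st))) ,
          placed-sat w λ k f → settled w compatible fair λ st → f (placed w compatible fair st k)
          where
          open Semantics using (stable)

-- From runs of the machine to the winner of the game

module Reduction where

  open import Data.Bool using (false; if_then_else_)
  open import Data.Empty using (⊥; ⊥-elim)
  open import Data.Fin as Fin using (Fin; zero; suc; _↑ˡ_; _↑ʳ_)
  open import Data.Fin.Properties as Fin using (↑ˡ-injective; ↑ʳ-injective; splitAt-↑ˡ; splitAt-↑ʳ)
  open import Data.List using (List; []; _∷_; _++_; _∷ʳ_)
  open import Data.List.Properties using (++-identityʳ; ∷ʳ-++)
  open import Data.List.Membership.Propositional using (_∈_)
  open import Data.List.Membership.Propositional.Properties using (∈-++⁺ˡ; ∈-++⁺ʳ; ∈-++⁻)
  open import Data.List.Relation.Unary.Any using (here; there)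
  open import Data.Nat as ℕ using (ℕ; zero; suc; _+_)
  import Data.Nat.Properties as ℕ
  import Data.Product.Properties as Product
  open import Data.Product using (∃; _×_; _,_; proj₁; proj₂)
  open import Data.Sum using (inj₁; inj₂; [_,_]′)
  open import Data.Unit using (tt)
  open import Function using (_∘_; case_of_; _⇔_; mk⇔; Equivalence)
  open import Relation.Nullary using (¬_; yes; no; does)
  open import Relation.Nullary.Decidable using (decidable-stable; dec-false)
  open import Relation.Binary.PropositionalEquality

  open Compilation using (Val)
  open Machines
  open ProcessLogic
  open TokenGame
  open Rules
  open Words
  open SystemPlay

  module _ (M : Machine) where
    open Machine M renaming (#trans to m)
    open Specification M using (good; good-fires; Fires)
    open Runs M

    record Initially (x : ℕ) (v : Val) : Set where
      constructor initially
      field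
        at-zero : v 0 ≡ x
        at-suc  : ∀ r → v (suc r) ≡ 0

    module _ {x n : ℕ} (π : Fin x → Fin n) (π-injective : ∀ {k l} → π k ≡ π l → k ≡ l) where
      open Tokens M π

      counts-[] : ∀ {v} → Initially x v → Counts [] v
      counts-[] {v} (initially z s) zero = trans (count-cong at-0) (trans (counts-input π π-injective) (sym z))
        where
        at-0 : ∀ p → holds 0 (status [] p) ≡ does (isInput? p)
        at-0 p with isInput? p
        ... | yes _ = refl
        ... | no _  = refl
      counts-[] {v} (initially z s) (suc r) = trans (count-false at-suc) (sym (s r))
        where
        at-suc : ∀ p → holds (suc r) (status [] p) ≡ false
        at-suc p with isInput? p
        ... | yes _ = refl
        ... | no _  = refl

      -- A step spends at most the process `free zero`, and all others of the supply stay fresh, so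
      -- `k` steps get by with `k` spare processes.
      schedule : ∀ {k es v} → Accepts k (state es , v) → Legal es → Counts es v →
                 (free : Fin k → Fin n) → (∀ {i j} → free i ≡ free j → i ≡ j) →
                 (∀ i → status es (free i) ≡ fresh) → ∃ λ es′ → Legal es′ × state es′ ≡ accept
      schedule {es = es} a = go a refl
        where
        go : ∀ {k es q v} → Accepts k (q , v) → state es ≡ q → Legal es → Counts es v →
             (free : Fin k → Fin n) → (∀ {i j} → free i ≡ free j → i ≡ j) →
             (∀ i → status es (free i) ≡ fresh) → ∃ λ es′ → Legal es′ × state es′ ≡ accept
        go here eq L c free inj fr = _ , L , eq
        go {es = es} (step (t , refl , refl , e) a) eq L c free inj fr =
          let (p , fits , only) , clear = effect-legal {es} {t} (fr zero) e c
              away : ∀ i → free (suc i) ≢ p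
              away i eq = case inj (trans eq (only (subst (λ q → status es q ≡ fresh) eq (fr (suc i))))) of λ ()
          in go a refl (fire L (sym eq) fits clear) (counts-fire {es} {t} {p} fits e c)
               (free ∘ suc) (λ eq → Fin.suc-injective (inj eq))
               (λ i → trans (status-there {t} {es = es} (away i)) (fr (suc i)))

    accepts-synth : ∀ {k x v} → accept ≢ 0 → Initially x v → Accepts k (0 , v) →
                    SharedSynth ⟨ m + m + x , m + m , sentence M x ⟩
    accepts-synth {k} {x} {v} acc≢0 init a =
      let es , L , acc = schedule π π-inj a [] (counts-[] π π-inj init) (x ↑ʳ_) (↑ʳ-injective x _ _) free-at-start
      in x + k , Plan.strategy M π π-inj L acc acc≢0 , Plan.wins M π π-inj L acc acc≢0
      where
      π : Fin x → Fin (x + k)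
      π = _↑ˡ k
      π-inj : ∀ {i j} → π i ≡ π j → i ≡ j
      π-inj = ↑ˡ-injective k _ _
      open Tokens M π
      free-at-start : ∀ i → status [] (x ↑ʳ i) ≡ fresh
      free-at-start i = cong (if_then token 0 else fresh) (dec-false (isInput? (x ↑ʳ i)) λ (j , eq) →
        case trans (sym (splitAt-↑ˡ x j k)) (trans (cong (Fin.splitAt x) eq) (splitAt-↑ʳ x k i)) of λ ())

    module Challenge {x n : ℕ} (S : Game.Strategy (m + m + x) (m + m) n)
                     (winning : Game.Winning (m + m + x) (m + m) n S (sentence M x)) where
      open GameOf M x n
      open Equivalence

      -- Environment falls silent after `u`, and the resulting word is a model because the strategy
      -- wins. The next round branches off from the part of this word up to `N`, which already
      -- contains every letter that occurs.
      record Round (u : List Letter) : Set where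
        field
          word      : Word
          N         : ℕ
          saturated : Saturated word N
          follows   : Follows S (initial word N)
          models    : word ⊨ sentence M x
          extends   : ∀ {a} → a ∈ u → ∃ λ i → letter word i ≡ a
          env-old   : ∀ i a p → letter word i ≡ (inj₂ a , p) → (inj₂ a , p) ∈ u

      round : ∀ {u} → Follows S u → ¬ ¬ Round u
      round {u} F k = continue S u F λ C → let open Continuation C in
        saturate word λ (N , sat) → k (record
          { word = word ; N = N ; saturated = sat ; follows = follows N
          ; models = winning word compatible fair ; extends = extends ; env-old = env-old })

      follows-++ : ∀ {u} v → Follows S u → (∀ {a} → a ∈ v → ∃ λ b → ∃ λ p → a ≡ (inj₂ b , p)) →
                   Follows S (u ++ v)
      follows-++ {u} []      F env = subst (Follows S) (sym (++-identityʳ u)) F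
      follows-++ {u} (a ∷ v) F env = subst (Follows S) (∷ʳ-++ u a v)
        (follows-++ v (follows-∷ʳ F λ τ eq → case trans (sym (proj₂ (proj₂ (env (here refl))))) eq of λ ())
          (env ∘ there))

      module Play (π : Fin x → Fin n) (π-injective : ∀ {k l} → π k ≡ π l → k ≡ l) where
        open Tokens M π
        open Plan M π π-injective using (confirmᴸ; closeᴸ; letter-injective)
        open import Data.List.Membership.DecPropositional
          (Product.≡-dec (Fin._≟_ {m}) (Fin._≟_ {n})) using () renaming (_∈?_ to _∈ᴱ?_)

        start : Legal []
        start = []

        reply : Event → List Event → List Letter
        reply e []       = confirmᴸ e ∷ []
        reply e (e₁ ∷ _) = closeᴸ e₁ ∷ confirmᴸ e ∷ []

        reply-env : ∀ e es {a} → a ∈ reply e es → ∃ λ b → ∃ λ p → a ≡ (inj₂ b , p)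
        reply-env e []      (here refl)         = _ , _ , refl
        reply-env e (_ ∷ _) (here refl)         = _ , _ , refl
        reply-env e (_ ∷ _) (there (here refl)) = _ , _ , refl

        confirm-reply : ∀ e es → confirmᴸ e ∈ reply e es
        confirm-reply e []      = here refl
        confirm-reply e (_ ∷ _) = there (here refl)

        confirm-injective : ∀ {e e′} → confirmᴸ e ≡ confirmᴸ e′ → e ≡ e′
        confirm-injective {t , _} {t′ , _} eq
          with letter-injective {inj₁ (confirm , t)} {inj₁ (confirm , t′)} eq
        ... | refl , refl = refl

        close-injective : ∀ {e e′} → closeᴸ e ≡ closeᴸ e′ → e ≡ e′
        close-injective {t , _} {t′ , _} eq
          with letter-injective {inj₁ (close , t)} {inj₁ (close , t′)} eq
        ... | refl , refl = refl

        confirm≢close : ∀ {e e′} → confirmᴸ e ≢ closeᴸ e′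
        confirm≢close {t , _} {t′ , _} eq
          with letter-injective {inj₁ (confirm , t)} {inj₁ (close , t′)} eq
        ... | () , _

        reply-confirm : ∀ {e e′} es → confirmᴸ e ∈ reply e′ es → e ≡ e′
        reply-confirm []      (here eq)         = confirm-injective eq
        reply-confirm (_ ∷ _) (here eq)         = ⊥-elim (confirm≢close eq)
        reply-confirm (_ ∷ _) (there (here eq)) = confirm-injective eq

        reply-close : ∀ {e e′} es → closeᴸ e ∈ reply e′ es → e ∈ es
        reply-close []      (here eq)         = ⊥-elim (confirm≢close (sym eq))
        reply-close (_ ∷ _) (here eq)         = here (close-injective eq)
        reply-close (_ ∷ _) (there (here eq)) = ⊥-elim (confirm≢close (sym eq))

        record Answers (es : List Event) (u : List Letter) : Set where
          field
            confirms : ∀ {e} → confirmᴸ e ∈ u ⇔ (e ∈ es)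
            closes   : ∀ {e} → closeᴸ e ∈ u ⇔ (e ∈ tail es)
            fires    : ∀ {t p} → (t , p) ∈ es → (embed fire t , p) ∈ u
            retires  : ∀ {t p} → (t , p) ∈ tail es → (embed retire t , p) ∈ u

        -- By recursion on the rejection. A model must contain a further legal event; this is a step
        -- of the machine, to a configuration that rejects again, and Environment answers it in the
        -- next round.
        loses : ∀ {es v u} → Rejects (state es , v) → Legal es → Counts es v →
                (∀ {t p} → (t , p) ∈ es → dst t ≢ accept) → Answers es u → (R : Round u) →
                (∀ {k p} → occurs (Round.word R) (inj₂ k) p ⇔ (π k ≡ p)) → ⊥
        loses {es} {v} {u} (rejects _ next) L c undecided A R placed =
          good-fires π (marking word) inputs⇔ L confirmed⇔ closed⇔ fired retired undecided good′ go-on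
          where
          open Answers A
          open Round R
          open Marking (marking word)
          open Semantics (marking word)

          good′ : ⟦ good ⟧ tt
          good′ = to (sat-translate word good _ tt) (proj₂ (proj₁ models))

          occurring : ∀ {a p} → (encode a , p) ∈ u → occurs word a p
          occurring h f = f (extends h)

          inputs⇔ : ∀ {p} → Input p ⇔ IsInput p
          inputs⇔ {p} = mk⇔
            (λ nn → decidable-stable (isInput? p) λ ni → nn λ (k , i , e) → ni (k , to placed λ f → f (i , e)))
            (λ (k , eq) f → from placed eq λ (i , e) → f (k , i , e))

          confirmed⇔ : ∀ {t p} → Has confirm t p ⇔ ((t , p) ∈ es)
          confirmed⇔ {t} {p} = mk⇔
            (λ nn → decidable-stable ((t , p) ∈ᴱ? es) λ ni → nn λ (i , e) → ni (to (confirms {t , p}) (env-old i _ p e)))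
            (λ h → occurring {inj₁ (confirm , t)} (from (confirms {t , _}) h))

          closed⇔ : ∀ {t p} → Has close t p ⇔ ((t , p) ∈ tail es)
          closed⇔ {t} {p} = mk⇔
            (λ nn → decidable-stable ((t , p) ∈ᴱ? tail es) λ ni → nn λ (i , e) → ni (to (closes {t , p}) (env-old i _ p e)))
            (λ h → occurring {inj₁ (close , t)} (from (closes {t , _}) h))

          fired : ∀ {t p} → (t , p) ∈ es → Has fire t p
          fired {t} h = occurring {inj₁ (fire , t)} (fires h)

          retired : ∀ {t p} → (t , p) ∈ tail es → Has retire t p
          retired {t} h = occurring {inj₁ (retire , t)} (retires h)

          go-on : ¬ Fires π (marking word) inputs⇔ es
          go-on ((t , p) , L′@(fire _ follow fits clear) , fired⇔ , retired⇔) =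
            round {u′} (follows-++ (reply (t , p) es) follows (reply-env (t , p) es)) λ R′ →
              loses {(t , p) ∷ es} (next (dst t , v′) (t , follow , refl , e)) L′ (counts-fire {es} {t} {p} fits e c) undecided′ answers R′ (placed′ R′)
            where
            effect = legal-effect {es} {t} {p} fits clear c
            v′ = proj₁ effect
            e = proj₂ effect

            rej : Rejects (dst t , v′)
            rej = next (dst t , v′) (t , follow , refl , e)

            u′ : List Letter
            u′ = initial word N ++ reply (t , p) es

            seen : ∀ {a q} → (encode a , q) ∈ initial word N → occurs word a q
            seen {a} = ∈⇒occurs word {a = a}

            listed : ∀ {a q} → occurs word a q → (encode a , q) ∈ initial word N
            listed {a} = occurs⇒∈ word {a = a} saturated

            undecided′ : ∀ {t′ p′} → (t′ , p′) ∈ (t , p) ∷ es → dst t′ ≢ accept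
            undecided′ (here refl) = case rej of λ { (rejects na _) → na }
            undecided′ (there h)   = undecided h

            answers : Answers ((t , p) ∷ es) u′
            answers = record
              { confirms = λ {e} → mk⇔
                  (λ h → case ∈-++⁻ (initial word N) h of λ where
                    (inj₁ h) → there (to confirmed⇔ (seen {inj₁ (confirm , proj₁ e)} h))
                    (inj₂ h) → here (reply-confirm es h))
                  (λ { (here refl) → ∈-++⁺ʳ (initial word N) (confirm-reply (t , p) es)
                     ; (there h) → ∈-++⁺ˡ (listed {inj₁ (confirm , proj₁ e)} (from confirmed⇔ h)) })
              ; closes = λ {e} → mk⇔
                  (λ h → case ∈-++⁻ (initial word N) h of λ where
                    (inj₁ h) → weaken es (to closed⇔ (seen {inj₁ (close , proj₁ e)} h))
                    (inj₂ h) → reply-close es h)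
                  (close-listed es (from closed⇔))
              ; fires   = λ {t′} h → ∈-++⁺ˡ (listed {inj₁ (fire , t′)} (from fired⇔ h))
              ; retires = λ {t′} h → ∈-++⁺ˡ (listed {inj₁ (retire , t′)} (from retired⇔ h))
              }
              where
              weaken : ∀ es {e} → e ∈ tail es → e ∈ es
              weaken (_ ∷ _) h = there h
              close-listed : ∀ es → (∀ {t p} → (t , p) ∈ tail es → Has close t p) → ∀ {e} → e ∈ es →
                             closeᴸ e ∈ initial word N ++ reply (t , p) es
              close-listed (_ ∷ _) cl (here refl) = ∈-++⁺ʳ (initial word N) (here refl)
              close-listed (_ ∷ _) cl {t′ , _} (there h) = ∈-++⁺ˡ (listed {inj₁ (close , t′)} (cl h))

            -- Input letters once played remain in the next word, and `inputs` confines each of them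
            -- to one process. So the placement read off in the first round stays valid.
            placed′ : (R′ : Round u′) → ∀ {k q} → occurs (Round.word R′) (inj₂ k) q ⇔ (π k ≡ q)
            placed′ R′ {k} {q} = mk⇔
              (λ nn → decidable-stable (π k Fin.≟ q) λ ne → nn λ (j , e) →
                sat-placed (Round.word R′) (proj₂ (Round.models R′)) k λ (_ , _ , unique) →
                  still refl λ (i , e′) → ne (trans (unique i _ e′) (sym (unique j _ e))))
              still
              where
              still : ∀ {q} → π k ≡ q → occurs (Round.word R′) (inj₂ k) q
              still eq f = f (Round.extends R′ (∈-++⁺ˡ (listed {inj₂ k} (from placed eq))))

    ¬¬-all : ∀ {k} {P : Fin k → Set} → (∀ i → ¬ ¬ P i) → ¬ ¬ (∀ i → P i)
    ¬¬-all {zero}  h f = f λ ()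
    ¬¬-all {suc k} h f = h zero λ p → ¬¬-all (h ∘ suc) λ ps → f λ { zero → p ; (suc i) → ps i }

    rejects-synth : ∀ {x v} → Initially x v → Rejects (0 , v) →
                    ¬ SharedSynth ⟨ m + m + x , m + m , sentence M x ⟩
    rejects-synth {x} init rej (n , S , winning) = round follows-[] λ R →
      -- The round with empty past reveals where System puts the input letters. Only finitely many
      -- processes are chosen, so the choices can be made together under the double negation.
      ¬¬-all (sat-placed (Round.word R) (proj₂ (Round.models R))) λ home →
        let open Round R
            π : Fin x → Fin n
            π k = proj₁ (home k)
            π-inj : ∀ {k l} → π k ≡ π l → k ≡ l
            π-inj {k} {l} eq = sat-apart word (proj₁ (proj₁ models))
              (trans (proj₂ (proj₁ (proj₂ (home k)))) (cong (inputLetter k ,_) eq)) (proj₂ (proj₁ (proj₂ (home l))))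
        in Play.loses π π-inj {es = []} rej (Play.start π π-inj) (counts-[] π π-inj init) (λ ())
             (record { confirms = mk⇔ (λ ()) (λ ()) ; closes = mk⇔ (λ ()) (λ ()) ; fires = λ () ; retires = λ () })
             R λ {k} {p} → mk⇔
               (λ nn → decidable-stable (π k Fin.≟ p) λ ne → nn λ (i , e) → ne (sym (proj₂ (proj₂ (home k)) i p e)))
               (λ { refl f → f (proj₁ (proj₂ (home k))) })
      where
      open Challenge S winning
      open GameOf M x n

-- Computing the codes of instances

open import Data.Fin as Fin using (Fin; zero; suc; toℕ; fromℕ; inject₁; _↑ʳ_)
open import Data.Fin.Properties using (toℕ-fromℕ; toℕ-inject₁; toℕ-↑ʳ)
open import Data.Nat as ℕ using (ℕ; zero; suc; _+_; _*_; _^_; _≤_; s≤s; z≤n)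
import Data.Nat.Properties as ℕ
open import Data.Product using (∃; _×_; _,_)
open import Data.Sum using (_⊎_; inj₁; inj₂; [_,_]′)
open import Data.Unit using (tt)
open import Data.Vec as Vec using (Vec; []; _∷_)
open import Data.Vec.Relation.Binary.Pointwise.Inductive using (Pointwise; []; _∷_)
open import Function using (_∘_)
open import Relation.Nullary using (¬_)
open import Relation.Binary.PropositionalEquality

open Compilation
open Machines
open ProcessLogic
open Rules
open SystemPlay
open Reduction

constᴿ : ∀ {k} → ℕ → Rec k
constᴿ zero    = compᴿ zeroᴿ []
constᴿ (suc n) = compᴿ sucᴿ (constᴿ n ∷ [])

const-⇓ : ∀ {k} n {xs : Vec ℕ k} → constᴿ n [ xs ]⇓ n
const-⇓ zero    = ⇓comp [] ⇓zero
const-⇓ (suc n) = ⇓comp (const-⇓ n ∷ []) ⇓suc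

addᴿ mulᴿ : Rec 2
addᴿ = precᴿ (projᴿ zero) (compᴿ sucᴿ (projᴿ (suc zero) ∷ []))
mulᴿ = precᴿ (constᴿ 0) (compᴿ addᴿ (projᴿ (suc (suc zero)) ∷ projᴿ (suc zero) ∷ []))

add-⇓ : ∀ x y → addᴿ [ x ∷ y ∷ [] ]⇓ (x + y)
add-⇓ zero    y = ⇓prec-zero ⇓proj
add-⇓ (suc x) y = ⇓prec-suc (add-⇓ x y) (⇓comp (⇓proj ∷ []) ⇓suc)

mul-⇓ : ∀ x y → mulᴿ [ x ∷ y ∷ [] ]⇓ (x * y)
mul-⇓ zero    y = ⇓prec-zero (const-⇓ 0)
mul-⇓ (suc x) y = ⇓prec-suc (mul-⇓ x y) (⇓comp (⇓proj ∷ ⇓proj ∷ []) (add-⇓ y (x * y)))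

2^ᴿ : Rec 1
2^ᴿ = precᴿ (constᴿ 1) (compᴿ mulᴿ (constᴿ 2 ∷ projᴿ (suc zero) ∷ []))

2^-⇓ : ∀ n → 2^ᴿ [ n ∷ [] ]⇓ (2 ^ n)
2^-⇓ zero    = ⇓prec-zero (const-⇓ 1)
2^-⇓ (suc n) = ⇓prec-suc (2^-⇓ n) (⇓comp (const-⇓ 2 ∷ ⇓proj ∷ []) (mul-⇓ 2 (2 ^ n)))

_+ᴿ_ pairᴿ : ∀ {k} → Rec k → Rec k → Rec k
f +ᴿ g    = compᴿ addᴿ (f ∷ g ∷ [])
pairᴿ f g = compᴿ mulᴿ (compᴿ 2^ᴿ (f ∷ []) ∷ compᴿ sucᴿ (compᴿ mulᴿ (constᴿ 2 ∷ g ∷ []) ∷ []) ∷ [])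

+-⇓ : ∀ {k} {f g : Rec k} {xs a b} → f [ xs ]⇓ a → g [ xs ]⇓ b → (f +ᴿ g) [ xs ]⇓ (a + b)
+-⇓ df dg = ⇓comp (df ∷ dg ∷ []) (add-⇓ _ _)

pair-⇓ : ∀ {k} {f g : Rec k} {xs} a b → f [ xs ]⇓ a → g [ xs ]⇓ b → pairᴿ f g [ xs ]⇓ pair a b
pair-⇓ a b df dg = ⇓comp (⇓comp (df ∷ []) (2^-⇓ a) ∷
  ⇓comp (⇓comp (const-⇓ 2 ∷ dg ∷ []) (mul-⇓ 2 b) ∷ []) ⇓suc ∷ []) (mul-⇓ (2 ^ a) (1 + 2 * b))

node-⇓ : ∀ {k} {f g : Rec k} {xs} s t → f [ xs ]⇓ number s → g [ xs ]⇓ number t →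
         pairᴿ f g [ xs ]⇓ number (node s t)
node-⇓ s t = pair-⇓ (number s) (number t)

leaf-⇓ : ∀ {k} n {xs : Vec ℕ k} → constᴿ n [ xs ]⇓ number (leaf n)
leaf-⇓ = const-⇓

-- A tree with a number left open: the function that computes its code, and the proof about it, come
-- by recursion on the pattern.
data Pattern : Set where
  hole : Pattern
  leaf : ℕ → Pattern
  node : Pattern → Pattern → Pattern

fill : Pattern → ℕ → Tree
fill hole       n = leaf n
fill (leaf l)   n = leaf l
fill (node p q) n = node (fill p n) (fill q n)

patternᴿ : ∀ {k} → Pattern → Rec k → Rec k
patternᴿ hole       f = f
patternᴿ (leaf l)   f = constᴿ l
patternᴿ (node p q) f = pairᴿ (patternᴿ p f) (patternᴿ q f)

pattern-⇓ : ∀ {k} p {f : Rec k} {xs n} → f [ xs ]⇓ n → patternᴿ p f [ xs ]⇓ number (fill p n)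
pattern-⇓ hole       d = d
pattern-⇓ (leaf l)   d = leaf-⇓ l
pattern-⇓ (node p q) {n = n} d = node-⇓ (fill p n) (fill q n) (pattern-⇓ p d) (pattern-⇓ q d)

-- tree (Translation.atOneProcess m x (inj₁ i)), with a hole for i.
onceᴾ : Pattern
onceᴾ = node (leaf 9) (node (leaf 0) (node (leaf 7) (node (actᴾ 0)
  (node (leaf 10) (node (leaf 1) (node (leaf 6) (node (leaf 7) (node (actᴾ 1)
    (node (leaf 6) (node (leaf 2) (node (leaf 0) (leaf 1))))))))))))
  where
  actᴾ : ℕ → Pattern
  actᴾ u = node (leaf 0) (node (node (leaf 0) hole) (leaf u))

truthᴾ : Pattern
truthᴾ = node (leaf 10) (node (leaf 0) (node (leaf 1) (node (leaf 0) (leaf 0))))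

-- The arguments are the number of conjuncts and `m + m`, the number of the first input letter.
-- Conjunct `k` concerns the letter `m + m + k`, and 7 is the tag of `conj`; the recursion adds
-- conjuncts in front, just as `⋀` does.
inputsᴿ : Rec 2
inputsᴿ = precᴿ (patternᴿ truthᴾ (projᴿ zero))
  (pairᴿ (constᴿ 7) (pairᴿ (patternᴿ onceᴾ (projᴿ (suc (suc zero)) +ᴿ projᴿ zero)) (projᴿ (suc zero))))

inputs-suc : ∀ {k s} t r → inputsᴿ [ k ∷ s ∷ [] ]⇓ number r →
             patternᴿ onceᴾ (projᴿ (suc (suc zero)) +ᴿ projᴿ zero) [ k ∷ number r ∷ s ∷ [] ]⇓ number t →
             inputsᴿ [ suc k ∷ s ∷ [] ]⇓ number (node (leaf 7) (node t r))
inputs-suc t r d first = ⇓prec-suc d (node-⇓ (leaf 7) (node t r) (leaf-⇓ 7) (node-⇓ t r first ⇓proj))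

inputs-⇓ : ∀ m x → inputsᴿ [ x ∷ m + m ∷ [] ]⇓ number (tree (Translation.inputs m x))
inputs-⇓ m x = conjunction x (atOneProcess ∘ inputLetter) λ k →
  cong (fill onceᴾ) (toℕ-↑ʳ (m + m) k)
  where
  open Translation m x
  conjunction : ∀ k (φ : Fin k → Form ∅) → (∀ i → tree (φ i) ≡ fill onceᴾ (m + m + toℕ i)) →
                inputsᴿ [ k ∷ m + m ∷ [] ]⇓ number (tree (⋀ k φ))
  conjunction zero    φ eq = ⇓prec-zero (subst (λ t → patternᴿ truthᴾ (projᴿ zero) [ m + m ∷ [] ]⇓ number t)
    {x = fill truthᴾ (m + m)} refl (pattern-⇓ truthᴾ {n = m + m} (⇓proj {i = zero})))
  conjunction (suc k) φ eq = subst (λ t → inputsᴿ [ suc k ∷ m + m ∷ [] ]⇓ number t)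
    {x = node (leaf 7) (node last rest)} refl
    (inputs-suc last rest
      (conjunction k (φ ∘ inject₁) λ i → trans (eq (inject₁ i)) (cong (λ j → fill onceᴾ (m + m + j)) (toℕ-inject₁ i)))
      (subst (λ t → patternᴿ onceᴾ (projᴿ (suc (suc zero)) +ᴿ projᴿ zero)
                      [ k ∷ number rest ∷ m + m ∷ [] ]⇓ number t)
        (sym (trans (eq (fromℕ k)) (cong (λ j → fill onceᴾ (m + m + j)) (toℕ-fromℕ k))))
        (pattern-⇓ onceᴾ {n = m + m + k} (+-⇓ ⇓proj ⇓proj))))
    where
    last rest : Tree
    last = tree (φ (fromℕ k))
    rest = tree (⋀ k (φ ∘ inject₁))

tree-template : ∀ M x → tree (template M x) ≡ tree (template M 0)
tree-template M x = cong₂ (λ s t → node (leaf 7) (node s t))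
  (tree-inputsApart m x) (tree-translate m x (Specification.good M) tt)
  where m = Machine.#trans M

number-conj : ∀ φ s t t′ → φ ≡ node (leaf 7) (node s t) → s ≡ t′ → number φ ≡ pair 7 (pair (number t′) (number t))
number-conj _ s t _ refl refl = number-node₂ 7 s t {number s} {number t} refl refl

number-sentence : ∀ M x → number (tree (sentence M x)) ≡
  pair 7 (pair (number (tree (template M 0))) (number (tree (Translation.inputs (Machine.#trans M) x))))
number-sentence M x = number-conj (tree (sentence M x)) (tree (template M x))
  (tree (Translation.inputs (Machine.#trans M) x)) (tree (template M 0)) refl (tree-template M x)

code-instance : ∀ s e (φ : Sentence s e) n → number (tree φ) ≡ n →
                codeInstance ⟨ s , e , φ ⟩ ≡ pair s (pair e n)
code-instance s e φ _ refl = cong (λ n → pair s (pair e n)) (sym (number-tree φ))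

instanceOf : Machine → ℕ → Instance
instanceOf M x = let m = Machine.#trans M in ⟨ m + m + x , m + m , sentence M x ⟩

code-instanceOf : ∀ M x → let m = Machine.#trans M in codeInstance (instanceOf M x) ≡
  pair (m + m + x) (pair (m + m) (pair 7 (pair (number (tree (template M 0)))
                                               (number (tree (Translation.inputs m x))))))
code-instanceOf M x = let m = Machine.#trans M in code-instance (m + m + x) (m + m) (sentence M x)
  (pair 7 (pair (number (tree (template M 0))) (number (tree (Translation.inputs m x)))))
  (number-sentence M x)

-- The self-referential machine and the diagonal argument

incs : ℕ → ℕ → Cmd
incs zero    r = skip
incs (suc a) r = inc r ⨾ incs a r

size-incs : ∀ a r → size (incs a r) ≡ a
size-incs zero    r = refl
size-incs (suc a) r = cong suc (size-incs a r)

incs-exec : ∀ a r v → ∃ λ v′ → Exec (incs a r) v v′ × v′ r ≡ v r + a × (∀ s → s ≢ r → v′ s ≡ v s)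
incs-exec zero    r v = v , skip , sym (ℕ.+-identityʳ (v r)) , λ _ _ → refl
incs-exec (suc a) r v with incs-exec a r (v [ r ≔ suc (v r) ])
... | v′ , ex , at-r , keep = v′ , inc ⨾ ex ,
  trans at-r (trans (cong (_+ a) (upd-same v r)) (sym (ℕ.+-suc (v r) a))) ,
  λ s s≢r → trans (keep s s≢r) (upd-other v s≢r)

-- The second argument `a` is the size of the main program. With `a` instructions to load it and one
-- final test there are `a + a + 1` instructions, two transitions for each, and each player has two
-- marks per transition. The first argument serves both as the code of the template and as the
-- number of input letters: this is the diagonal.
lettersᴿ questionᴿ : Rec 2
lettersᴿ = l +ᴿ l
  where
  a = projᴿ (suc zero)
  l = ((a +ᴿ a) +ᴿ constᴿ 1) +ᴿ ((a +ᴿ a) +ᴿ constᴿ 1)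
questionᴿ = pairᴿ (lettersᴿ +ᴿ projᴿ zero) (pairᴿ lettersᴿ (pairᴿ (constᴿ 7)
  (pairᴿ (projᴿ zero) (compᴿ inputsᴿ (projᴿ zero ∷ lettersᴿ ∷ [])))))

letters-⇓ : ∀ c a {m} → (a + a + 1) + (a + a + 1) ≡ m → lettersᴿ [ c ∷ a ∷ [] ]⇓ (m + m)
letters-⇓ c a refl = +-⇓ l l
  where
  l′ : ((projᴿ (suc zero) +ᴿ projᴿ (suc zero)) +ᴿ constᴿ 1) [ c ∷ a ∷ [] ]⇓ (a + a + 1)
  l′ = +-⇓ (+-⇓ (⇓proj {i = suc zero}) (⇓proj {i = suc zero})) (const-⇓ 1)
  l = +-⇓ l′ l′

question-⇓ : ∀ c a {m} → (a + a + 1) + (a + a + 1) ≡ m → questionᴿ [ c ∷ a ∷ [] ]⇓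
  pair (m + m + c) (pair (m + m) (pair 7 (pair c (number (tree (Translation.inputs m c))))))
question-⇓ c a {m} eq =
  pair-⇓ (m + m + c) (pair (m + m) (pair 7 (pair c i))) (+-⇓ s (⇓proj {i = zero}))
    (pair-⇓ (m + m) (pair 7 (pair c i)) s
      (pair-⇓ 7 (pair c i) (const-⇓ 7)
        (pair-⇓ c i (⇓proj {i = zero}) (⇓comp (⇓proj {i = zero} ∷ s ∷ []) (inputs-⇓ m c)))))
  where
  s = letters-⇓ c a eq
  i = number (tree (Translation.inputs m c))

question-instance : ∀ M c a → number (tree (template M 0)) ≡ c →
  (a + a + 1) + (a + a + 1) ≡ Machine.#trans M → questionᴿ [ c ∷ a ∷ [] ]⇓ codeInstance (instanceOf M c)
question-instance M c a refl m≡ = subst (λ n → questionᴿ [ c ∷ a ∷ [] ]⇓ n) (sym (code-instanceOf M c))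
  (question-⇓ c a m≡)

-- The machine first loads the size of rest into register 1: from it one can
-- compute how many letters the game of the machine has.
preloaded : Cmd → Machine
preloaded rest = assemble (incs (size rest) 1 ⨾ rest) 2

preloaded-#trans : ∀ rest → let a = size rest in (a + a + 1) + (a + a + 1) ≡ Machine.#trans (preloaded rest)
preloaded-#trans rest = cong (λ l → l + l) (sym (trans (length-program (incs (size rest) 1 ⨾ rest) 2)
  (cong (λ b → b + size rest + 1) (size-incs (size rest) 1))))

start : ℕ → Val
start c zero    = c
start c (suc _) = 0

preloaded-run : ∀ rest c r →
  (∀ v → Ready (0 ∷ 1 ∷ []) (c ∷ size rest ∷ []) 2 3 v → Sets rest v 2 r) →
  ∃ λ v → Exec (incs (size rest) 1 ⨾ rest) (start c) v × v 2 ≡ r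
preloaded-run rest c r correct =
  let v₁ , e₁ , v₁1 , keep₁ = incs-exec (size rest) 1 (start c)
      v₂ , e₂ , v₂2 , _ = correct v₁
        (ready ℕ.≤-refl (λ { zero → s≤s z≤n ; (suc zero) → s≤s (s≤s z≤n) })
          (λ { zero → λ () ; (suc zero) → λ () }) (keep₁ 2 λ ())
          (λ { (suc (suc s)) _ → keep₁ (suc (suc s)) λ () ; (suc zero) (s≤s ()) })
          (λ { zero → keep₁ 0 λ () ; (suc zero) → v₁1 }))
  in v₂ , e₁ ⨾ e₂ , v₂2

module _ (f : Rec 1) (rest : Cmd) (c : ℕ)
  (rest-asks : ∀ {r v} → compᴿ f (questionᴿ ∷ []) [ c ∷ size rest ∷ [] ]⇓ r →
               Ready (0 ∷ 1 ∷ []) (c ∷ size rest ∷ []) 2 3 v → Sets rest v 2 r)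
  (c≡ : number (tree (template (preloaded rest) 0)) ≡ c) where
  private
    run : ∀ {r} → f [ codeInstance (instanceOf (preloaded rest) c) ∷ [] ]⇓ r →
          ∃ λ v → Exec (incs (size rest) 1 ⨾ rest) (start c) v × v 2 ≡ r
    run {r} d = preloaded-run rest c r λ v → rest-asks
      (⇓comp (question-instance (preloaded rest) c (size rest) c≡ (preloaded-#trans rest) ∷ []) d)

  -- The machine refutes either answer given about its own instance: the answer 1 leaves a positive
  -- value in register 2, on which it gets stuck, and the answer 0 makes it accept.
  undecided : ¬ (f [ codeInstance (instanceOf (preloaded rest) c) ∷ [] ]⇓ 1 × SharedSynth (instanceOf (preloaded rest) c) ⊎
                 f [ codeInstance (instanceOf (preloaded rest) c) ∷ [] ]⇓ 0 × ¬ SharedSynth (instanceOf (preloaded rest) c))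
  undecided (inj₁ (d , wins)) = let v , e , v2 = run d in
    rejects-synth (preloaded rest) (initially refl λ _ → refl) (rejects-pos e v2) wins
  undecided (inj₂ (d , ¬wins)) = let v , e , v2 = run d ; k , acc = accepts e v2 in
    -- The accepting state has the form `2 + size c`, so it is not the initial state 0; register 0
    -- holds `c` and all others start at 0.
    ¬wins (accepts-synth (preloaded rest) (λ ()) (initially refl λ _ → refl) acc)

asking : Rec 1 → Cmd
asking f = compile (compᴿ f (questionᴿ ∷ [])) (0 ∷ 1 ∷ []) 2 3

theorem5 : Undecidable codeInstance SharedSynth
theorem5 (f , decides) = undecided f (asking f) (number (tree (template (preloaded (asking f)) 0)))
  (λ d R → compile-correct (compᴿ f (questionᴿ ∷ [])) R d) refl
  (decides (instanceOf (preloaded (asking f)) (number (tree (template (preloaded (asking f)) 0)))))
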